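{- A maximal matching in an $n$-node graph $G=(V,E)$ of maximum degree $\Delta$ can be computed deterministically in $O(\log^2\Delta\cdot\log n)$ rounds in the $\mathsf{CONGEST}$ model.
   Context: $\mathsf{CONGEST}$ model: the network is $G$; nodes have unique $O(\log n)$-bit identifiers; in each synchronous round each node may send an $O(\log n)$-bit message to each neighbor; at the end each node knows which of its incident edges are in the matching. A maximal matching is a set of pairwise disjoint edges such that every edge of $G$ shares an endpoint with some edge of the set. -}

module Defs where

open import Data.Nat using (ℕ; zero; suc; _+_; _*_; _^_; _≤_; _<_; _≡ᵇ_)
open import Data.Nat.Logarithm using (⌊log₂_⌋)
open import Data.Bool using (Bool; true; false; _∧_; if_then_else_)
open import Data.Fin using (Fin)
open import Data.List using (List; allFin; map; foldr)
open import Data.Nat.ListAction using (sum)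
open import Data.Bool.ListAction using (any)
open import Data.Maybe using (Maybe; nothing)
open import Data.Vec using (Vec)
open import Data.Product using (Σ; ∃; _×_)
open import Data.Sum using (_⊎_)
open import Relation.Binary.PropositionalEquality using (_≡_)

record Graph (n : ℕ) : Set where
  field
    adj    : Fin n → Fin n → Bool
    sym    : ∀ u v → adj u v ≡ adj v u
    irrefl : ∀ v → adj v v ≡ false
open Graph public

degree : ∀ {n} → Graph n → Fin n → ℕ
degree {n} G v = sum (map (λ u → if adj G v u then 1 else 0) (allFin n))

MaxDegree : ∀ {n} → Graph n → ℕ → Set
MaxDegree G Δ = (∀ v → degree G v ≤ Δ) × ∃ λ v → degree G v ≡ Δ

-- Unique identifiers of O(log n) bits: injective, and bounded by n^k
IdAssignment : (n k : ℕ) → Set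
IdAssignment n k =
  Σ (Fin n → ℕ) λ id → (∀ u v → id u ≡ id v → u ≡ v) × (∀ v → id v < n ^ k)

-- Deterministic CONGEST algorithms.
-- Nodes know n and Δ, their own ID and the set of IDs of their neighbours
-- (as a membership test).  Neighbours are addressed by their IDs.
-- Messages are bit strings of exactly  bandwidth * (1 + ⌊log₂ n⌋)  bits
-- (or no message), i.e. O(log n) bits.  Local computation is unbounded.

msgLen : ℕ → ℕ → ℕ
msgLen B n = B * suc ⌊log₂ n ⌋

record CongestAlg : Set₁ where
  field
    bandwidth : ℕ
    State     : ℕ → ℕ → Set
    rounds    : ℕ → ℕ → ℕ
    init      : ∀ n Δ → (myId : ℕ) → (nbrIds : ℕ → Bool) → State n Δ
    send      : ∀ {n Δ} → State n Δ → (toId : ℕ) → Maybe (Vec Bool (msgLen bandwidth n))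
    recv      : ∀ {n Δ} → State n Δ → (inbox : ℕ → Maybe (Vec Bool (msgLen bandwidth n))) → State n Δ
    -- output: is the incident edge to the neighbour with the given ID matched?
    out       : ∀ {n Δ} → State n Δ → (nbrId : ℕ) → Bool
open CongestAlg public

module Execution (A : CongestAlg) {n : ℕ} (Δ : ℕ) (G : Graph n) (id : Fin n → ℕ) where

  nbrIds : Fin n → ℕ → Bool
  nbrIds v j = any (λ u → adj G v u ∧ (id u ≡ᵇ j)) (allFin n)

  state : ℕ → Fin n → State A n Δ
  state zero    v = init A n Δ (id v) (nbrIds v)
  state (suc r) v = recv A (state r v) inbox
    where
    inbox : ℕ → Maybe (Vec Bool (msgLen (bandwidth A) n))
    inbox j = foldr (λ u rest → if adj G v u ∧ (id u ≡ᵇ j)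
                                  then send A (state r u) (id v) else rest)
                    nothing (allFin n)

  final : Fin n → State A n Δ
  final = state (rounds A n Δ)

  InM : Fin n → Fin n → Set
  InM u v = (adj G u v ≡ true) × (out A (final u) (id v) ≡ true)

  OutputsMaximalMatching : Set
  OutputsMaximalMatching =
    (∀ u v → adj G u v ≡ true → out A (final u) (id v) ≡ out A (final v) (id u))
    × (∀ u v w → InM u v → InM u w → v ≡ w)
    × (∀ u v → adj G u v ≡ true → (∃ λ w → InM u w) ⊎ (∃ λ w → InM v w))

SolvesMaximalMatchingInRounds : (k : ℕ) → CongestAlg → ℕ → Set
SolvesMaximalMatchingInRounds k A c =
  ∀ n Δ (G : Graph n) → MaxDegree G Δ → (ids : IdAssignment n k) →
    (rounds A n Δ ≤ c * (suc ⌊log₂ Δ ⌋ * suc ⌊log₂ Δ ⌋) * suc ⌊log₂ n ⌋)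
    × Execution.OutputsMaximalMatching A Δ G (Σ.proj₁ ids)

{-# OPTIONS --safe #-}
module Submission where

-- In a phase, let w e be one plus the number of surviving edges adjacent to e, and give e the value
-- x e ≈ 1 / (8 w e).  Then Σ w e x e is a constant fraction of the number of surviving edges, and it
-- exceeds twice the cost Σ (w e + w f) x e x f over adjacent pairs.  Both are multilinear, so their
-- difference survives in expectation when the edges of smallest value are independently doubled or
-- dropped; after L = O(log Δ) such levels the values are 0 and 1, and the isolated chosen edges form a
-- matching which meets a constant fraction of the survivors.  O(log n) phases exhaust the graph.
--
-- A level is derandomised by conditional expectations along a colouring of the edges with O(L)
-- classes in which a 1 / (8 L) fraction of the cost is monochromatic.  Its classes are obtained by
-- O(log L) successive splittings, each again by conditional expectations along a colouring with
-- polylogarithmically many classes and defect 1 / O(log L); the latter comes from a proper colouring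
-- with poly(Δ) colours, computed once, by reading colours as lines and moving to points on them.
-- The number of rounds per level is thus O(L).

open import Defs renaming (sym to adj-sym)
open import Data.Bool using (Bool; true; false; _∧_; _∨_; _xor_; not; if_then_else_; T)
open import Data.Bool.ListAction using (any)
open import Data.Empty using (⊥; ⊥-elim)
open import Data.Fin using (Fin; toℕ) renaming (zero to fzero; suc to fsuc)
import Data.Fin.Properties as Fin
open import Data.List using (List; []; _∷_; _++_; map; foldr; allFin; tabulate; downFrom; cartesianProduct; length)
open import Data.List.Membership.Propositional using (_∈_)
open import Data.List.Membership.Propositional.Properties using (∈-allFin)
open import Data.List.Properties using (map-tabulate; length-tabulate; map-++)
open import Data.List.Relation.Unary.Any using (here; there)
open import Data.Maybe using (Maybe; just; nothing)
open import Data.Nat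
open import Data.Nat.DivMod
open import Data.Nat.Induction using (<-rec)
open import Data.Nat.ListAction using (sum)
open import Data.Nat.ListAction.Properties using (sum-++)
open import Data.Nat.Logarithm
open import Data.Nat.Properties
open import Data.Nat.Tactic.RingSolver using (solve-∀)
open import Data.Product using (Σ; ∃; _×_; _,_; proj₁; proj₂)
open import Data.Sum using (_⊎_; inj₁; inj₂)
open import Data.Vec using (Vec; []; _∷_)
open import Function using (_∘_; id)
open import Relation.Binary.PropositionalEquality hiding (J)
open import Relation.Nullary using (¬_; Dec; yes; no; does)
open import Relation.Nullary.Decidable using (map′; _×-dec_; dec-true; dec-false)

-- Finite sums

-- The round budget shapes the proof. O(log n) phases of L levels leave O(L) rounds per level,
-- whereas sweeping a proper colouring takes poly(Δ) rounds, and a colouring by lines of defect 1 /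
-- O(L) has at least about L^3 classes. So the classes of a level are not read off such a colouring
-- but made by splitting, where the defect need only be 1 / O(log L). The polynomial loss then falls
-- on J = O(log L), and a power of J is O(2^J) = O(L).
--
-- All arithmetic is integral: values are multiples of 2^-L, and inequalities between differences
-- are rearranged into inequalities between sums.
--
-- Each edge of G is represented by both ordered pairs. The resulting line graph is that of a
-- bipartite graph, so adjacency means sharing a row or sharing a column, and each of the two
-- endpoints in G can evaluate one of these two parts by itself. The two copies of an edge are not
-- adjacent and always behave alike, so a symmetric independent set of pairs is a matching of G.

𝟙 : Bool → ℕ
𝟙 b = if b then 1 else 0

∑ : ∀ {A : Set} → List A → (A → ℕ) → ℕ
∑ xs f = sum (map f xs)

module _ {A : Set} where

  ∑-cong : ∀ (xs : List A) {f g : A → ℕ} → (∀ x → f x ≡ g x) → ∑ xs f ≡ ∑ xs g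
  ∑-cong []       h = refl
  ∑-cong (x ∷ xs) h = cong₂ _+_ (h x) (∑-cong xs h)

  ∑-mono : ∀ (xs : List A) {f g : A → ℕ} → (∀ x → f x ≤ g x) → ∑ xs f ≤ ∑ xs g
  ∑-mono []       h = z≤n
  ∑-mono (x ∷ xs) h = +-mono-≤ (h x) (∑-mono xs h)

  ∑-+ : ∀ (xs : List A) (f g : A → ℕ) → ∑ xs (λ x → f x + g x) ≡ ∑ xs f + ∑ xs g
  ∑-+ []       f g = refl
  ∑-+ (x ∷ xs) f g = trans (cong (f x + g x +_) (∑-+ xs f g)) (interchange (f x) (g x) _ _)
    where
    interchange : ∀ a b c d → a + b + (c + d) ≡ a + c + (b + d)
    interchange = solve-∀

  ∑-* : ∀ c (xs : List A) (f : A → ℕ) → ∑ xs (λ x → c * f x) ≡ c * ∑ xs f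
  ∑-* c []       f = sym (*-zeroʳ c)
  ∑-* c (x ∷ xs) f = trans (cong (c * f x +_) (∑-* c xs f)) (sym (*-distribˡ-+ c (f x) _))

  ∑-zero : ∀ (xs : List A) → ∑ xs (λ _ → 0) ≡ 0
  ∑-zero []       = refl
  ∑-zero (x ∷ xs) = ∑-zero xs

∑-swap : ∀ {A B : Set} (xs : List A) (ys : List B) (f : A → B → ℕ) →
         ∑ xs (λ x → ∑ ys (f x)) ≡ ∑ ys (λ y → ∑ xs (λ x → f x y))
∑-swap []       ys f = sym (∑-zero ys)
∑-swap (x ∷ xs) ys f = trans (cong (∑ ys (f x) +_) (∑-swap xs ys f)) (sym (∑-+ ys _ _))

2^suc : ∀ n → 2 ^ suc n ≡ 2 ^ n + 2 ^ n
2^suc n = cong (2 ^ n +_) (+-identityʳ (2 ^ n))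

-- Edge programs

-- The numbers an edge shows its neighbours: a tag and a slot while a defective colouring is being
-- computed, its weight, and its fractional value in units of 2^-L.
record EdgeData : Set where
  constructor ⟨_,_,_,_⟩
  field tag slot wt val : ℕ
open EdgeData public

Payload : Set
Payload = ℕ × EdgeData

-- A d-round program run by every edge.  In a round an edge shows a payload, and learns the sum of
-- its own query over the payloads of the adjacent edges, each summand cut off at cap.
EProg : ℕ → Set → Set
EProg zero    R = R
EProg (suc d) R = Payload × (Payload → ℕ) × (ℕ → EProg d R)

bind : ∀ d₁ {d₂} {A B : Set} → EProg d₁ A → (A → EProg d₂ B) → EProg (d₁ + d₂) B
bind zero     p f = f p
bind (suc d₁) p f = proj₁ p , proj₁ (proj₂ p) , λ m → bind d₁ (proj₂ (proj₂ p) m) f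

module Semantics {I : Set} (items : List I) (κ : I → I → Bool) (cap : ℕ) where

  nb : I → (I → ℕ) → ℕ
  nb e g = ∑ items (λ f → 𝟙 (κ e f) * g f)

  exec : ∀ d {R} → (I → EProg d R) → I → R
  exec zero    p = p
  exec (suc d) p = exec d λ e →
    proj₂ (proj₂ (p e)) (nb e λ f → proj₁ (proj₂ (p e)) (proj₁ (p f)) ⊓ cap)

  -- The depth is part of the type, so all edges leave the first program in the same round and enter
  -- the second one in lockstep.
  exec-bind : ∀ d₁ {d₂} {A B : Set} (p : I → EProg d₁ A) (f : I → A → EProg d₂ B) →
              exec (d₁ + d₂) (λ e → bind d₁ (p e) (f e)) ≡
              exec d₂ (λ e → f e (exec d₁ p e))
  exec-bind zero     p f = refl
  exec-bind (suc d₁) p f = exec-bind d₁ _ f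

  nb-cong : ∀ e {g h} → (∀ f → g f ≡ h f) → nb e g ≡ nb e h
  nb-cong e q = ∑-cong items λ f → cong (𝟙 (κ e f) *_) (q f)

  nb-mono : ∀ e {g h} → (∀ f → g f ≤ h f) → nb e g ≤ nb e h
  nb-mono e q = ∑-mono items λ f → *-monoʳ-≤ (𝟙 (κ e f)) (q f)

  nb-+ : ∀ e g h → nb e (λ f → g f + h f) ≡ nb e g + nb e h
  nb-+ e g h = trans (∑-cong items λ f → *-distribˡ-+ (𝟙 (κ e f)) (g f) (h f)) (∑-+ items _ _)

  nb-* : ∀ e c g → nb e (λ f → c * g f) ≡ c * nb e g
  nb-* e c g = trans (∑-cong items λ f → comm (𝟙 (κ e f)) c (g f)) (∑-* c items _)
    where
    comm : ∀ a b c → a * (b * c) ≡ b * (a * c)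
    comm = solve-∀

  nb-cap : ∀ e {g} → (∀ f → g f ≤ cap) → nb e (λ f → g f ⊓ cap) ≡ nb e g
  nb-cap e q = nb-cong e λ f → m≤n⇒m⊓n≡m (q f)

  -- Adjacent pairs are counted in both orders; the factors 2 in `cheaper` and `both-ends` come from
  -- here.
  pairSum : (I → I → ℕ) → ℕ
  pairSum g = ∑ items λ e → nb e (g e)

  pairSum-mono : ∀ {g h} → (∀ e f → g e f ≤ h e f) → pairSum g ≤ pairSum h
  pairSum-mono q = ∑-mono items λ e → nb-mono e (q e)

  pairSum-cong : ∀ {g h} → (∀ e f → g e f ≡ h e f) → pairSum g ≡ pairSum h
  pairSum-cong q = ∑-cong items λ e → nb-cong e (q e)

  pairSum-+ : ∀ g h → pairSum (λ e f → g e f + h e f) ≡ pairSum g + pairSum h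
  pairSum-+ g h = trans (∑-cong items λ e → nb-+ e (g e) (h e)) (∑-+ items _ _)

  pairSum-* : ∀ c g → pairSum (λ e f → c * g e f) ≡ c * pairSum g
  pairSum-* c g = trans (∑-cong items λ e → nb-* e c (g e)) (∑-* c items _)

  pairSum-swap : (∀ e f → κ e f ≡ κ f e) → ∀ g → pairSum g ≡ pairSum (λ e f → g f e)
  pairSum-swap κ-sym g = trans (∑-swap items items _)
    (∑-cong items λ e → ∑-cong items λ f → cong (λ b → 𝟙 b * g f e) (κ-sym f e))

≡ᵇ-true⇒≡ : ∀ m n → (m ≡ᵇ n) ≡ true → m ≡ n
≡ᵇ-true⇒≡ m n eq = ≡ᵇ⇒≡ m n (subst T (sym eq) _)

≡ᵇ-refl : ∀ n → (n ≡ᵇ n) ≡ true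
≡ᵇ-refl zero    = refl
≡ᵇ-refl (suc n) = ≡ᵇ-refl n

≢⇒≡ᵇ-false : ∀ m n → m ≢ n → (m ≡ᵇ n) ≡ false
≢⇒≡ᵇ-false m n neq with m ≡ᵇ n in eq
... | true  = ⊥-elim (neq (≡ᵇ-true⇒≡ m n eq))
... | false = refl

𝟙≤1 : ∀ b → 𝟙 b ≤ 1
𝟙≤1 true  = s≤s z≤n
𝟙≤1 false = z≤n

-- Colour reduction

-- The colour c = a 2^β + b is read as the line x ↦ a + b x; two lines meet at most once.
lineAt : ℕ → ℕ → ℕ → ℕ
lineAt β c x = c / 2 ^ β + c % 2 ^ β * x
  where instance _ = m^n≢0 2 β

lines-meet-once : ∀ a b a′ b′ x d → .{{NonZero d}} → a + b * x ≡ a′ + b′ * x →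
                  a + b * (x + d) ≡ a′ + b′ * (x + d) → a ≡ a′ × b ≡ b′
lines-meet-once a b a′ b′ x d p q = +-cancelʳ-≡ (b * x) a a′ (trans p (cong (λ t → a′ + t * x) (sym b≡b′))) , b≡b′
  where
  expand : ∀ a b x d → a + b * (x + d) ≡ (a + b * x) + b * d
  expand = solve-∀
  b≡b′ : b ≡ b′
  b≡b′ = *-cancelʳ-≡ b b′ d (+-cancelˡ-≡ (a + b * x) _ _
    (trans (sym (expand a b x d)) (trans q (trans (expand a′ b′ x d) (cong (_+ b′ * d) (sym p))))))

lineAt-injective : ∀ β c c′ x y → x < y → lineAt β c x ≡ lineAt β c′ x →
                   lineAt β c y ≡ lineAt β c′ y → c ≡ c′
lineAt-injective β c c′ x y x<y p q = trans (m≡m%n+[m/n]*n c (2 ^ β))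
  (trans (cong₂ (λ u v → u + v * 2 ^ β) (proj₂ eqs) (proj₁ eqs)) (sym (m≡m%n+[m/n]*n c′ (2 ^ β))))
  where
  instance
    _ = m^n≢0 2 β
    _ = >-nonZero (m<n⇒0<n∸m x<y)
  y≡ : y ≡ x + (y ∸ x)
  y≡ = sym (m+[n∸m]≡n (<⇒≤ x<y))
  eqs : c / 2 ^ β ≡ c′ / 2 ^ β × c % 2 ^ β ≡ c′ % 2 ^ β
  eqs = lines-meet-once (c / 2 ^ β) (c % 2 ^ β) (c′ / 2 ^ β) (c′ % 2 ^ β) x (y ∸ x) p
          (subst (λ t → lineAt β c t ≡ lineAt β c′ t) y≡ q)

lineAt-bound : ∀ β s c x → c < 2 ^ (β + (β + s)) → x < 2 ^ s → lineAt β c x < 2 ^ suc (β + s)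
lineAt-bound β s c x c< x< = begin-strict
  c / 2 ^ β + c % 2 ^ β * x            <⟨ +-mono-<-≤ a< b≤ ⟩
  2 ^ (β + s) + 2 ^ (β + s)            ≡⟨ sym (2^suc (β + s)) ⟩
  2 ^ suc (β + s)                      ∎
  where
  open ≤-Reasoning
  instance _ = m^n≢0 2 β
  a< : c / 2 ^ β < 2 ^ (β + s)
  a< = m<n*o⇒m/o<n (subst (c <_) (trans (^-distribˡ-+-* 2 β (β + s)) (*-comm (2 ^ β) _)) c<)
  b≤ : c % 2 ^ β * x ≤ 2 ^ (β + s)
  b≤ = subst (c % 2 ^ β * x ≤_) (sym (^-distribˡ-+-* 2 β s)) (*-mono-≤ (<⇒≤ (m%n<n c (2 ^ β))) (<⇒≤ x<))

agreements : ℕ → ℕ → ℕ → ℕ → ℕ → ℕ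
agreements β zero    lo c c′ = 0
agreements β (suc m) lo c c′ = 𝟙 (lineAt β c lo ≡ᵇ lineAt β c′ lo) + agreements β m (suc lo) c c′

agreements-+ : ∀ β m m′ lo c c′ →
  agreements β (m + m′) lo c c′ ≡ agreements β m lo c c′ + agreements β m′ (lo + m) c c′
agreements-+ β zero    m′ lo c c′ = cong (λ t → agreements β m′ t c c′) (sym (+-identityʳ lo))
agreements-+ β (suc m) m′ lo c c′ = trans
  (cong (_ +_) (trans (agreements-+ β m m′ (suc lo) c c′)
    (cong (λ t → agreements β m (suc lo) c c′ + agreements β m′ t c c′) (sym (+-suc lo m)))))
  (sym (+-assoc (𝟙 (lineAt β c lo ≡ᵇ lineAt β c′ lo)) _ _))

agreements≤ : ∀ β m lo c c′ → agreements β m lo c c′ ≤ m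
agreements≤ β zero    lo c c′ = z≤n
agreements≤ β (suc m) lo c c′ = +-mono-≤ (𝟙≤1 _) (agreements≤ β m (suc lo) c c′)

agreements-after : ∀ β m lo x c c′ → c ≢ c′ → x < lo → lineAt β c x ≡ lineAt β c′ x →
                   agreements β m lo c c′ ≡ 0
agreements-after β zero    lo x c c′ c≢c′ x<lo p = refl
agreements-after β (suc m) lo x c c′ c≢c′ x<lo p
  rewrite ≢⇒≡ᵇ-false (lineAt β c lo) (lineAt β c′ lo) (λ q → c≢c′ (lineAt-injective β c c′ x lo x<lo p q))
  = agreements-after β m (suc lo) x c c′ c≢c′ (m<n⇒m<1+n x<lo) p

agreements≤1 : ∀ β m lo c c′ → c ≢ c′ → agreements β m lo c c′ ≤ 1
agreements≤1 β zero    lo c c′ c≢c′ = z≤n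
agreements≤1 β (suc m) lo c c′ c≢c′ with lineAt β c lo ≡ᵇ lineAt β c′ lo in eq
... | false = agreements≤1 β m (suc lo) c c′ c≢c′
... | true  = ≤-reflexive (cong suc (agreements-after β m (suc lo) lo c c′ c≢c′ ≤-refl (≡ᵇ-true⇒≡ _ _ eq)))

pointColour : ℕ → ℕ → ℕ → ℕ → ℕ
pointColour s β c x = x + lineAt β c x * 2 ^ s

pointColour-injective : ∀ s β c c′ x x′ → x < 2 ^ s → x′ < 2 ^ s →
  pointColour s β c x ≡ pointColour s β c′ x′ → lineAt β c x ≡ lineAt β c′ x
pointColour-injective s β c c′ x x′ x< x′< p = trans
  (*-cancelʳ-≡ _ _ (2 ^ s) (+-cancelˡ-≡ x _ _ (trans p (cong (_+ _) (sym x≡x′)))))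
  (cong (lineAt β c′) (sym x≡x′))
  where
  instance _ = m^n≢0 2 s
  x≡x′ : x ≡ x′
  x≡x′ = trans (sym (trans ([m+kn]%n≡m%n x (lineAt β c x) (2 ^ s)) (m<n⇒m%n≡m x<)))
    (trans (cong (_% 2 ^ s) p) (trans ([m+kn]%n≡m%n x′ (lineAt β c′ x′) (2 ^ s)) (m<n⇒m%n≡m x′<)))

pointColour-bound : ∀ s β c x → c < 2 ^ (β + (β + s)) → x < 2 ^ s → pointColour s β c x < 2 ^ (suc (β + s) + s)
pointColour-bound s β c x c< x< = begin-strict
  x + lineAt β c x * 2 ^ s      <⟨ +-monoˡ-< _ x< ⟩
  suc (lineAt β c x) * 2 ^ s    ≤⟨ *-monoˡ-≤ (2 ^ s) (lineAt-bound β s c x c< x<) ⟩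
  2 ^ suc (β + s) * 2 ^ s       ≡⟨ sym (^-distribˡ-+-* 2 (suc (β + s)) s) ⟩
  2 ^ (suc (β + s) + s)         ∎
  where open ≤-Reasoning

2*pick≤ : ∀ (F : ℕ → ℕ) x y {a b} → F x ≡ a → F y ≡ b → 2 * F (if a ≤ᵇ b then x else y) ≤ a + b
2*pick≤ F x y {a} {b} refl refl with F x ≤ᵇ F y in eq
... | true  = +-monoʳ-≤ (F x) (≤-trans (≤-reflexive (+-identityʳ (F x))) (≤ᵇ⇒≤ (F x) (F y) (subst T (sym eq) _)))
... | false = ≤-trans (≤-reflexive (cong (F y +_) (+-identityʳ (F y)))) (+-monoˡ-≤ (F y) (<⇒≤ (≰⇒> λ le → subst T eq (≤⇒≤ᵇ le))))

module Lines (s : ℕ) (pw : EdgeData → EdgeData → ℕ) where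

  -- Each edge moves to a point (x , y) of its line, with the bits of x fixed one by one so that the
  -- weight of the adjacent lines through the point is at most the average over all 2^s choices.
  choosePoint : ∀ (β t : ℕ) → ℕ → EdgeData → ℕ → EProg (t * 2) ℕ
  choosePoint β zero    c z lo = pointColour s β c lo
  choosePoint β (suc t) c z lo =
    (c , z) , (λ (c′ , z′) → pw z z′ * agreements β (2 ^ t) lo c c′) , λ a →
    (c , z) , (λ (c′ , z′) → pw z z′ * agreements β (2 ^ t) (lo + 2 ^ t) c c′) , λ b →
    choosePoint β t c z (if a ≤ᵇ b then lo else lo + 2 ^ t)

  lineStep : ℕ → ℕ → EdgeData → EProg (s * 2) ℕ
  lineStep β c z = choosePoint β s c z 0

  -- A colour of 2 + 3 s + 2 y bits is a line with suc s + y bits of slope; a step roughly halves y.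
  reduce : ∀ (N y c : ℕ) → EdgeData → EProg (N * (s * 2)) ℕ
  reduce zero    y c z = c
  reduce (suc N) y c z = bind (s * 2) (lineStep (suc s + y) c z) λ c′ → reduce N ⌈ y /2⌉ c′ z

  module Spec {I : Set} (items : List I) (κ : I → I → Bool) (cap : ℕ)
              (pw-cap : ∀ z z′ → pw z z′ * 2 ^ s ≤ cap) (z : I → EdgeData) where
    open Semantics items κ cap

    -- The monochromatic weight at an edge.
    mono : (I → ℕ) → I → ℕ
    mono c e = nb e λ f → pw (z e) (z f) * 𝟙 (c e ≡ᵇ c f)

    total : I → ℕ
    total e = nb e λ f → pw (z e) (z f)

    module _ (β : ℕ) (c : I → ℕ) where

      conflict : I → ℕ → ℕ → ℕ
      conflict e m lo = nb e λ f → pw (z e) (z f) * agreements β m lo (c e) (c f)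

      conflict-+ : ∀ e m lo → conflict e (m + m) lo ≡ conflict e m lo + conflict e m (lo + m)
      conflict-+ e m lo = trans
        (nb-cong e λ f → trans (cong (pw (z e) (z f) *_) (agreements-+ β m m lo (c e) (c f)))
                               (*-distribˡ-+ (pw (z e) (z f)) _ _))
        (nb-+ e _ _)

      -- Conditional expectations: the conflict over an interval is the sum over its two halves, so
      -- the better half has at most half of it. By `pw-cap` no summand reaches the cut-off, hence
      -- the answers are exact.
      choosePoint-spec : ∀ t → t ≤ s → (lo : I → ℕ) → ∃ λ (x : I → ℕ) → ∀ e →
        exec (t * 2) (λ e → choosePoint β t (c e) (z e) (lo e)) e ≡ pointColour s β (c e) (x e)
        × x e < lo e + 2 ^ t
        × 2 ^ t * conflict e 1 (x e) ≤ conflict e (2 ^ t) (lo e)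
      choosePoint-spec zero    t≤s lo = lo , λ e → refl , m<m+n (lo e) z<s , ≤-reflexive (*-identityˡ _)
      choosePoint-spec (suc t) t<s lo = proj₁ IH , λ e →
        proj₁ (proj₂ IH e) , upper e (proj₁ (proj₂ (proj₂ IH e))) , halves e (proj₂ (proj₂ (proj₂ IH e)))
        where
        bounded : ∀ e f l → pw (z e) (z f) * agreements β (2 ^ t) l (c e) (c f) ≤ cap
        bounded e f l = ≤-trans
          (*-monoʳ-≤ (pw (z e) (z f)) (≤-trans (agreements≤ β (2 ^ t) l (c e) (c f)) (^-monoʳ-≤ 2 (<⇒≤ t<s))))
          (pw-cap (z e) (z f))
        a b lo′ : I → ℕ
        a e = nb e λ f → pw (z e) (z f) * agreements β (2 ^ t) (lo e) (c e) (c f) ⊓ cap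
        b e = nb e λ f → pw (z e) (z f) * agreements β (2 ^ t) (lo e + 2 ^ t) (c e) (c f) ⊓ cap
        lo′ e = if a e ≤ᵇ b e then lo e else lo e + 2 ^ t
        a≡ : ∀ e → conflict e (2 ^ t) (lo e) ≡ a e
        a≡ e = sym (nb-cap e λ f → bounded e f (lo e))
        b≡ : ∀ e → conflict e (2 ^ t) (lo e + 2 ^ t) ≡ b e
        b≡ e = sym (nb-cap e λ f → bounded e f (lo e + 2 ^ t))
        IH = choosePoint-spec t (<⇒≤ t<s) lo′
        lo′≤ : ∀ e → lo′ e ≤ lo e + 2 ^ t
        lo′≤ e with a e ≤ᵇ b e
        ... | true  = m≤m+n (lo e) _
        ... | false = ≤-refl
        upper : ∀ e {x} → x < lo′ e + 2 ^ t → x < lo e + 2 ^ suc t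
        upper e {x} x< = begin-strict
          x                         <⟨ x< ⟩
          lo′ e + 2 ^ t             ≤⟨ +-monoˡ-≤ (2 ^ t) (lo′≤ e) ⟩
          lo e + 2 ^ t + 2 ^ t      ≡⟨ +-assoc (lo e) (2 ^ t) (2 ^ t) ⟩
          lo e + (2 ^ t + 2 ^ t)    ≡⟨ cong (lo e +_) (sym (2^suc t)) ⟩
          lo e + 2 ^ suc t          ∎
          where open ≤-Reasoning
        halves : ∀ e {x} → 2 ^ t * conflict e 1 x ≤ conflict e (2 ^ t) (lo′ e) →
                 2 ^ suc t * conflict e 1 x ≤ conflict e (2 ^ suc t) (lo e)
        halves e {x} h = begin
          2 ^ suc t * conflict e 1 x                                    ≡⟨ *-assoc 2 (2 ^ t) _ ⟩
          2 * (2 ^ t * conflict e 1 x)                                  ≤⟨ *-monoʳ-≤ 2 h ⟩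
          2 * conflict e (2 ^ t) (lo′ e)                                ≤⟨ 2*pick≤ (conflict e (2 ^ t)) (lo e) (lo e + 2 ^ t) (a≡ e) (b≡ e) ⟩
          a e + b e                                                     ≡⟨ sym (cong₂ _+_ (a≡ e) (b≡ e)) ⟩
          conflict e (2 ^ t) (lo e) + conflict e (2 ^ t) (lo e + 2 ^ t) ≡⟨ sym (conflict-+ e (2 ^ t) (lo e)) ⟩
          conflict e (2 ^ t + 2 ^ t) (lo e)                             ≡⟨ cong (λ m → conflict e m (lo e)) (sym (2^suc t)) ⟩
          conflict e (2 ^ suc t) (lo e)                                 ∎
          where open ≤-Reasoning

      stepped : I → ℕ
      stepped = exec (s * 2) λ e → lineStep β (c e) (z e)

      -- If f still collides with e, then the line of f passes through the point of e, whichever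
      -- point f picked; so all edges can choose at once. Among the 2^s abscissae a line agrees
      -- everywhere with a line of equal colour and at most once with any other, so the average
      -- conflict is at most `mono c e` plus `total e` / 2^s.
      lineStep-mono : ∀ e → 2 ^ s * mono stepped e ≤ 2 ^ s * mono c e + total e
      lineStep-mono e = begin
        2 ^ s * mono stepped e        ≤⟨ *-monoʳ-≤ (2 ^ s) (nb-mono e λ f → *-monoʳ-≤ (pw (z e) (z f)) (collision f)) ⟩
        2 ^ s * conflict e 1 (x e)    ≤⟨ proj₂ (proj₂ (spec e)) ⟩
        conflict e (2 ^ s) 0          ≤⟨ nb-mono e pointwise ⟩
        nb e (λ f → 2 ^ s * (pw (z e) (z f) * 𝟙 (c e ≡ᵇ c f)) + pw (z e) (z f)) ≡⟨ nb-+ e _ _ ⟩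
        nb e (λ f → 2 ^ s * (pw (z e) (z f) * 𝟙 (c e ≡ᵇ c f))) + total e        ≡⟨ cong (_+ total e) (nb-* e (2 ^ s) _) ⟩
        2 ^ s * mono c e + total e    ∎
        where
        open ≤-Reasoning
        x = proj₁ (choosePoint-spec s ≤-refl (λ _ → 0))
        spec = proj₂ (choosePoint-spec s ≤-refl (λ _ → 0))
        collision : ∀ f → 𝟙 (stepped e ≡ᵇ stepped f) ≤ agreements β 1 (x e) (c e) (c f)
        collision f with stepped e ≡ᵇ stepped f in eq
        ... | false = z≤n
        ... | true rewrite pointColour-injective s β (c e) (c f) (x e) (x f) (proj₁ (proj₂ (spec e))) (proj₁ (proj₂ (spec f)))
                     (trans (sym (proj₁ (spec e))) (trans (≡ᵇ-true⇒≡ _ _ eq) (proj₁ (spec f))))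
                   | ≡ᵇ-refl (lineAt β (c f) (x e)) = ≤-refl
        pointwise : ∀ f → pw (z e) (z f) * agreements β (2 ^ s) 0 (c e) (c f)
                        ≤ 2 ^ s * (pw (z e) (z f) * 𝟙 (c e ≡ᵇ c f)) + pw (z e) (z f)
        pointwise f with c e ≟ c f
        ... | yes p rewrite p | ≡ᵇ-refl (c f) = ≤-trans
                (*-monoʳ-≤ (pw (z e) (z f)) (agreements≤ β (2 ^ s) 0 (c f) (c f)))
                (≤-trans (≤-reflexive (eq (pw (z e) (z f)) (2 ^ s))) (m≤m+n _ _))
                where
                eq : ∀ a b → a * b ≡ b * (a * 1)
                eq = solve-∀
        ... | no p = ≤-trans (*-monoʳ-≤ (pw (z e) (z f)) (agreements≤1 β (2 ^ s) 0 (c e) (c f) p))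
                (≤-trans (≤-reflexive (*-identityʳ (pw (z e) (z f)))) (m≤n+m (pw (z e) (z f)) _))

      lineStep-bound : (∀ e → c e < 2 ^ (β + (β + s))) → ∀ e → stepped e < 2 ^ (suc (β + s) + s)
      lineStep-bound c< e = subst (_< _) (sym (proj₁ (spec e))) (pointColour-bound s β (c e) _ (c< e) (proj₁ (proj₂ (spec e))))
        where
        spec = proj₂ (choosePoint-spec s ≤-refl (λ _ → 0))

    reduced : ∀ N y → (I → ℕ) → I → ℕ
    reduced N y c = exec (N * (s * 2)) λ e → reduce N y (c e) (z e)

    reduced-suc : ∀ N y c → reduced (suc N) y c ≡ reduced N ⌈ y /2⌉ (stepped (suc s + y) c)
    reduced-suc N y c = exec-bind (s * 2) _ _

    reduce-mono : ∀ N y c e → 2 ^ s * mono (reduced N y c) e ≤ 2 ^ s * mono c e + N * total e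
    reduce-mono zero    y c e = m≤m+n _ _
    reduce-mono (suc N) y c e rewrite reduced-suc N y c = begin
      2 ^ s * mono (reduced N ⌈ y /2⌉ c′) e            ≤⟨ reduce-mono N ⌈ y /2⌉ c′ e ⟩
      2 ^ s * mono c′ e + N * total e                  ≤⟨ +-monoˡ-≤ _ (lineStep-mono (suc s + y) c e) ⟩
      2 ^ s * mono c e + total e + N * total e         ≡⟨ +-assoc (2 ^ s * mono c e) _ _ ⟩
      2 ^ s * mono c e + suc N * total e               ∎
      where
      open ≤-Reasoning
      c′ = stepped (suc s + y) c

    -- An integral defect below 1 is 0: starting from a proper colouring, a step creates
    -- monochromatic weight at most `total e` / 2^s.
    reduce-proper : (∀ e → total e < 2 ^ s) → ∀ N y c → (∀ e → mono c e ≡ 0) → ∀ e → mono (reduced N y c) e ≡ 0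
    reduce-proper small zero    y c proper e = proper e
    reduce-proper small (suc N) y c proper e rewrite reduced-suc N y c =
      reduce-proper small N ⌈ y /2⌉ c′ (λ e → n<1⇒n≡0 (*-cancelˡ-< (2 ^ s) _ 1 (begin-strict
        2 ^ s * mono c′ e              ≤⟨ lineStep-mono (suc s + y) c e ⟩
        2 ^ s * mono c e + total e     ≡⟨ cong (λ m → 2 ^ s * m + total e) (proper e) ⟩
        2 ^ s * 0 + total e            ≡⟨ cong (_+ total e) (*-zeroʳ (2 ^ s)) ⟩
        total e                        <⟨ small e ⟩
        2 ^ s                          ≡⟨ sym (*-identityʳ (2 ^ s)) ⟩
        2 ^ s * 1                      ∎))) e
      where
      open ≤-Reasoning
      c′ = stepped (suc s + y) c

    -- Rounding up, repeated halving of a positive y stops at 1, which leaves 2 + 3 s + 2 bits.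
    reduce-bound : ∀ N y c → y ≤ 2 ^ N → (∀ e → c e < 2 ^ (2 + 3 * s + 2 * y)) → ∀ e → reduced N y c e < 2 ^ (4 + 3 * s)
    reduce-bound zero    y c y≤ c< e = <-≤-trans (c< e) (^-monoʳ-≤ 2 (begin
      2 + 3 * s + 2 * y  ≤⟨ +-monoʳ-≤ (2 + 3 * s) (*-monoʳ-≤ 2 y≤) ⟩
      2 + 3 * s + 2      ≡⟨ +-comm (2 + 3 * s) 2 ⟩
      4 + 3 * s          ∎))
      where open ≤-Reasoning
    reduce-bound (suc N) y c y≤ c< e rewrite reduced-suc N y c =
      reduce-bound N ⌈ y /2⌉ c′ half (λ e → <-≤-trans
        (lineStep-bound (suc s + y) c (λ e → subst (λ t → c e < 2 ^ t) (before s y) (c< e)) e)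
        (^-monoʳ-≤ 2 (after s y))) e
      where
      c′ = stepped (suc s + y) c
      before : ∀ s y → 2 + 3 * s + 2 * y ≡ (suc s + y) + ((suc s + y) + s)
      before = solve-∀
      y≤2⌈y/2⌉ : ∀ y → y ≤ ⌈ y /2⌉ + ⌈ y /2⌉
      y≤2⌈y/2⌉ y = subst (_≤ ⌈ y /2⌉ + ⌈ y /2⌉) (⌊n/2⌋+⌈n/2⌉≡n y) (+-monoˡ-≤ ⌈ y /2⌉ (⌊n/2⌋≤⌈n/2⌉ y))
      half : ⌈ y /2⌉ ≤ 2 ^ N
      half = subst (⌈ y /2⌉ ≤_) (sym (n≡⌈n+n/2⌉ (2 ^ N))) (⌈n/2⌉-mono (subst (y ≤_) (2^suc N) y≤))
      after : ∀ s y → suc ((suc s + y) + s) + s ≤ 2 + 3 * s + 2 * ⌈ y /2⌉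
      after s y = begin
        suc ((suc s + y) + s) + s           ≡⟨ left s y ⟩
        2 + 3 * s + y                       ≤⟨ +-monoʳ-≤ (2 + 3 * s) (y≤2⌈y/2⌉ y) ⟩
        2 + 3 * s + (⌈ y /2⌉ + ⌈ y /2⌉)     ≡⟨ cong (λ t → 2 + 3 * s + (⌈ y /2⌉ + t)) (sym (+-identityʳ ⌈ y /2⌉)) ⟩
        2 + 3 * s + 2 * ⌈ y /2⌉             ∎
        where
        open ≤-Reasoning
        left : ∀ s y → suc ((suc s + y) + s) + s ≡ 2 + 3 * s + y
        left = solve-∀

-- Derandomised sweeps

n<ᵇn≡false : ∀ n → (n <ᵇ n) ≡ false
n<ᵇn≡false zero    = refl
n<ᵇn≡false (suc n) = n<ᵇn≡false n

n<ᵇ1+n≡true : ∀ n → (n <ᵇ suc n) ≡ true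
n<ᵇ1+n≡true zero    = refl
n<ᵇ1+n≡true (suc n) = n<ᵇ1+n≡true n

-- In terms of twice the cost minus the gain, with the subtractions moved across: the better
-- candidate is at most the average of both, which is at most the present value.
average-choice : ∀ a b g₀ g₁ {A g} → a + b ≤ 2 * A → 2 * g ≤ g₀ + g₁ → 2 * a + g₁ ≤ 2 * b + g₀ →
                 2 * a + g ≤ 2 * A + g₀
average-choice a b g₀ g₁ {A} {g} p q h = *-cancelˡ-≤ 2 (begin
  2 * (2 * a + g)                  ≡⟨ e₁ a g ⟩
  2 * a + 2 * a + 2 * g            ≤⟨ +-monoʳ-≤ (2 * a + 2 * a) q ⟩
  2 * a + 2 * a + (g₀ + g₁)        ≡⟨ e₂ a g₀ g₁ ⟩
  2 * a + g₀ + (2 * a + g₁)        ≤⟨ +-monoʳ-≤ (2 * a + g₀) h ⟩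
  2 * a + g₀ + (2 * b + g₀)        ≡⟨ e₃ a b g₀ ⟩
  2 * (a + b) + 2 * g₀             ≤⟨ +-monoˡ-≤ (2 * g₀) (*-monoʳ-≤ 2 p) ⟩
  2 * (2 * A) + 2 * g₀             ≡⟨ sym (*-distribˡ-+ 2 (2 * A) g₀) ⟩
  2 * (2 * A + g₀)                 ∎)
  where
  open ≤-Reasoning
  e₁ : ∀ a g → 2 * (2 * a + g) ≡ 2 * a + 2 * a + 2 * g
  e₁ = solve-∀
  e₂ : ∀ a g₀ g₁ → 2 * a + 2 * a + (g₀ + g₁) ≡ 2 * a + g₀ + (2 * a + g₁)
  e₂ = solve-∀
  e₃ : ∀ a b g₀ → 2 * a + g₀ + (2 * b + g₀) ≡ 2 * (a + b) + 2 * g₀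
  e₃ = solve-∀

-- Conditional expectations: the classes r - 1, …, 0 are processed in turn, and an edge of the current
-- class moves to the cheaper of two candidates whose average is no worse than its present state.
-- Adjacent edges of the same class ignore each other, which costs at most their clash.
module Sweeping (quad : EdgeData → EdgeData → ℕ) (gain : EdgeData → ℕ) (c₀ c₁ : EdgeData → EdgeData) where

  -- The costs are doubled because an edge sees each of its pairs once while `cost` counts both
  -- orders; `gain` is counted once per edge.
  cheaper : ℕ → ℕ → EdgeData → EdgeData
  cheaper a b z = if 2 * a + gain (c₁ z) ≤ᵇ 2 * b + gain (c₀ z) then c₀ z else c₁ z

  sweep : ∀ r → ℕ → EdgeData → EProg (r * 2) EdgeData
  sweep zero    χ z = z
  sweep (suc r) χ z =
    (χ , z) , (λ (χ′ , z′) → 𝟙 (not (χ′ ≡ᵇ r)) * quad (c₀ z) z′) , λ a →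
    (χ , z) , (λ (χ′ , z′) → 𝟙 (not (χ′ ≡ᵇ r)) * quad (c₁ z) z′) , λ b →
    sweep r χ (if χ ≡ᵇ r then cheaper a b z else z)

  module Spec {I : Set} (items : List I) (κ : I → I → Bool) (κ-sym : ∀ e f → κ e f ≡ κ f e) (cap : ℕ)
              (quad-sym : ∀ z z′ → quad z z′ ≡ quad z′ z)
              (quad-cap : ∀ z z′ → quad z z′ ≤ cap)
              (quad-avg : ∀ z z′ → quad (c₀ z) z′ + quad (c₁ z) z′ ≤ 2 * quad z z′)
              (gain-avg : ∀ z → 2 * gain z ≤ gain (c₀ z) + gain (c₁ z))
              (χ : I → ℕ) where
    open Semantics items κ cap

    cost utility : (I → EdgeData) → ℕ
    cost z = pairSum λ e f → quad (z e) (z f)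
    utility z = ∑ items λ e → gain (z e)

    -- Only the classes below r are charged, since those are the ones that a sweep of r classes
    -- moves; idle edges may share an out-of-range class for free.
    clash : ℕ → (I → EdgeData) → ℕ
    clash r z = pairSum λ e f → 𝟙 ((χ e ≡ᵇ χ f) ∧ (χ e <ᵇ r)) * quad (z e) (z f)

    swept : ∀ r → (I → EdgeData) → I → EdgeData
    swept r z = exec (r * 2) λ e → sweep r (χ e) (z e)

    module Step (r : ℕ) (z : I → EdgeData) where

      in? out? : I → ℕ
      in?  e = 𝟙 (χ e ≡ᵇ r)
      out? e = 𝟙 (not (χ e ≡ᵇ r))

      ask : (EdgeData → EdgeData) → I → ℕ
      ask c e = nb e λ f → out? f * quad (c (z e)) (z f) ⊓ cap

      z′ : I → EdgeData
      z′ e = if χ e ≡ᵇ r then cheaper (ask c₀ e) (ask c₁ e) (z e) else z e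

      outer : (I → EdgeData) → I → ℕ
      outer y e = nb e λ f → in? e * (out? f * quad (y e) (z f))

      ask≡ : ∀ c e → ask c e ≡ nb e λ f → out? f * quad (c (z e)) (z f)
      ask≡ c e = nb-cap e λ f → ≤-trans (*-monoˡ-≤ _ (𝟙≤1 (not (χ f ≡ᵇ r))))
        (≤-trans (≤-reflexive (*-identityˡ _)) (quad-cap (c (z e)) (z f)))

      asks≤ : ∀ e → ask c₀ e + ask c₁ e ≤ 2 * nb e (λ f → out? f * quad (z e) (z f))
      asks≤ e = begin
        ask c₀ e + ask c₁ e ≡⟨ cong₂ _+_ (ask≡ c₀ e) (ask≡ c₁ e) ⟩
        _                   ≡⟨ sym (nb-+ e _ _) ⟩
        nb e (λ f → out? f * quad (c₀ (z e)) (z f) + out? f * quad (c₁ (z e)) (z f)) ≤⟨ nb-mono e pointwise ⟩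
        nb e (λ f → 2 * (out? f * quad (z e) (z f))) ≡⟨ nb-* e 2 _ ⟩
        2 * nb e (λ f → out? f * quad (z e) (z f)) ∎
        where
        open ≤-Reasoning
        comm : ∀ a b → a * (2 * b) ≡ 2 * (a * b)
        comm = solve-∀
        pointwise : ∀ f → out? f * quad (c₀ (z e)) (z f) + out? f * quad (c₁ (z e)) (z f) ≤ 2 * (out? f * quad (z e) (z f))
        pointwise f = begin
          _ ≡⟨ sym (*-distribˡ-+ (out? f) _ _) ⟩
          out? f * (quad (c₀ (z e)) (z f) + quad (c₁ (z e)) (z f)) ≤⟨ *-monoʳ-≤ (out? f) (quad-avg (z e) (z f)) ⟩
          out? f * (2 * quad (z e) (z f)) ≡⟨ comm (out? f) _ ⟩
          2 * (out? f * quad (z e) (z f)) ∎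

      cheaper-good : ∀ a b A x y (F : EdgeData → ℕ) → F (c₀ x) ≡ a → F (c₁ x) ≡ b → a + b ≤ 2 * A →
                     y ≡ cheaper a b x → 2 * F y + gain x ≤ 2 * A + gain y
      cheaper-good a b A x y F refl refl a+b≤ refl with 2 * F (c₀ x) + gain (c₁ x) ≤ᵇ 2 * F (c₁ x) + gain (c₀ x) in eq
      ... | true  = average-choice a b (gain (c₀ x)) (gain (c₁ x)) {A} a+b≤ (gain-avg x) (≤ᵇ⇒≤ _ _ (subst T (sym eq) _))
      ... | false = average-choice b a (gain (c₁ x)) (gain (c₀ x)) {A} (subst (_≤ 2 * A) (+-comm a b) a+b≤)
                      (subst (2 * gain x ≤_) (+-comm (gain (c₀ x)) _) (gain-avg x)) (<⇒≤ (≰⇒> λ le → subst T eq (≤⇒≤ᵇ le)))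
      outer-good : ∀ e → 2 * outer z′ e + gain (z e) ≤ 2 * outer z e + gain (z′ e)
      outer-good e with χ e ≡ᵇ r
      ... | false = ≤-refl
      ... | true  = subst₂ (λ A′ A → 2 * A′ + gain (z e) ≤ 2 * A + gain y)
                      (nb-cong e λ f → sym (*-identityˡ (out? f * quad y (z f))))
                      (nb-cong e λ f → sym (*-identityˡ (out? f * quad (z e) (z f))))
                      (cheaper-good (ask c₀ e) (ask c₁ e) (nb e λ f → out? f * quad (z e) (z f)) (z e) y (λ x → nb e λ f → out? f * quad x (z f))
                        (sym (ask≡ c₀ e)) (sym (ask≡ c₁ e)) (asks≤ e) refl)
        where y = cheaper (ask c₀ e) (ask c₁ e) (z e)

      inner : (I → EdgeData) → I → I → ℕ
      inner y e f = in? e * (in? f * quad (y e) (y f))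

      cross : (I → EdgeData) → I → I → ℕ
      cross y e f = in? e * (out? f * quad (y e) (z f))

      rest : I → I → ℕ
      rest e f = out? e * (out? f * quad (z e) (z f))

      after≤ : ∀ e f → quad (z′ e) (z′ f) ≤ inner z′ e f + (cross z′ e f + cross z′ f e + rest e f)
      after≤ e f with χ e ≡ᵇ r | χ f ≡ᵇ r
      ... | true  | true  = ≤-reflexive (eq _)
        where
        eq : ∀ a → a ≡ 1 * (1 * a) + 0
        eq = solve-∀
      ... | true  | false = ≤-reflexive (eq _)
        where
        eq : ∀ a → a ≡ 1 * (1 * a) + 0 + 0
        eq = solve-∀
      ... | false | true  = ≤-reflexive (trans (quad-sym _ _) (eq _))
        where
        eq : ∀ a → a ≡ 1 * (1 * a) + 0
        eq = solve-∀
      ... | false | false = ≤-reflexive (eq _)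
        where
        eq : ∀ a → a ≡ 1 * (1 * a)
        eq = solve-∀

      before≤ : ∀ e f → cross z e f + cross z f e + rest e f ≤ quad (z e) (z f)
      before≤ e f with χ e ≡ᵇ r | χ f ≡ᵇ r
      ... | true  | true  = z≤n
      ... | true  | false = ≤-reflexive (eq _)
        where
        eq : ∀ a → 1 * (1 * a) + 0 + 0 ≡ a
        eq = solve-∀
      ... | false | true  = ≤-reflexive (trans (eq _) (quad-sym _ _))
        where
        eq : ∀ a → 1 * (1 * a) + 0 ≡ a
        eq = solve-∀
      ... | false | false = ≤-reflexive (eq _)
        where
        eq : ∀ a → 1 * (1 * a) ≡ a
        eq = solve-∀

      split : ∀ y → pairSum (λ e f → cross y e f + cross y f e + rest e f) ≡ 2 * pairSum (cross y) + pairSum rest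
      split y = trans (pairSum-+ _ rest) (cong (_+ pairSum rest)
        (trans (pairSum-+ (cross y) _) (cong (pairSum (cross y) +_)
          (trans (sym (pairSum-swap κ-sym (cross y))) (sym (+-identityʳ _))))))

      outer-sum : 2 * pairSum (cross z′) + utility z ≤ 2 * pairSum (cross z) + utility z′
      outer-sum = subst₂ _≤_ (eq z′ z) (eq z z′) (∑-mono items outer-good)
        where
        eq : ∀ y x → ∑ items (λ e → 2 * outer y e + gain (x e)) ≡ 2 * pairSum (cross y) + utility x
        eq y x = trans (∑-+ items _ _) (cong (_+ utility x) (∑-* 2 items (outer y)))

      -- Pairs are sorted by how many ends lie in class r. Those with one end are controlled by
      -- `outer-good`, those with none do not change, and those with two are charged in full
      -- afterwards while `before≤` simply forgets what they cost before.
      step : cost z′ + utility z ≤ cost z + utility z′ + pairSum (inner z′)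
      step = begin
        cost z′ + utility z                                                      ≤⟨ +-monoˡ-≤ _ (≤-trans (pairSum-mono after≤) (≤-reflexive (trans (pairSum-+ _ _) (cong (pairSum (inner z′) +_) (split z′))))) ⟩
        pairSum (inner z′) + (2 * pairSum (cross z′) + pairSum rest) + utility z ≡⟨ shuffle (pairSum (inner z′)) (2 * pairSum (cross z′)) (pairSum rest) (utility z) ⟩
        (2 * pairSum (cross z′) + utility z) + pairSum rest + pairSum (inner z′) ≤⟨ +-monoˡ-≤ _ (+-monoˡ-≤ _ outer-sum) ⟩
        (2 * pairSum (cross z) + utility z′) + pairSum rest + pairSum (inner z′) ≡⟨ shuffle′ (2 * pairSum (cross z)) (utility z′) (pairSum rest) (pairSum (inner z′)) ⟩
        (2 * pairSum (cross z) + pairSum rest) + utility z′ + pairSum (inner z′) ≤⟨ +-monoˡ-≤ _ (+-monoˡ-≤ _ (≤-trans (≤-reflexive (sym (split z))) (pairSum-mono before≤))) ⟩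
        cost z + utility z′ + pairSum (inner z′)                                 ∎
        where
        open ≤-Reasoning
        shuffle : ∀ a b c d → a + (b + c) + d ≡ b + d + c + a
        shuffle = solve-∀
        shuffle′ : ∀ a b c d → a + b + c + d ≡ a + c + b + d
        shuffle′ = solve-∀

    -- This serves twice: an edge is final once its class has had its turn, and an edge is excluded
    -- from a sweep by giving it a class out of range.
    swept-keeps : ∀ r z e → r ≤ χ e → swept r z e ≡ z e
    swept-keeps zero    z e r≤ = refl
    swept-keeps (suc r) z e r< = trans (swept-keeps r (Step.z′ r z) e (<⇒≤ r<)) unchanged
      where
      unchanged : Step.z′ r z e ≡ z e
      unchanged rewrite ≢⇒≡ᵇ-false (χ e) r (λ p → <⇒≢ r< (sym p)) = refl

    swept-moves : ∀ r z e → χ e < r → swept r z e ≡ c₀ (z e) ⊎ swept r z e ≡ c₁ (z e)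
    swept-moves (suc r) z e χ<sr with χ e ≟ r
    ... | no χ≢r = subst (λ y → swept r (Step.z′ r z) e ≡ c₀ y ⊎ swept r (Step.z′ r z) e ≡ c₁ y) unchanged
                     (swept-moves r (Step.z′ r z) e (≤∧≢⇒< (s≤s⁻¹ χ<sr) χ≢r))
      where
      unchanged : Step.z′ r z e ≡ z e
      unchanged rewrite ≢⇒≡ᵇ-false (χ e) r χ≢r = refl
    ... | yes χ≡r = subst (λ y → y ≡ c₀ (z e) ⊎ y ≡ c₁ (z e)) (sym (swept-keeps r (Step.z′ r z) e (≤-reflexive (sym χ≡r)))) choice
      where
      choice : Step.z′ r z e ≡ c₀ (z e) ⊎ Step.z′ r z e ≡ c₁ (z e)
      choice rewrite χ≡r | ≡ᵇ-refl r
        with 2 * Step.ask r z c₀ e + gain (c₁ (z e)) ≤ᵇ 2 * Step.ask r z c₁ e + gain (c₀ (z e))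
      ... | true  = inj₁ refl
      ... | false = inj₂ refl

    sweep-cost : ∀ r z → cost (swept r z) + utility z ≤ cost z + utility (swept r z) + clash r (swept r z)
    sweep-cost zero    z = m≤m+n _ _
    sweep-cost (suc r) z = +-cancelʳ-≤ (cost z₁ + utility z₁) _ _ (begin
      cost z₂ + utility z + (cost z₁ + utility z₁)                                              ≡⟨ swap₁ (cost z₂) (utility z) (cost z₁) (utility z₁) ⟩
      (cost z₂ + utility z₁) + (cost z₁ + utility z)                                            ≤⟨ +-mono-≤ (sweep-cost r z₁) (Step.step r z) ⟩
      (cost z₁ + utility z₂ + clash r z₂) + (cost z + utility z₁ + pairSum (Step.inner r z z₁)) ≡⟨ swap₂ (cost z₁) (utility z₂) (clash r z₂) (cost z) (utility z₁) _ ⟩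
      cost z + utility z₂ + (clash r z₂ + pairSum (Step.inner r z z₁)) + (cost z₁ + utility z₁) ≤⟨ +-monoˡ-≤ _ (+-monoʳ-≤ (cost z + utility z₂) (≤-trans (≤-reflexive (sym (pairSum-+ _ _))) (pairSum-mono collect))) ⟩
      cost z + utility z₂ + clash (suc r) z₂ + (cost z₁ + utility z₁)                           ∎)
      where
      open ≤-Reasoning
      z₁ = Step.z′ r z
      z₂ = swept r z₁
      swap₁ : ∀ a b c d → a + b + (c + d) ≡ a + d + (c + b)
      swap₁ = solve-∀
      swap₂ : ∀ a b c d e f → (a + b + c) + (d + e + f) ≡ d + b + (c + f) + (a + e)
      swap₂ = solve-∀
      -- Class r never moves after its own step, so its inner pairs can be priced at the final data
      -- `z₂` and merged into the clash.
      collect : ∀ e f → 𝟙 ((χ e ≡ᵇ χ f) ∧ (χ e <ᵇ r)) * quad (z₂ e) (z₂ f) + Step.inner r z z₁ e f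
                      ≤ 𝟙 ((χ e ≡ᵇ χ f) ∧ (χ e <ᵇ suc r)) * quad (z₂ e) (z₂ f)
      collect e f with χ e ≟ r | χ f ≟ r
      ... | yes p | yes q rewrite swept-keeps r z₁ e (≤-reflexive (sym p)) | swept-keeps r z₁ f (≤-reflexive (sym q))
                        | p | q | ≡ᵇ-refl r | n<ᵇn≡false r | n<ᵇ1+n≡true r = ≤-reflexive (cong (_+ 0) (+-identityʳ _))
      ... | no p | _ rewrite ≢⇒≡ᵇ-false (χ e) r p = grow (χ e ≡ᵇ χ f) (χ e) r (quad (z₂ e) (z₂ f))
        where
        grow : ∀ b x r q → 𝟙 (b ∧ (x <ᵇ r)) * q + 0 ≤ 𝟙 (b ∧ (x <ᵇ suc r)) * q
        grow false x r q = z≤n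
        grow true  x r q with x <ᵇ r in eq
        ... | false = z≤n
        ... | true with x <ᵇ suc r in eq′
        ...   | true  = ≤-reflexive (+-identityʳ _)
        ...   | false = ⊥-elim (subst T eq′ (<⇒<ᵇ (m<n⇒m<1+n (<ᵇ⇒< x r (subst T (sym eq) _)))))
      ... | yes p | no q rewrite ≢⇒≡ᵇ-false (χ e) (χ f) (λ h → q (trans (sym h) p)) | ≢⇒≡ᵇ-false (χ f) r q
                        = ≤-reflexive (*-zeroʳ (𝟙 (χ e ≡ᵇ r)))

-- Defective colouring

≡ᵇ-sym : ∀ m n → (m ≡ᵇ n) ≡ (n ≡ᵇ m)
≡ᵇ-sym zero    zero    = refl
≡ᵇ-sym zero    (suc n) = refl
≡ᵇ-sym (suc m) zero    = refl
≡ᵇ-sym (suc m) (suc n) = ≡ᵇ-sym m n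

𝟙*≤ : ∀ b n → 𝟙 b * n ≤ n
𝟙*≤ b n = ≤-trans (*-monoˡ-≤ n (𝟙≤1 b)) (≤-reflexive (*-identityˡ n))

2*-+-injective : ∀ m n a b → a ≤ 1 → b ≤ 1 → 2 * m + a ≡ 2 * n + b → m ≡ n × a ≡ b
2*-+-injective m n a b a≤ b≤ p = m≡n , +-cancelˡ-≡ (2 * m) a b (trans p (cong (λ t → 2 * t + b) (sym m≡n)))
  where
  le : ∀ m n a b → b ≤ 1 → 2 * m + a ≡ 2 * n + b → m ≤ n
  le m n a b b≤ p = s≤s⁻¹ (*-cancelˡ-< 2 m (suc n) (begin-strict
    2 * m          ≤⟨ m≤m+n (2 * m) a ⟩
    2 * m + a      ≡⟨ p ⟩
    2 * n + b      ≤⟨ +-monoʳ-≤ (2 * n) b≤ ⟩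
    2 * n + 1      <⟨ +-monoʳ-< (2 * n) (s≤s (s≤s z≤n)) ⟩
    2 * n + 2      ≡⟨ eq n ⟩
    2 * suc n      ∎))
    where
    open ≤-Reasoning
    eq : ∀ n → 2 * n + 2 ≡ 2 * suc n
    eq = solve-∀
  m≡n = ≤-antisym (le m n a b b≤ p) (le n m b a a≤ (sym p))

-- Twice the probability that the two halves agree; tag 0 is undecided, tags 1 and 2 are the halves.
tagCost : ℕ → ℕ → ℕ
tagCost zero    _       = 1
tagCost (suc _) zero    = 1
tagCost (suc a) (suc b) = 2 * 𝟙 (a ≡ᵇ b)

tagCost-sym : ∀ a b → tagCost a b ≡ tagCost b a
tagCost-sym zero    zero    = refl
tagCost-sym zero    (suc b) = refl
tagCost-sym (suc a) zero    = refl
tagCost-sym (suc a) (suc b) = cong (λ t → 2 * 𝟙 t) (≡ᵇ-sym a b)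

tagCost≤2 : ∀ a b → tagCost a b ≤ 2
tagCost≤2 zero    b       = s≤s z≤n
tagCost≤2 (suc a) zero    = s≤s z≤n
tagCost≤2 (suc a) (suc b) = *-monoʳ-≤ 2 (𝟙≤1 (a ≡ᵇ b))

tagCost-avg : ∀ b → tagCost 1 b + tagCost 2 b ≤ 2
tagCost-avg zero          = ≤-refl
tagCost-avg (suc zero)    = ≤-refl
tagCost-avg (suc (suc zero)) = ≤-refl
tagCost-avg (suc (suc (suc b))) = z≤n

-- A decided edge keeps its tag because the averaging hypothesis is required of all data: both
-- candidates then equal the present state.
setTag : ℕ → EdgeData → EdgeData
setTag t ⟨ zero  , σ , w , x ⟩ = ⟨ t , σ , w , x ⟩
setTag t ⟨ suc u , σ , w , x ⟩ = ⟨ suc u , σ , w , x ⟩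

module Weights (M : ℕ) where

  -- Truncation at `M` bounds the queries for arbitrary data. Before rounding it can only lower the
  -- cost, as `initial-cost` allows; after rounding `w e + w f` and both values are at most P, so
  -- with `M = P * (P * P)` the cost is exact.
  weight : EdgeData → EdgeData → ℕ
  weight z z′ = (wt z + wt z′) * (val z * val z′) ⊓ M

  weight-sym : ∀ z z′ → weight z z′ ≡ weight z′ z
  weight-sym z z′ = cong₂ (λ a b → a * b ⊓ M) (+-comm (wt z) (wt z′)) (*-comm (val z) (val z′))

  slotWeight : EdgeData → EdgeData → ℕ
  slotWeight z z′ = 𝟙 (slot z ≡ᵇ slot z′) * weight z z′

  splitQuad : EdgeData → EdgeData → ℕ
  splitQuad z z′ = tagCost (tag z) (tag z′) * slotWeight z z′

  slotWeight-sym : ∀ z z′ → slotWeight z z′ ≡ slotWeight z′ z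
  slotWeight-sym z z′ = cong₂ (λ b n → 𝟙 b * n) (≡ᵇ-sym (slot z) (slot z′)) (weight-sym z z′)

  slotWeight≤M : ∀ z z′ → slotWeight z z′ ≤ M
  slotWeight≤M z z′ = ≤-trans (𝟙*≤ (slot z ≡ᵇ slot z′) (weight z z′)) (m⊓n≤n _ M)

  splitQuad-avg : ∀ z z′ → splitQuad (setTag 1 z) z′ + splitQuad (setTag 2 z) z′ ≤ 2 * splitQuad z z′
  splitQuad-avg z@(⟨ zero , _ , _ , _ ⟩) z′ = begin
    tagCost 1 (tag z′) * w + tagCost 2 (tag z′) * w   ≡⟨ sym (*-distribʳ-+ w (tagCost 1 (tag z′)) _) ⟩
    (tagCost 1 (tag z′) + tagCost 2 (tag z′)) * w     ≤⟨ *-monoˡ-≤ w (tagCost-avg (tag z′)) ⟩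
    2 * w                                             ≡⟨ cong (2 *_) (sym (*-identityˡ w)) ⟩
    2 * (1 * w)                                       ∎
    where
    open ≤-Reasoning
    w = slotWeight z z′
  splitQuad-avg z@(⟨ suc _ , _ , _ , _ ⟩) z′ = ≤-reflexive (cong (splitQuad z z′ +_) (sym (+-identityʳ (splitQuad z z′))))

  module Slots (s y N : ℕ) where
    open Lines s slotWeight hiding (module Spec)
    module LinesSpec = Lines.Spec s slotWeight
    open Sweeping splitQuad (λ _ → 0) (setTag 1) (setTag 2) hiding (module Spec)
    module SweepSpec = Sweeping.Spec splitQuad (λ _ → 0) (setTag 1) (setTag 2)

    classes : ℕ
    classes = 2 ^ (4 + 3 * s)

    halveDepth : ℕ
    halveDepth = N * (s * 2) + classes * 2

    halve : ℕ → EdgeData → EProg halveDepth EdgeData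
    halve b z = bind (N * (s * 2)) (reduce N y b z) λ χ → sweep classes χ z

    next : ℕ → EdgeData → ℕ
    next σ z = 2 * σ + (tag z ∸ 1)

    -- A crude colouring with few classes is enough to split every slot almost evenly, and J splits give
    -- 2^J slots carrying about a 2^-J fraction of the weight.
    refine : ∀ m → (b w x σ : ℕ) → EProg (m * halveDepth) ℕ
    refine zero    b w x σ = σ
    refine (suc m) b w x σ = bind halveDepth (halve b ⟨ 0 , σ , w , x ⟩) λ z → refine m b w x (next σ z)

    module Spec {I : Set} (items : List I) (κ : I → I → Bool) (κ-sym : ∀ e f → κ e f ≡ κ f e) (cap : ℕ)
                (cap≥ : M * 2 ^ s ≤ cap) (cap≥′ : 2 * M ≤ cap) (y≤ : y ≤ 2 ^ N)
                (b w x : I → ℕ) (b-proper : ∀ e f → κ e f ≡ true → b e ≢ b f)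
                (b-bound : ∀ e → b e < 2 ^ (2 + 3 * s + 2 * y)) where
      open Semantics items κ cap

      data₀ : (I → ℕ) → I → EdgeData
      data₀ σ e = ⟨ 0 , σ e , w e , x e ⟩

      slotSum : (I → ℕ) → ℕ
      slotSum σ = pairSum λ e f → slotWeight (data₀ σ e) (data₀ σ f)

      module Halve (σ : I → ℕ) where
        z = data₀ σ
        module L = LinesSpec items κ cap (λ z z′ → ≤-trans (*-monoˡ-≤ (2 ^ s) (slotWeight≤M z z′)) cap≥) z
        χ = L.reduced N y b
        module S = SweepSpec items κ κ-sym cap
          (λ z z′ → cong₂ _*_ (tagCost-sym (tag z) (tag z′)) (slotWeight-sym z z′))
          (λ z z′ → ≤-trans (*-mono-≤ (tagCost≤2 (tag z) (tag z′)) (slotWeight≤M z z′)) cap≥′)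
          splitQuad-avg (λ _ → z≤n) χ
        z′ = S.swept classes z
        σ′ : I → ℕ
        σ′ e = next (σ e) (z′ e)

        halved≡ : exec halveDepth (λ e → halve (b e) (z e)) ≡ z′
        halved≡ = exec-bind (N * (s * 2)) _ _

        tagged : ∀ e → z′ e ≡ ⟨ 1 , σ e , w e , x e ⟩ ⊎ z′ e ≡ ⟨ 2 , σ e , w e , x e ⟩
        tagged e = S.swept-moves classes z e (L.reduce-bound N y b y≤ b-bound e)

        tag≤ : ∀ e → tag (z′ e) ∸ 1 ≤ 1
        tag≤ e with tagged e
        ... | inj₁ p rewrite p = z≤n
        ... | inj₂ p rewrite p = ≤-refl

        slotWeight-z′ : ∀ e f → slotWeight (z′ e) (z′ f) ≡ slotWeight (z e) (z f)
        slotWeight-z′ e f with tagged e | tagged f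
        ... | inj₁ p | inj₁ q rewrite p | q = refl
        ... | inj₁ p | inj₂ q rewrite p | q = refl
        ... | inj₂ p | inj₁ q rewrite p | q = refl
        ... | inj₂ p | inj₂ q rewrite p | q = refl

        -- New slots agree only if the old slots and the chosen halves both agree, and then
        -- `tagCost` is 2.
        same-next : ∀ e f → 2 * slotWeight (data₀ σ′ e) (data₀ σ′ f) ≤ splitQuad (z′ e) (z′ f)
        same-next e f with σ′ e ≟ σ′ f
        ... | no p rewrite ≢⇒≡ᵇ-false (σ′ e) (σ′ f) p = z≤n
        ... | yes p rewrite slotWeight-z′ e f | p | ≡ᵇ-refl (σ′ f) =
          bits (2*-+-injective (σ e) (σ f) _ _ (tag≤ e) (tag≤ f) p)
          where
          tags : tag (z′ e) ∸ 1 ≡ tag (z′ f) ∸ 1 → tagCost (tag (z′ e)) (tag (z′ f)) ≡ 2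
          tags q with tagged e | tagged f
          ... | inj₁ p | inj₁ p′ rewrite p | p′ = refl
          ... | inj₂ p | inj₂ p′ rewrite p | p′ = refl
          ... | inj₁ p | inj₂ p′ rewrite p | p′ with q
          ...   | ()
          tags q | inj₂ p | inj₁ p′ rewrite p | p′ with q
          ...   | ()
          bits : σ e ≡ σ f × tag (z′ e) ∸ 1 ≡ tag (z′ f) ∸ 1 →
                 2 * (1 * weight (z e) (z f)) ≤ tagCost (tag (z′ e)) (tag (z′ f)) * (𝟙 (σ e ≡ᵇ σ f) * weight (z e) (z f))
          bits (q , r) rewrite tags r | q | ≡ᵇ-refl (σ f) = ≤-refl

        clash≤ : S.clash classes z′ ≤ 2 * ∑ items (L.mono χ)
        clash≤ = ≤-trans (pairSum-mono pointwise) (≤-reflexive (pairSum-* 2 _))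
          where
          pointwise : ∀ e f → 𝟙 ((χ e ≡ᵇ χ f) ∧ (χ e <ᵇ classes)) * splitQuad (z′ e) (z′ f)
                            ≤ 2 * (slotWeight (z e) (z f) * 𝟙 (χ e ≡ᵇ χ f))
          pointwise e f with χ e ≡ᵇ χ f
          ... | false = z≤n
          ... | true  = ≤-trans (𝟙*≤ (χ e <ᵇ classes) _) (≤-trans
                (*-mono-≤ (tagCost≤2 (tag (z′ e)) (tag (z′ f))) (≤-reflexive (slotWeight-z′ e f)))
                (≤-reflexive (cong (2 *_) (sym (*-identityʳ (slotWeight (z e) (z f)))))))

        mono-base : ∀ e → L.mono b e ≡ 0
        mono-base e = trans (∑-cong items vanish) (∑-zero items)
          where
          vanish : ∀ f → 𝟙 (κ e f) * (slotWeight (z e) (z f) * 𝟙 (b e ≡ᵇ b f)) ≡ 0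
          vanish f with κ e f in eq
          ... | false = refl
          ... | true rewrite ≢⇒≡ᵇ-false (b e) (b f) (b-proper e f eq) | *-zeroʳ (slotWeight (z e) (z f)) = refl

        mono-sum : 2 ^ s * ∑ items (L.mono χ) ≤ N * slotSum σ
        mono-sum = subst₂ _≤_ (∑-* (2 ^ s) items _) (∑-* N items _) (∑-mono items λ e → begin
          2 ^ s * L.mono χ e                       ≤⟨ L.reduce-mono N y b e ⟩
          2 ^ s * L.mono b e + N * L.total e       ≡⟨ cong (λ t → 2 ^ s * t + N * L.total e) (mono-base e) ⟩
          2 ^ s * 0 + N * L.total e                ≡⟨ cong (_+ N * L.total e) (*-zeroʳ (2 ^ s)) ⟩
          N * L.total e                            ∎)
          where open ≤-Reasoning

        -- With all tags undecided, `splitQuad` is the slot weight itself, twice what a random split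
        -- keeps in expectation. Pairs of equal crude colour ignore each other and may add twice
        -- their weight, but by `mono-sum` they carry only an N / 2^s share.
        halve-spec : 2 ^ s * (2 * slotSum σ′) ≤ 2 ^ s * slotSum σ + 2 * N * slotSum σ
        halve-spec = begin
          2 ^ s * (2 * slotSum σ′)                                    ≡⟨ cong (2 ^ s *_) (sym (pairSum-* 2 _)) ⟩
          2 ^ s * pairSum (λ e f → 2 * slotWeight (data₀ σ′ e) (data₀ σ′ f)) ≤⟨ *-monoʳ-≤ (2 ^ s) (pairSum-mono same-next) ⟩
          2 ^ s * S.cost z′                                           ≤⟨ *-monoʳ-≤ (2 ^ s) swept≤ ⟩
          2 ^ s * (S.cost z + 2 * ∑ items (L.mono χ))                 ≡⟨ arith (2 ^ s) (S.cost z) _ ⟩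
          2 ^ s * S.cost z + 2 * (2 ^ s * ∑ items (L.mono χ))         ≤⟨ +-mono-≤ (*-monoʳ-≤ (2 ^ s) (≤-reflexive (pairSum-cong λ e f → *-identityˡ _))) (*-monoʳ-≤ 2 mono-sum) ⟩
          2 ^ s * slotSum σ + 2 * (N * slotSum σ)                     ≡⟨ cong (2 ^ s * slotSum σ +_) (sym (*-assoc 2 N _)) ⟩
          2 ^ s * slotSum σ + 2 * N * slotSum σ                       ∎
          where
          open ≤-Reasoning
          arith : ∀ a b c → a * (b + 2 * c) ≡ a * b + 2 * (a * c)
          arith = solve-∀
          swept≤ : S.cost z′ ≤ S.cost z + 2 * ∑ items (L.mono χ)
          swept≤ = ≤-trans (m≤m+n _ (S.utility z)) (≤-trans (S.sweep-cost classes z)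
            (+-mono-≤ (≤-reflexive (trans (cong (S.cost z +_) (∑-zero items)) (+-identityʳ _))) clash≤))

      refined : ∀ m → (I → ℕ) → I → ℕ
      refined m σ = exec (m * halveDepth) λ e → refine m (b e) (w e) (x e) (σ e)

      refined-suc : ∀ m σ → refined (suc m) σ ≡ refined m (Halve.σ′ σ)
      refined-suc m σ = trans (exec-bind halveDepth _ _)
        (cong (λ z → exec (m * halveDepth) λ e → refine m (b e) (w e) (x e) (next (σ e) (z e))) (Halve.halved≡ σ))

      -- The factor (J + m) / J absorbs the defects of the at most J halvings.
      refine-spec : ∀ J → 4 * (J * N) ≤ 2 ^ s → ∀ m → m ≤ J → ∀ σ →
                    2 ^ m * (J * slotSum (refined m σ)) ≤ (J + m) * slotSum σ
      refine-spec J J≤ zero    m≤ σ = ≤-reflexive (trans (*-identityˡ _) (cong (_* slotSum σ) (sym (+-identityʳ J))))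
      refine-spec J J≤ (suc m) m< σ rewrite refined-suc m σ = *-cancelˡ-≤ (2 ^ s) (begin
        2 ^ s * (2 ^ suc m * (J * slotSum ρ))                ≡⟨ e₁ (2 ^ s) (2 ^ m) (J * slotSum ρ) ⟩
        2 ^ s * 2 * (2 ^ m * (J * slotSum ρ))                ≤⟨ *-monoʳ-≤ (2 ^ s * 2) (refine-spec J J≤ m (<⇒≤ m<) σ′) ⟩
        2 ^ s * 2 * ((J + m) * slotSum σ′)                   ≡⟨ e₂ (2 ^ s) (J + m) (slotSum σ′) ⟩
        (J + m) * (2 ^ s * (2 * slotSum σ′))                 ≤⟨ *-monoʳ-≤ (J + m) (Halve.halve-spec σ) ⟩
        (J + m) * (2 ^ s * W + 2 * N * W)                    ≡⟨ e₃ (J + m) (2 ^ s) N W ⟩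
        -- As m < J, the error factor 2 (J + m) N is at most 4 J N ≤ 2^s, which is one more unit in
        -- the factor J + m.
        2 ^ s * ((J + m) * W) + 2 * ((J + m) * N) * W        ≤⟨ +-monoʳ-≤ _ (*-monoˡ-≤ W (≤-trans (*-monoʳ-≤ 2 (*-monoˡ-≤ N (+-monoʳ-≤ J (<⇒≤ m<)))) (≤-trans (≤-reflexive (e₄ J N)) J≤))) ⟩
        2 ^ s * ((J + m) * W) + 2 ^ s * W                    ≡⟨ e₅ (2 ^ s) J m W ⟩
        2 ^ s * ((J + suc m) * W)                            ∎)
        where
        open ≤-Reasoning
        instance _ = m^n≢0 2 s
        σ′ = Halve.σ′ σ
        ρ = refined m σ′
        W = slotSum σ
        e₁ : ∀ a p c → a * (2 * p * c) ≡ a * 2 * (p * c)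
        e₁ = solve-∀
        e₂ : ∀ a b c → a * 2 * (b * c) ≡ b * (a * (2 * c))
        e₂ = solve-∀
        e₃ : ∀ j a n w → j * (a * w + 2 * n * w) ≡ a * (j * w) + 2 * (j * n) * w
        e₃ = solve-∀
        e₄ : ∀ j n → 2 * ((j + j) * n) ≡ 4 * (j * n)
        e₄ = solve-∀
        e₅ : ∀ a j m w → a * ((j + m) * w) + a * w ≡ a * ((j + suc m) * w)
        e₅ = solve-∀

      refine-bound : ∀ m σ e → refined m σ e < 2 ^ m * suc (σ e)
      refine-bound zero    σ e = ≤-reflexive (sym (*-identityˡ _))
      refine-bound (suc m) σ e rewrite refined-suc m σ = begin-strict
        refined m (Halve.σ′ σ) e           <⟨ refine-bound m (Halve.σ′ σ) e ⟩
        2 ^ m * suc (Halve.σ′ σ e)         ≤⟨ *-monoʳ-≤ (2 ^ m) (s≤s (+-monoʳ-≤ (2 * σ e) (Halve.tag≤ σ e))) ⟩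
        2 ^ m * suc (2 * σ e + 1)          ≡⟨ eq (2 ^ m) (σ e) ⟩
        2 ^ suc m * suc (σ e)              ∎
        where
        open ≤-Reasoning
        eq : ∀ p σ → p * suc (2 * σ + 1) ≡ 2 * p * suc σ
        eq = solve-∀

-- Rounding fractional matchings

scaleVal : ℕ → EdgeData → EdgeData
scaleVal k ⟨ t , σ , w , x ⟩ = ⟨ t , σ , w , k * x ⟩

-- Truncation is concave, so capping weights at `M` does not spoil the average over dropping and
-- doubling.
*-⊓-≤ : ∀ k .{{_ : NonZero k}} m n → k * m ⊓ n ≤ k * (m ⊓ n)
*-⊓-≤ k m n = ≤-trans (⊓-monoʳ-≤ (k * m) (m≤n*m n k)) (≤-reflexive (sym (*-distribˡ-⊓ k m n)))

module Levels (M L s y N J : ℕ) where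
  open Weights M
  open Slots s y N hiding (module Spec)
  module SlotsSpec = Slots.Spec s y N

  -- The cost is quadratic in values measured in units of 2^-L and the utility linear, hence the
  -- factor 2^L; the factor 2 L matches the weight of the cost before the first level.
  g : ℕ
  g = 2 * L * 2 ^ L

  quad : ℕ → EdgeData → EdgeData → ℕ
  quad a z z′ = a * weight z z′

  gain : EdgeData → ℕ
  gain z = g * (wt z * val z)

  slots : ℕ
  slots = 2 ^ J

  levelDepth : ℕ
  levelDepth = J * halveDepth + slots * 2

  -- Edges that are idle at level j get value 0, hence weight 0, so the splitting cares only about
  -- pairs that can clash.
  restrict : ℕ → ℕ → ℕ
  restrict j x = if x ≡ᵇ 2 ^ j then x else 0

  -- Idle edges are parked in the class `slots`, which the sweep does not reach.
  class : ℕ → ℕ → ℕ → ℕ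
  class j x σ = if x ≡ᵇ 2 ^ j then σ else slots

  level : ℕ → ℕ → (b w x : ℕ) → EProg levelDepth EdgeData
  level a j b w x = bind (J * halveDepth) (refine J b w (restrict j x) 0) λ σ →
    Sweeping.sweep (quad a) gain (scaleVal 0) (scaleVal 2) slots (class j x σ) ⟨ 0 , 0 , w , x ⟩

  -- Level j doubles or drops the edges of value 2^j.  The weight of the cost falls from 2 L to L
  -- over the L levels, paying for the defect of each level's colouring.
  levels : ∀ r → ℕ → (b w x : ℕ) → EProg (r * levelDepth) ℕ
  levels zero    j b w x = x
  levels (suc r) j b w x = bind levelDepth (level (L + r) j b w x) λ z → levels r (suc j) b w (val z)

  -- The invariant on entering level j: the smaller powers are already gone. At j = L only 0 and 2^L
  -- remain, which stand for the values 0 and 1.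
  Dyadic : ℕ → ℕ → Set
  Dyadic j x = x ≡ 0 ⊎ ∃ λ i → x ≡ 2 ^ i × j ≤ i × i ≤ L

  module Spec {I : Set} (items : List I) (κ : I → I → Bool) (κ-sym : ∀ e f → κ e f ≡ κ f e) (cap : ℕ)
              (cap≥ : M * 2 ^ s ≤ cap) (cap≥′ : 2 * M ≤ cap) (cap≥″ : 2 * L * M ≤ cap) (y≤ : y ≤ 2 ^ N)
              .{{_ : NonZero J}} (J≤ : 4 * (J * N) ≤ 2 ^ s) (L≤ : 16 * L ≤ slots)
              (b w : I → ℕ) (b-proper : ∀ e f → κ e f ≡ true → b e ≢ b f)
              (b-bound : ∀ e → b e < 2 ^ (2 + 3 * s + 2 * y)) where
    open Semantics items κ cap

    edgeData : (I → ℕ) → I → EdgeData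
    edgeData x e = ⟨ 0 , 0 , w e , x e ⟩

    C U : (I → ℕ) → ℕ
    C x = pairSum λ e f → weight (edgeData x e) (edgeData x f)
    U x = ∑ items λ e → w e * x e

    module Level (r j : ℕ) (r< : r < L) (x : I → ℕ) where
      a = L + r
      a≤ : a ≤ 2 * L
      a≤ = +-monoʳ-≤ L (≤-trans (<⇒≤ r<) (≤-reflexive (sym (+-identityʳ L))))
      xʳ : I → ℕ
      xʳ e = restrict j (x e)
      module R = SlotsSpec items κ κ-sym cap cap≥ cap≥′ y≤ b w xʳ b-proper b-bound
      ρ = R.refined J (λ _ → 0)
      χ : I → ℕ
      χ e = class j (x e) (ρ e)
      z = edgeData x
      quad-avg : ∀ z z′ → quad a (scaleVal 0 z) z′ + quad a (scaleVal 2 z) z′ ≤ 2 * quad a z z′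
      quad-avg z z′ = begin
        a * (W * 0 ⊓ M) + a * (W * (2 * val z * val z′) ⊓ M)   ≡⟨ cong₂ (λ p q → a * (p ⊓ M) + a * (q ⊓ M)) (*-zeroʳ W) (e₁ W (val z) (val z′)) ⟩
        a * 0 + a * (2 * (W * (val z * val z′)) ⊓ M)           ≤⟨ +-mono-≤ (≤-reflexive (*-zeroʳ a)) (*-monoʳ-≤ a (*-⊓-≤ 2 (W * (val z * val z′)) M)) ⟩
        a * (2 * weight z z′)                                  ≡⟨ e₂ a (weight z z′) ⟩
        2 * (a * weight z z′)                                  ∎
        where
        open ≤-Reasoning
        W = wt z + wt z′
        e₁ : ∀ w a b → w * (2 * a * b) ≡ 2 * (w * (a * b))
        e₁ = solve-∀
        e₂ : ∀ a b → a * (2 * b) ≡ 2 * (a * b)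
        e₂ = solve-∀
      gain-avg : ∀ z → 2 * gain z ≤ gain (scaleVal 0 z) + gain (scaleVal 2 z)
      gain-avg z = ≤-reflexive (eq g (wt z) (val z))
        where
        eq : ∀ g w x → 2 * (g * (w * x)) ≡ g * (w * 0) + g * (w * (2 * x))
        eq = solve-∀
      module S = Sweeping.Spec (quad a) gain (scaleVal 0) (scaleVal 2) items κ κ-sym cap
        (λ z z′ → cong (a *_) (weight-sym z z′))
        (λ z z′ → ≤-trans (*-mono-≤ a≤ (m⊓n≤n _ M)) cap≥″)
        quad-avg gain-avg χ
      z′ = S.swept slots z
      x′ : I → ℕ
      x′ e = val (z′ e)

      level≡ : exec levelDepth (λ e → level a j (b e) (w e) (x e)) ≡ z′
      level≡ = exec-bind (J * halveDepth) _ _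

      ρ< : ∀ e → ρ e < slots
      ρ< e = subst (ρ e <_) (*-identityʳ slots) (R.refine-bound J (λ _ → 0) e)

      outcome : ∀ e → (x e ≢ 2 ^ j × z′ e ≡ z e)
                    ⊎ (x e ≡ 2 ^ j × χ e ≡ ρ e × xʳ e ≡ x e × (z′ e ≡ scaleVal 0 (z e) ⊎ z′ e ≡ scaleVal 2 (z e)))
      outcome e with x e ≟ 2 ^ j
      ... | no p = inj₁ (p , S.swept-keeps slots z e inactive)
        where
        inactive : slots ≤ χ e
        inactive rewrite ≢⇒≡ᵇ-false (x e) (2 ^ j) p = ≤-refl
      ... | yes p = inj₂ (p , χ≡ρ , xʳ≡x , S.swept-moves slots z e (subst (_< slots) (sym χ≡ρ) (ρ< e)))
        where
        active : (x e ≡ᵇ 2 ^ j) ≡ true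
        active = trans (cong (_≡ᵇ 2 ^ j) p) (≡ᵇ-refl (2 ^ j))
        χ≡ρ : χ e ≡ ρ e
        χ≡ρ rewrite active = refl
        xʳ≡x : xʳ e ≡ x e
        xʳ≡x rewrite active = refl

      edgeData-x′ : ∀ e → z′ e ≡ edgeData x′ e
      edgeData-x′ e with outcome e
      ... | inj₁ (_ , p) rewrite p = refl
      ... | inj₂ (_ , _ , _ , inj₁ p) rewrite p = refl
      ... | inj₂ (_ , _ , _ , inj₂ p) rewrite p = refl

      x′≤ : ∀ e → x′ e ≤ 2 * x e
      x′≤ e with outcome e
      ... | inj₁ (_ , p) rewrite p = m≤m+n (x e) _
      ... | inj₂ (_ , _ , _ , inj₁ p) rewrite p = z≤n
      ... | inj₂ (_ , _ , _ , inj₂ p) rewrite p = ≤-refl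

      weight-z′ : ∀ e f → weight (z′ e) (z′ f) ≤ 4 * weight (z e) (z f)
      weight-z′ e f rewrite edgeData-x′ e | edgeData-x′ f = begin
        W * (x′ e * x′ f) ⊓ M                ≤⟨ ⊓-monoˡ-≤ M (*-monoʳ-≤ W (*-mono-≤ (x′≤ e) (x′≤ f))) ⟩
        W * (2 * x e * (2 * x f)) ⊓ M        ≡⟨ cong (_⊓ M) (eq W (x e) (x f)) ⟩
        4 * (W * (x e * x f)) ⊓ M            ≤⟨ *-⊓-≤ 4 (W * (x e * x f)) M ⟩
        4 * weight (z e) (z f)               ∎
        where
        open ≤-Reasoning
        W = w e + w f
        eq : ∀ w a b → w * (2 * a * (2 * b)) ≡ 4 * (w * (a * b))
        eq = solve-∀

      clash-pointwise : ∀ e f → 𝟙 ((χ e ≡ᵇ χ f) ∧ (χ e <ᵇ slots)) * quad a (z′ e) (z′ f)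
                              ≤ 4 * a * slotWeight (R.data₀ ρ e) (R.data₀ ρ f)
      clash-pointwise e f with χ e ≟ χ f
      ... | no p rewrite ≢⇒≡ᵇ-false (χ e) (χ f) p = z≤n
      ... | yes p with χ e <ᵇ slots in eq
      ...   | false rewrite p | ≡ᵇ-refl (χ f) = z≤n
      ...   | true = ≤-trans (𝟙*≤ ((χ e ≡ᵇ χ f) ∧ true) _) (both (outcome e) (outcome f))
        where
        χe< : χ e < slots
        χe< = <ᵇ⇒< (χ e) slots (subst T (sym eq) _)
        idle : ∀ e → x e ≢ 2 ^ j → ¬ χ e < slots
        idle e p χ< rewrite ≢⇒≡ᵇ-false (x e) (2 ^ j) p = <-irrefl refl χ<
        both : _ → _ → a * weight (z′ e) (z′ f) ≤ 4 * a * slotWeight (R.data₀ ρ e) (R.data₀ ρ f)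
        both (inj₁ (q , _)) _ = ⊥-elim (idle e q χe<)
        both _ (inj₁ (q , _)) = ⊥-elim (idle f q (subst (_< slots) p χe<))
        both (inj₂ (_ , χe , xe , _)) (inj₂ (_ , χf , xf , _))
          rewrite trans (sym χe) (trans p χf) | ≡ᵇ-refl (ρ f) | xe | xf =
          ≤-trans (*-monoʳ-≤ a (weight-z′ e f)) (≤-reflexive (eq′ a _))
          where
          eq′ : ∀ a n → a * (4 * n) ≡ 4 * a * (1 * n)
          eq′ = solve-∀

      restrict-sum : R.slotSum (λ _ → 0) ≤ C x
      restrict-sum = pairSum-mono λ e f → ≤-trans (≤-reflexive (*-identityˡ _))
        (⊓-monoˡ-≤ M (*-monoʳ-≤ (w e + w f) (*-mono-≤ (restrict≤ (x e)) (restrict≤ (x f)))))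
        where
        restrict≤ : ∀ n → restrict j n ≤ n
        restrict≤ n with n ≡ᵇ 2 ^ j
        ... | true  = ≤-refl
        ... | false = z≤n

      -- Doubling both ends multiplies a weight by at most 4, and the cost has weight a ≤ 2 L, so a
      -- pair is charged at most 8 L times. The slots retain at most a 2 / `slots` share of the
      -- weight by `refine-spec`, and 16 L ≤ `slots` leaves `C x`: exactly what lowering the weight
      -- of the cost by one pays for.
      clash≤ : S.clash slots z′ ≤ C x
      clash≤ = *-cancelˡ-≤ (2 * J) {{m*n≢0 2 J}} (begin
        2 * J * S.clash slots z′             ≤⟨ *-monoʳ-≤ (2 * J) (≤-trans (pairSum-mono clash-pointwise) (≤-reflexive (pairSum-* (4 * a) _))) ⟩
        2 * J * (4 * a * V)                  ≤⟨ *-monoʳ-≤ (2 * J) (*-monoˡ-≤ V (*-monoʳ-≤ 4 a≤)) ⟩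
        2 * J * (4 * (2 * L) * V)            ≡⟨ e₁ J L V ⟩
        16 * L * (J * V)                     ≤⟨ *-monoˡ-≤ (J * V) L≤ ⟩
        slots * (J * V)                      ≤⟨ R.refine-spec J J≤ J ≤-refl (λ _ → 0) ⟩
        (J + J) * R.slotSum (λ _ → 0)        ≤⟨ *-mono-≤ (≤-reflexive (cong (J +_) (sym (+-identityʳ J)))) restrict-sum ⟩
        2 * J * C x                          ∎)
        where
        open ≤-Reasoning
        V = R.slotSum ρ
        e₁ : ∀ j l v → 2 * j * (4 * (2 * l) * v) ≡ 16 * l * (j * v)
        e₁ = solve-∀

      level-cost : a * C x′ + g * U x ≤ (L + suc r) * C x + g * U x′
      level-cost = begin
        a * C x′ + g * U x                     ≡⟨ cong₂ _+_ (trans (sym (pairSum-* a _)) (pairSum-cong λ e f → cong₂ (quad a) (sym (edgeData-x′ e)) (sym (edgeData-x′ f)))) (sym (∑-* g items _)) ⟩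
        S.cost z′ + S.utility z                ≤⟨ S.sweep-cost slots z ⟩
        S.cost z + S.utility z′ + S.clash slots z′ ≤⟨ +-monoʳ-≤ _ clash≤ ⟩
        S.cost z + S.utility z′ + C x          ≡⟨ cong₂ (λ p q → p + q + C x) (pairSum-* a _) (trans (∑-cong items λ e → cong gain (edgeData-x′ e)) (∑-* g items _)) ⟩
        a * C x + g * U x′ + C x               ≡⟨ e₁ L r (C x) (g * U x′) ⟩
        (L + suc r) * C x + g * U x′           ∎
        where
        open ≤-Reasoning
        e₁ : ∀ l r c u → (l + r) * c + u + c ≡ (l + suc r) * c + u
        e₁ = solve-∀

      level-dyadic : suc j ≤ L → (∀ e → Dyadic j (x e)) → ∀ e → Dyadic (suc j) (x′ e)
      level-dyadic j<L dy e with outcome e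
      ... | inj₂ (_ , _ , _ , inj₁ q) rewrite q = inj₁ refl
      ... | inj₂ (p , _ , _ , inj₂ q) rewrite q | p = inj₂ (suc j , refl , ≤-refl , j<L)
      ... | inj₁ (p , q) rewrite q with dy e
      ...   | inj₁ x≡0 = inj₁ x≡0
      ...   | inj₂ (i , x≡ , j≤ , i≤) = inj₂ (i , x≡ , ≤∧≢⇒< j≤ (λ j≡i → p (trans x≡ (cong (2 ^_) (sym j≡i)))) , i≤)

      level-zero : ∀ e → x e ≡ 0 → x′ e ≡ 0
      level-zero e x≡0 with outcome e
      ... | inj₁ (_ , q) rewrite q = x≡0
      ... | inj₂ (_ , _ , _ , inj₁ q) rewrite q = refl
      ... | inj₂ (_ , _ , _ , inj₂ q) rewrite q | x≡0 = refl

    leveled : ∀ r j → (I → ℕ) → I → ℕ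
    leveled r j x = exec (r * levelDepth) λ e → levels r j (b e) (w e) (x e)

    leveled-suc : ∀ r j (r< : r < L) x → leveled (suc r) j x ≡ leveled r (suc j) (Level.x′ r j r< x)
    leveled-suc r j r< x = trans (exec-bind levelDepth _ _)
      (cong (λ z → exec (r * levelDepth) λ e → levels r (suc j) (b e) (w e) (val (z e))) (Level.level≡ r j r< x))

    levels-cost : ∀ r j x → r ≤ L → L * C (leveled r j x) + g * U x ≤ (L + r) * C x + g * U (leveled r j x)
    levels-cost zero    j x r≤ = ≤-reflexive (cong (λ t → t * C x + g * U x) (sym (+-identityʳ L)))
    levels-cost (suc r) j x r< rewrite leveled-suc r j r< x = +-cancelʳ-≤ ((L + r) * C x′ + g * U x′) _ _ (begin
      L * C x″ + g * U x + ((L + r) * C x′ + g * U x′)            ≡⟨ e₁ (L * C x″) (g * U x) ((L + r) * C x′) (g * U x′) ⟩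
      (L * C x″ + g * U x′) + ((L + r) * C x′ + g * U x)          ≤⟨ +-mono-≤ (levels-cost r (suc j) x′ (<⇒≤ r<)) (Level.level-cost r j r< x) ⟩
      ((L + r) * C x′ + g * U x″) + ((L + suc r) * C x + g * U x′) ≡⟨ e₂ ((L + r) * C x′) (g * U x″) ((L + suc r) * C x) (g * U x′) ⟩
      (L + suc r) * C x + g * U x″ + ((L + r) * C x′ + g * U x′)  ∎)
      where
      open ≤-Reasoning
      x′ = Level.x′ r j r< x
      x″ = leveled r (suc j) x′
      e₁ : ∀ a b c d → a + b + (c + d) ≡ (a + d) + (c + b)
      e₁ = solve-∀
      e₂ : ∀ a b c d → (a + b) + (c + d) ≡ c + b + (a + d)
      e₂ = solve-∀

    levels-dyadic : ∀ r j x → r + j ≡ L → (∀ e → Dyadic j (x e)) → ∀ e → leveled r j x e ≡ 0 ⊎ leveled r j x e ≡ 2 ^ L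
    levels-dyadic zero    j x refl dy e with dy e
    ... | inj₁ p = inj₁ p
    ... | inj₂ (i , p , j≤ , i≤) = inj₂ (trans p (cong (2 ^_) (≤-antisym i≤ j≤)))
    levels-dyadic (suc r) j x eq dy e rewrite leveled-suc r j (≤-trans (m≤m+n (suc r) j) (≤-reflexive eq)) x =
      levels-dyadic r (suc j) _ (trans (+-suc r j) eq)
        (Level.level-dyadic r j r< x (≤-trans (s≤s (m≤n+m j r)) (≤-reflexive eq)) dy) e
      where
      r< : r < L
      r< = ≤-trans (m≤m+n (suc r) j) (≤-reflexive eq)

    levels-zero : ∀ r j x → r ≤ L → ∀ e → x e ≡ 0 → leveled r j x e ≡ 0
    levels-zero zero    j x r≤ e x≡0 = x≡0
    levels-zero (suc r) j x r< e x≡0 rewrite leveled-suc r j r< x =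
      levels-zero r (suc j) _ (<⇒≤ r<) e (Level.level-zero r j r< x e x≡0)

-- Line graphs

∑-positive : ∀ {A : Set} (xs : List A) (f : A → ℕ) → (∃ λ x → 0 < f x) ⊎ ∑ xs f ≡ 0
∑-positive []       f = inj₂ refl
∑-positive (x ∷ xs) f with f x in eq | ∑-positive xs f
... | suc m | _      = inj₁ (x , subst (0 <_) (sym eq) z<s)
... | zero  | inj₁ p = inj₁ p
... | zero  | inj₂ p = inj₂ p

𝟙*-positive : ∀ {a b} → 0 < 𝟙 a * 𝟙 b → a ≡ true × b ≡ true
𝟙*-positive {true} {true} _ = refl , refl

-- The line graph of a bipartite graph: an item lies in one row clique and one column clique, its
-- two ends. Items that are not edges are tolerated, and `count` says that the list contains every
-- item exactly once.
record LineGraph {I : Set} (items : List I) (κ : I → I → Bool) : Set where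
  field
    edge       : I → Bool
    row col    : I → ℕ
    _≟ᴵ_       : (e f : I) → Dec (e ≡ f)
    count      : ∀ e (g : I → ℕ) → ∑ items (λ f → 𝟙 (does (e ≟ᴵ f)) * g f) ≡ g e
    κ-sym      : ∀ e f → κ e f ≡ κ f e
    κ-key      : ∀ {e f} → κ e f ≡ true → row e ≡ row f ⊎ col e ≡ col f
    row-κ      : ∀ {e f} → edge e ≡ true → edge f ≡ true → row e ≡ row f → e ≢ f → κ e f ≡ true
    col-κ      : ∀ {e f} → edge e ≡ true → edge f ≡ true → col e ≡ col f → e ≢ f → κ e f ≡ true

module LineGraphSums {I : Set} (items : List I) (κ : I → I → Bool) (cap : ℕ) (G : LineGraph items κ) where
  open LineGraph G
  open Semantics items κ cap

  module Clique (key : I → ℕ)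
                (key-κ : ∀ {e f} → edge e ≡ true → edge f ≡ true → key e ≡ key f → e ≢ f → κ e f ≡ true) where

    keySum : I → (I → ℕ) → ℕ
    keySum e g = ∑ items λ f → 𝟙 (key e ≡ᵇ key f) * g f

    keySum≤ : ∀ (S : I → Bool) → (∀ {e} → S e ≡ true → edge e ≡ true) → ∀ e → edge e ≡ true →
              keySum e (λ f → 𝟙 (S f)) ≤ 𝟙 (S e) + nb e (λ f → 𝟙 (S f))
    keySum≤ S S⇒edge e edge-e = begin
      keySum e (λ f → 𝟙 (S f))                                                    ≤⟨ ∑-mono items pointwise ⟩
      ∑ items (λ f → 𝟙 (does (e ≟ᴵ f)) * 𝟙 (S f) + 𝟙 (κ e f) * 𝟙 (S f))           ≡⟨ ∑-+ items _ _ ⟩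
      ∑ items (λ f → 𝟙 (does (e ≟ᴵ f)) * 𝟙 (S f)) + nb e (λ f → 𝟙 (S f))          ≡⟨ cong (_+ nb e (λ f → 𝟙 (S f))) (count e (λ f → 𝟙 (S f))) ⟩
      𝟙 (S e) + nb e (λ f → 𝟙 (S f))                                              ∎
      where
      open ≤-Reasoning
      pointwise : ∀ f → 𝟙 (key e ≡ᵇ key f) * 𝟙 (S f) ≤ 𝟙 (does (e ≟ᴵ f)) * 𝟙 (S f) + 𝟙 (κ e f) * 𝟙 (S f)
      pointwise f with S f in Sf | key e ≡ᵇ key f in eq | e ≟ᴵ f
      ... | false | b     | _     = ≤-trans (≤-reflexive (*-zeroʳ (𝟙 b))) z≤n
      ... | true  | false | _     = z≤n
      ... | true  | true  | yes _ = m≤m+n 1 _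
      ... | true  | true  | no e≢f rewrite key-κ edge-e (S⇒edge Sf) (≡ᵇ-true⇒≡ (key e) (key f) eq) e≢f = ≤-refl

    keySum≤1 : ∀ (S : I → Bool) → (∀ {e} → S e ≡ true → edge e ≡ true) →
               (∀ {e f} → S e ≡ true → S f ≡ true → κ e f ≡ true → ⊥) → ∀ e → keySum e (λ f → 𝟙 (S f)) ≤ 1
    keySum≤1 S S⇒edge indep e with ∑-positive items (λ f → 𝟙 (key e ≡ᵇ key f) * 𝟙 (S f))
    ... | inj₂ p = ≤-trans (≤-reflexive p) z≤n
    ... | inj₁ (d , pos) = ≤-trans (∑-mono items pointwise) (≤-reflexive (count d (λ _ → 1)))
      where
      key-d : (key e ≡ᵇ key d) ≡ true × S d ≡ true
      key-d = 𝟙*-positive pos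
      pointwise : ∀ f → 𝟙 (key e ≡ᵇ key f) * 𝟙 (S f) ≤ 𝟙 (does (d ≟ᴵ f)) * 1
      pointwise f with S f in Sf | key e ≡ᵇ key f in eq | d ≟ᴵ f
      ... | false | b     | _     = ≤-trans (≤-reflexive (*-zeroʳ (𝟙 b))) z≤n
      ... | true  | false | _     = z≤n
      ... | true  | true  | yes _ = ≤-refl
      ... | true  | true  | no d≢f = ⊥-elim (indep (proj₂ key-d) Sf (key-κ (S⇒edge (proj₂ key-d)) (S⇒edge Sf)
              (trans (sym (≡ᵇ-true⇒≡ (key e) (key d) (proj₁ key-d))) (≡ᵇ-true⇒≡ (key e) (key f) eq)) d≢f))

    -- In a clique with R survivors each of them has w at least R, hence value at most P / (8 R);
    -- together they have at most P / 8.
    keySum-value : ∀ (S : I → Bool) → (∀ {e} → S e ≡ true → edge e ≡ true) → ∀ (x : I → ℕ) P →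
                   (∀ e → S e ≡ true → 8 * (suc (nb e λ f → 𝟙 (S f)) * x e) ≤ P) → (∀ e → S e ≡ false → x e ≡ 0) →
                   ∀ e → 8 * keySum e x ≤ P
    keySum-value S S⇒edge x P x≤ x0 e = cancel (keySum e (λ f → 𝟙 (S f))) refl
      where
      open ≤-Reasoning
      R = keySum e (λ f → 𝟙 (S f))
      size : ∀ f → (key e ≡ᵇ key f) ≡ true → S f ≡ true → R ≤ suc (nb f λ h → 𝟙 (S h))
      size f ke Sf = ≤-trans (≤-reflexive (cong (λ k → ∑ items λ h → 𝟙 (k ≡ᵇ key h) * 𝟙 (S h)) (≡ᵇ-true⇒≡ (key e) (key f) ke)))
        (≤-trans (keySum≤ S S⇒edge f (S⇒edge Sf)) (+-monoˡ-≤ _ (𝟙≤1 (S f))))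
      pointwise : ∀ f → 8 * R * (𝟙 (key e ≡ᵇ key f) * x f) ≤ P * (𝟙 (key e ≡ᵇ key f) * 𝟙 (S f))
      pointwise f with key e ≡ᵇ key f in ke
      ... | false = ≤-trans (≤-reflexive (*-zeroʳ (8 * R))) z≤n
      ... | true with S f in Sf
      ...   | false rewrite x0 f Sf = ≤-trans (≤-reflexive (*-zeroʳ (8 * R))) z≤n
      ...   | true = begin
        8 * R * (1 * x f)                          ≡⟨ eq R (x f) ⟩
        8 * (R * x f)                              ≤⟨ *-monoʳ-≤ 8 (*-monoˡ-≤ (x f) (size f ke Sf)) ⟩
        8 * (suc (nb f λ h → 𝟙 (S h)) * x f)       ≤⟨ x≤ f Sf ⟩
        P                                          ≡⟨ sym (*-identityʳ P) ⟩
        P * 1                                      ∎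
        where
        eq : ∀ r a → 8 * r * (1 * a) ≡ 8 * (r * a)
        eq = solve-∀
      small : ∀ f → 8 * (𝟙 (key e ≡ᵇ key f) * x f) ≤ P * (𝟙 (key e ≡ᵇ key f) * 𝟙 (S f))
      small f with key e ≡ᵇ key f
      ... | false = z≤n
      ... | true with S f in Sf
      ...   | false rewrite x0 f Sf = z≤n
      ...   | true = begin
        8 * (1 * x f)                              ≤⟨ *-monoʳ-≤ 8 (*-monoˡ-≤ (x f) (s≤s (z≤n {nb f λ h → 𝟙 (S h)}))) ⟩
        8 * (suc (nb f λ h → 𝟙 (S h)) * x f)       ≤⟨ x≤ f Sf ⟩
        P                                          ≡⟨ sym (*-identityʳ P) ⟩
        P * 1                                      ∎
      summed : 8 * R * keySum e x ≤ P * R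
      summed = subst₂ _≤_ (∑-* (8 * R) items _) (∑-* P items _) (∑-mono items pointwise)
      cancel : ∀ r → R ≡ r → 8 * keySum e x ≤ P
      -- R = 0 cannot be divided out. Then no member of the clique carries value, and the bound
      -- `small`, without the factor R, suffices.
      cancel zero    R≡0 = ≤-trans (subst₂ _≤_ (∑-* 8 items _) (∑-* P items _) (∑-mono items small))
                             (≤-trans (≤-reflexive (trans (cong (P *_) R≡0) (*-zeroʳ P))) z≤n)
      cancel (suc r) R≡ = *-cancelʳ-≤ _ _ (suc r) (begin
        8 * keySum e x * suc r      ≡⟨ eq (keySum e x) (suc r) ⟩
        8 * suc r * keySum e x      ≤⟨ subst (λ R → 8 * R * keySum e x ≤ P * R) R≡ summed ⟩
        P * suc r                   ∎)
        where
        eq : ∀ a b → 8 * a * b ≡ 8 * b * a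
        eq = solve-∀

    -- For `removal`: survivors seen from matched edges become matched edges seen from survivors, of
    -- which each clique has at most one.
    keySum-swap : ∀ (g h : I → ℕ) → ∑ items (λ e → g e * keySum e h) ≡ ∑ items (λ f → h f * keySum f g)
    keySum-swap g h = begin-equality
      ∑ items (λ e → g e * keySum e h)                                     ≡⟨ ∑-cong items (λ e → sym (∑-* (g e) items _)) ⟩
      ∑ items (λ e → ∑ items λ f → g e * (𝟙 (key e ≡ᵇ key f) * h f))       ≡⟨ ∑-swap items items _ ⟩
      ∑ items (λ f → ∑ items λ e → g e * (𝟙 (key e ≡ᵇ key f) * h f))       ≡⟨ ∑-cong items (λ f → ∑-cong items λ e → trans (cong (λ b → g e * (𝟙 b * h f)) (≡ᵇ-sym (key e) (key f))) (comm (g e) (𝟙 (key f ≡ᵇ key e)) (h f))) ⟩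
      ∑ items (λ f → ∑ items λ e → h f * (𝟙 (key f ≡ᵇ key e) * g e))       ≡⟨ ∑-cong items (λ f → ∑-* (h f) items _) ⟩
      ∑ items (λ f → h f * keySum f g)                                     ∎
      where
      open ≤-Reasoning
      comm : ∀ a b c → a * (b * c) ≡ c * (b * a)
      comm = solve-∀

  module Row = Clique row row-κ
  module Col = Clique col col-κ

  κ≤keys : ∀ e f → 𝟙 (κ e f) ≤ 𝟙 (row e ≡ᵇ row f) + 𝟙 (col e ≡ᵇ col f)
  κ≤keys e f with κ e f in eq
  ... | false = z≤n
  ... | true with κ-key eq
  ...   | inj₁ p rewrite p | ≡ᵇ-refl (row f) = s≤s z≤n
  ...   | inj₂ p rewrite p | ≡ᵇ-refl (col f) = m≤n+m 1 _

  nb≤keySums : ∀ e g → nb e g ≤ Row.keySum e g + Col.keySum e g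
  nb≤keySums e g = ≤-trans
    (∑-mono items λ f → ≤-trans (*-monoˡ-≤ (g f) (κ≤keys e f)) (≤-reflexive (*-distribʳ-+ (g f) (𝟙 (row e ≡ᵇ row f)) _)))
    (≤-reflexive (∑-+ items _ _))

  -- The edge e belongs to both of its cliques, and this pays for the `suc`.
  suc-nb≤keySums : ∀ (S : I → Bool) e → S e ≡ true →
    suc (nb e λ f → 𝟙 (S f)) ≤ Row.keySum e (λ f → 𝟙 (S f)) + Col.keySum e (λ f → 𝟙 (S f))
  suc-nb≤keySums S e Se = begin
    suc (nb e λ f → 𝟙 (S f))                                                 ≡⟨ cong (_+ nb e λ f → 𝟙 (S f)) (sym (count e (λ _ → 1))) ⟩
    ∑ items (λ f → 𝟙 (does (e ≟ᴵ f)) * 1) + nb e (λ f → 𝟙 (S f))             ≡⟨ sym (∑-+ items _ _) ⟩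
    ∑ items (λ f → 𝟙 (does (e ≟ᴵ f)) * 1 + 𝟙 (κ e f) * 𝟙 (S f))              ≤⟨ ∑-mono items pointwise ⟩
    ∑ items (λ f → 𝟙 (row e ≡ᵇ row f) * 𝟙 (S f) + 𝟙 (col e ≡ᵇ col f) * 𝟙 (S f)) ≡⟨ ∑-+ items _ _ ⟩
    _                                                                        ∎
    where
    open ≤-Reasoning
    pointwise : ∀ f → 𝟙 (does (e ≟ᴵ f)) * 1 + 𝟙 (κ e f) * 𝟙 (S f)
                    ≤ 𝟙 (row e ≡ᵇ row f) * 𝟙 (S f) + 𝟙 (col e ≡ᵇ col f) * 𝟙 (S f)
    pointwise f with e ≟ᴵ f
    ... | no _ = ≤-trans (*-monoˡ-≤ (𝟙 (S f)) (κ≤keys e f)) (≤-reflexive (*-distribʳ-+ (𝟙 (S f)) (𝟙 (row e ≡ᵇ row f)) _))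
    ... | yes refl rewrite Se | ≡ᵇ-refl (row e) | ≡ᵇ-refl (col e) = s≤s (≤-trans (≤-reflexive (*-identityʳ (𝟙 (κ e e)))) (𝟙≤1 (κ e e)))

  nb-positive : ∀ (S : I → Bool) e f → κ e f ≡ true → S f ≡ true → 0 < nb e λ h → 𝟙 (S h)
  nb-positive S e f κef Sf = begin
    1                                                              ≡⟨ cong₂ (λ a b → 𝟙 a * 𝟙 b) (sym κef) (sym Sf) ⟩
    𝟙 (κ e f) * 𝟙 (S f)                                            ≡⟨ sym (count f (λ h → 𝟙 (κ e h) * 𝟙 (S h))) ⟩
    ∑ items (λ h → 𝟙 (does (f ≟ᴵ h)) * (𝟙 (κ e h) * 𝟙 (S h)))      ≤⟨ ∑-mono items (λ h → 𝟙*≤ (does (f ≟ᴵ h)) _) ⟩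
    nb e (λ h → 𝟙 (S h))                                           ∎
    where open ≤-Reasoning

  nb-witness : ∀ (S : I → Bool) e → nb e (λ f → 𝟙 (S f)) ≢ 0 → ∃ λ f → κ e f ≡ true × S f ≡ true
  nb-witness S e nb≢0 with ∑-positive items (λ f → 𝟙 (κ e f) * 𝟙 (S f))
  ... | inj₁ (f , pos) = f , 𝟙*-positive pos
  ... | inj₂ p = ⊥-elim (nb≢0 p)

  -- An edge outside M that leaves S is adjacent to at most one edge of M at either end.
  removal : ∀ (S M S′ : I → Bool) → (∀ {e} → S e ≡ true → edge e ≡ true) → (∀ {e} → M e ≡ true → S e ≡ true) →
            (∀ {e f} → M e ≡ true → M f ≡ true → κ e f ≡ true → ⊥) →
            (∀ e → S′ e ≡ true → S e ≡ true × M e ≡ false × nb e (λ f → 𝟙 (M f)) ≡ 0) →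
            ∑ items (λ e → 𝟙 (M e) * suc (nb e λ f → 𝟙 (S f))) + 2 * ∑ items (λ e → 𝟙 (S′ e)) ≤ 2 * ∑ items (λ e → 𝟙 (S e))
  removal S M S′ S⇒edge M⇒S indep S′-spec = begin
    ∑ items (λ e → 𝟙 (M e) * suc (nb e λ f → 𝟙 (S f))) + 2 * ∑ items (λ e → 𝟙 (S′ e))
      ≤⟨ +-monoˡ-≤ _ (∑-mono items weighted) ⟩
    ∑ items (λ e → 𝟙 (M e) * Row.keySum e 𝟙S + 𝟙 (M e) * Col.keySum e 𝟙S) + 2 * ∑ items (λ e → 𝟙 (S′ e))
      ≡⟨ cong₂ _+_ (trans (∑-+ items _ _) (trans (cong₂ _+_ (Row.keySum-swap 𝟙M 𝟙S) (Col.keySum-swap 𝟙M 𝟙S)) (sym (∑-+ items _ _)))) (sym (∑-* 2 items _)) ⟩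
    ∑ items (λ f → 𝟙S f * Row.keySum f 𝟙M + 𝟙S f * Col.keySum f 𝟙M) + ∑ items (λ e → 2 * 𝟙 (S′ e))
      ≡⟨ sym (∑-+ items _ _) ⟩
    ∑ items (λ f → 𝟙S f * Row.keySum f 𝟙M + 𝟙S f * Col.keySum f 𝟙M + 2 * 𝟙 (S′ f))
      ≤⟨ ∑-mono items charged ⟩
    ∑ items (λ f → 2 * 𝟙S f)
      ≡⟨ ∑-* 2 items _ ⟩
    2 * ∑ items 𝟙S ∎
    where
    open ≤-Reasoning
    𝟙M 𝟙S : I → ℕ
    𝟙M e = 𝟙 (M e)
    𝟙S e = 𝟙 (S e)
    M⇒edge : ∀ {e} → M e ≡ true → edge e ≡ true
    M⇒edge p = S⇒edge (M⇒S p)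
    weighted : ∀ e → 𝟙 (M e) * suc (nb e 𝟙S) ≤ 𝟙 (M e) * Row.keySum e 𝟙S + 𝟙 (M e) * Col.keySum e 𝟙S
    weighted e with M e in Me
    ... | false = z≤n
    ... | true = ≤-trans (≤-reflexive (*-identityˡ _)) (≤-trans (suc-nb≤keySums S e (M⇒S Me))
                   (≤-reflexive (cong₂ _+_ (sym (*-identityˡ (Row.keySum e 𝟙S))) (sym (*-identityˡ (Col.keySum e 𝟙S))))))
    none : ∀ {e n} → n ≤ 𝟙 (M e) + nb e 𝟙M → M e ≡ false → nb e 𝟙M ≡ 0 → n ≡ 0
    none n≤ p q rewrite p | q = n≤0⇒n≡0 n≤
    charged : ∀ f → 𝟙S f * Row.keySum f 𝟙M + 𝟙S f * Col.keySum f 𝟙M + 2 * 𝟙 (S′ f) ≤ 2 * 𝟙S f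
    charged f with S′ f in S′f
    ... | false = begin
      𝟙S f * Row.keySum f 𝟙M + 𝟙S f * Col.keySum f 𝟙M + 0   ≤⟨ +-monoˡ-≤ 0 (+-mono-≤ (*-monoʳ-≤ (𝟙S f) (Row.keySum≤1 M M⇒edge indep f)) (*-monoʳ-≤ (𝟙S f) (Col.keySum≤1 M M⇒edge indep f))) ⟩
      𝟙S f * 1 + 𝟙S f * 1 + 0                               ≡⟨ eq (𝟙S f) ⟩
      2 * 𝟙S f                                              ∎
      where
      eq : ∀ a → a * 1 + a * 1 + 0 ≡ 2 * a
      eq = solve-∀
    ... | true with S′-spec f S′f
    ...   | Sf , Mf , nbf rewrite none {f} (Row.keySum≤ M M⇒edge f (S⇒edge Sf)) Mf nbf
                                | none {f} (Col.keySum≤ M M⇒edge f (S⇒edge Sf)) Mf nbf | Sf = ≤-refl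

  none-counted : ∀ (S : I → Bool) → ∑ items (λ e → 𝟙 (S e)) ≡ 0 → ∀ e → S e ≡ false
  none-counted S none e with S e in eq
  ... | false = refl
  ... | true  = ⊥-elim (<⇒≢ (begin
    1                                              ≡⟨ cong 𝟙 (sym eq) ⟩
    𝟙 (S e)                                        ≡⟨ sym (count e (λ f → 𝟙 (S f))) ⟩
    ∑ items (λ f → 𝟙 (does (e ≟ᴵ f)) * 𝟙 (S f))    ≤⟨ ∑-mono items (λ f → 𝟙*≤ (does (e ≟ᴵ f)) (𝟙 (S f))) ⟩
    ∑ items (λ f → 𝟙 (S f))                        ∎) (sym none))
    where open ≤-Reasoning

-- Phases

-- The largest 2^j with j ≤ i and 8 w 2^j ≤ P, provided that 8 w ≤ P.
initVal : ℕ → ℕ → ℕ → ℕ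
initVal P zero    w = 1
initVal P (suc i) w = if 8 * (w * 2 ^ suc i) ≤ᵇ P then 2 ^ suc i else initVal P i w

initVal-spec : ∀ P i w → 8 * w ≤ P → P ≤ 8 * (w * 2 ^ suc i) →
  8 * (w * initVal P i w) ≤ P × P ≤ 16 * (w * initVal P i w) × ∃ λ j → initVal P i w ≡ 2 ^ j × j ≤ i
initVal-spec P zero    w lo hi = subst (λ t → 8 * t ≤ P) (sym (*-identityʳ w)) lo , ≤-trans hi (≤-reflexive (eq w)) , 0 , refl , z≤n
  where
  eq : ∀ w → 8 * (w * 2) ≡ 16 * (w * 1)
  eq = solve-∀
initVal-spec P (suc i) w lo hi with 8 * (w * 2 ^ suc i) ≤ᵇ P in eq
... | true  = ≤ᵇ⇒≤ _ P (subst T (sym eq) _) , ≤-trans hi (≤-reflexive (double w (2 ^ suc i))) , suc i , refl , ≤-refl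
  where
  double : ∀ w p → 8 * (w * (2 * p)) ≡ 16 * (w * p)
  double = solve-∀
... | false with initVal-spec P i w lo (<⇒≤ (≰⇒> λ le → subst T eq (≤⇒≤ᵇ le)))
...   | p , q , j , r , j≤ = p , q , j , r , m≤n⇒m≤1+n j≤

0<⇒<ᵇ : ∀ {n} → 0 < n → (0 <ᵇ n) ≡ true
0<⇒<ᵇ z<s = refl

module Matching (L s y N J : ℕ) where
  P : ℕ
  P = 2 ^ L
  M : ℕ
  M = P * (P * P)
  open Weights M using (weight)
  open Levels M L s y N J hiding (module Spec)
  module LevelsSpec = Levels.Spec M L s y N J

  phaseDepth : ℕ
  phaseDepth = suc (L * levelDepth + 2)

  chosen? : ℕ → ℕ → Bool
  chosen? x m = (0 <ᵇ x) ∧ (m ≡ᵇ 0)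

  startVal : Bool → ℕ → ℕ
  startVal alive a = if alive then initVal P L (suc a) else 0

  select : Bool → Bool → ℕ → EProg 2 (Bool × Bool)
  select alive matched x =
    (0 , ⟨ 0 , 0 , 0 , x ⟩) , (λ (_ , z) → 𝟙 (0 <ᵇ val z)) , λ m →
    (0 , ⟨ 0 , 0 , 0 , 𝟙 (chosen? x m) ⟩) , (λ (_ , z) → val z) , λ q →
    (alive ∧ (not (chosen? x m) ∧ (q ≡ᵇ 0)) , matched ∨ chosen? x m)

  phase : ℕ → Bool × Bool → EProg phaseDepth (Bool × Bool)
  phase b (alive , matched) =
    (0 , ⟨ 0 , 0 , 0 , 𝟙 alive ⟩) , (λ (_ , z) → val z) , λ a →
    bind (L * levelDepth) (levels L 0 b (suc a) (startVal alive a)) (select alive matched)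

  phases : ∀ n → ℕ → Bool × Bool → EProg (n * phaseDepth) (Bool × Bool)
  phases zero    b st = st
  phases (suc n) b st = bind phaseDepth (phase b st) (phases n b)

  module Spec {I : Set} (items : List I) (κ : I → I → Bool) (G : LineGraph items κ) (cap : ℕ)
              (cap>0 : 1 ≤ cap)
              (cap≥ : M * 2 ^ s ≤ cap) (cap≥′ : 2 * M ≤ cap) (cap≥″ : 2 * L * M ≤ cap) (y≤ : y ≤ 2 ^ N)
              .{{_ : NonZero J}} (J≤ : 4 * (J * N) ≤ 2 ^ s) (L≤ : 16 * L ≤ slots) (L>0 : 0 < L)
              (degree≤ : ∀ e → 16 * suc (Semantics.nb items κ cap e (λ _ → 1)) ≤ P)
              (b : I → ℕ) (b-proper : ∀ e f → κ e f ≡ true → b e ≢ b f)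
              (b-bound : ∀ e → b e < 2 ^ (2 + 3 * s + 2 * y)) where
    open Semantics items κ cap
    open LineGraph G
    open LineGraphSums items κ cap G

    size : (I → Bool) → ℕ
    size S = ∑ items λ e → 𝟙 (S e)

    record Invariant (alive matched : I → Bool) : Set where
      field
        alive-edge   : ∀ {e} → alive e ≡ true → edge e ≡ true
        matched-edge : ∀ {e} → matched e ≡ true → edge e ≡ true
        independent  : ∀ {e f} → matched e ≡ true → matched f ≡ true → κ e f ≡ true → ⊥
        free         : ∀ {e f} → alive e ≡ true → matched f ≡ true → κ e f ≡ true → ⊥
        covered      : ∀ e → edge e ≡ true → alive e ≡ true ⊎ matched e ≡ true ⊎ ∃ λ f → κ e f ≡ true × matched f ≡ true

    module Phase (alive matched : I → Bool) (inv : Invariant alive matched) where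
      open Invariant inv

      a w x : I → ℕ
      a e = nb e λ f → 𝟙 (alive f) ⊓ cap
      w e = suc (a e)
      x e = startVal (alive e) (a e)

      a≡ : ∀ e → a e ≡ nb e λ f → 𝟙 (alive f)
      a≡ e = nb-cap e λ f → ≤-trans (𝟙≤1 (alive f)) cap>0

      w≤ : ∀ e → 16 * w e ≤ P
      w≤ e = ≤-trans (*-monoʳ-≤ 16 (s≤s (≤-trans (≤-reflexive (a≡ e)) (nb-mono e λ f → 𝟙≤1 (alive f))))) (degree≤ e)

      started : ∀ e → alive e ≡ true → 8 * (w e * x e) ≤ P × P ≤ 16 * (w e * x e) × ∃ λ j → x e ≡ 2 ^ j × j ≤ L
      started e al rewrite al = initVal-spec P L (w e) (≤-trans (*-monoˡ-≤ (w e) (m≤m+n 8 8)) (w≤ e))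
        (≤-trans (≤-trans (m≤n*m P 2) (m≤n*m (2 ^ suc L) (8 * w e))) (≤-reflexive (*-assoc 8 (w e) (2 ^ suc L))))

      dead : ∀ e → alive e ≡ false → x e ≡ 0
      dead e al rewrite al = refl

      module V = LevelsSpec items κ κ-sym cap cap≥ cap≥′ cap≥″ y≤ J≤ L≤ b w b-proper b-bound

      x′ : I → ℕ
      x′ = V.leveled L 0 x

      dyadic : ∀ e → Dyadic 0 (x e)
      dyadic e with alive e in al
      ... | false = inj₁ refl
      ... | true with started e al
      ...   | started-e rewrite al with started-e
      ...     | _ , _ , j , x≡ , j≤ = inj₂ (j , x≡ , z≤n , j≤)

      final : ∀ e → x′ e ≡ P * 𝟙 (0 <ᵇ x′ e)
      final e with V.levels-dyadic L 0 x (+-identityʳ L) dyadic e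
      ... | inj₁ p rewrite p = sym (*-zeroʳ P)
      ... | inj₂ p rewrite p = trans (sym (*-identityʳ P)) (cong (λ t → P * 𝟙 t) (sym pos))
        where
        pos : (0 <ᵇ P) ≡ true
        pos = 0<⇒<ᵇ (m^n>0 2 L)

      S C : I → Bool
      S e = 0 <ᵇ x′ e
      m q : I → ℕ
      m e = nb e λ f → 𝟙 (S f) ⊓ cap
      C e = chosen? (x′ e) (m e)
      q e = nb e λ f → 𝟙 (C f) ⊓ cap
      alive′ matched′ : I → Bool
      alive′ e = alive e ∧ (not (C e) ∧ (q e ≡ᵇ 0))
      matched′ e = matched e ∨ C e

      m≡ : ∀ e → m e ≡ nb e λ f → 𝟙 (S f)
      m≡ e = nb-cap e λ f → ≤-trans (𝟙≤1 (S f)) cap>0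
      q≡ : ∀ e → q e ≡ nb e λ f → 𝟙 (C f)
      q≡ e = nb-cap e λ f → ≤-trans (𝟙≤1 (C f)) cap>0

      -- The neighbours of e lie in two cliques of value at most P / 8 each. The constant 8 of
      -- `initVal` is chosen so that the resulting 1 / 4 yields `2 * V.C x ≤ P * V.U x`.
      nb-x≤ : ∀ e → 4 * nb e x ≤ P
      nb-x≤ e = *-cancelˡ-≤ 2 (begin
        2 * (4 * nb e x)                                   ≡⟨ sym (*-assoc 2 4 (nb e x)) ⟩
        8 * nb e x                                         ≤⟨ *-monoʳ-≤ 8 (nb≤keySums e x) ⟩
        8 * (Row.keySum e x + Col.keySum e x)              ≡⟨ *-distribˡ-+ 8 (Row.keySum e x) _ ⟩
        8 * Row.keySum e x + 8 * Col.keySum e x            ≤⟨ +-mono-≤ (Row.keySum-value alive alive-edge x P small dead e) (Col.keySum-value alive alive-edge x P small dead e) ⟩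
        P + P                                              ≡⟨ cong (P +_) (sym (+-identityʳ P)) ⟩
        2 * P                                              ∎)
        where
        open ≤-Reasoning
        small : ∀ e → alive e ≡ true → 8 * (suc (nb e λ f → 𝟙 (alive f)) * x e) ≤ P
        small e al = subst (λ t → 8 * (suc t * x e) ≤ P) (a≡ e) (proj₁ (started e al))

      both-ends : ∀ (v : I → ℕ) → pairSum (λ e f → (w e + w f) * (v e * v f)) ≡ 2 * ∑ items (λ e → w e * v e * nb e v)
      both-ends v = begin-equality
        pairSum (λ e f → (w e + w f) * (v e * v f))                                     ≡⟨ pairSum-cong (λ e f → e₁ (w e) (w f) (v e) (v f)) ⟩
        pairSum (λ e f → w e * v e * v f + w f * v f * v e)                             ≡⟨ pairSum-+ _ _ ⟩
        pairSum (λ e f → w e * v e * v f) + pairSum (λ e f → w f * v f * v e)           ≡⟨ cong (pairSum (λ e f → w e * v e * v f) +_) (sym (pairSum-swap κ-sym _)) ⟩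
        pairSum (λ e f → w e * v e * v f) + pairSum (λ e f → w e * v e * v f)           ≡⟨ cong (λ t → t + t) (∑-cong items λ e → nb-* e (w e * v e) v) ⟩
        W + W                                                                           ≡⟨ cong (W +_) (sym (+-identityʳ W)) ⟩
        2 * W                                                                           ∎
        where
        open ≤-Reasoning
        W = ∑ items (λ e → w e * v e * nb e v)
        e₁ : ∀ a b c d → (a + b) * (c * d) ≡ a * c * d + b * d * c
        e₁ = solve-∀

      initial-cost : 2 * V.C x ≤ P * V.U x
      initial-cost = begin
        2 * V.C x                                          ≤⟨ *-monoʳ-≤ 2 (≤-trans (pairSum-mono λ e f → m⊓n≤m _ M) (≤-reflexive (both-ends x))) ⟩
        2 * (2 * ∑ items (λ e → w e * x e * nb e x))       ≡⟨ sym (*-assoc 2 2 (∑ items (λ e → w e * x e * nb e x))) ⟩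
        4 * ∑ items (λ e → w e * x e * nb e x)             ≡⟨ sym (∑-* 4 items _) ⟩
        ∑ items (λ e → 4 * (w e * x e * nb e x))           ≤⟨ ∑-mono items (λ e → ≤-trans (≤-reflexive (e₁ (w e * x e) (nb e x))) (*-monoˡ-≤ (w e * x e) (nb-x≤ e))) ⟩
        ∑ items (λ e → P * (w e * x e))                    ≡⟨ ∑-* P items _ ⟩
        P * V.U x                                          ∎
        where
        open ≤-Reasoning
        e₁ : ∀ a b → 4 * (a * b) ≡ 4 * b * a
        e₁ = solve-∀

      initial-value : P * size alive ≤ 16 * V.U x
      initial-value = subst₂ _≤_ (∑-* P items _) (∑-* 16 items _) (∑-mono items pointwise)
        where
        pointwise : ∀ e → P * 𝟙 (alive e) ≤ 16 * (w e * x e)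
        pointwise e with alive e in al
        ... | false = ≤-trans (≤-reflexive (*-zeroʳ P)) z≤n
        ... | true with started e al
        ...   | started-e rewrite al = ≤-trans (≤-reflexive (*-identityʳ P)) (proj₁ (proj₂ started-e))

      𝟙S : I → ℕ
      𝟙S e = 𝟙 (S e)

      final-value : V.U x′ ≡ P * ∑ items (λ e → w e * 𝟙S e)
      final-value = trans (∑-cong items λ e → trans (cong (w e *_) (final e)) (comm (w e) P (𝟙S e))) (∑-* P items _)
        where
        comm : ∀ a b c → a * (b * c) ≡ b * (a * c)
        comm = solve-∀

      final-cost : V.C x′ ≡ P * P * (2 * ∑ items (λ e → w e * 𝟙S e * nb e 𝟙S))
      final-cost = trans (pairSum-cong pointwise) (trans (pairSum-* (P * P) _) (cong (P * P *_) (both-ends 𝟙S)))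
        where
        comm : ∀ w p a b → w * (p * a * (p * b)) ≡ p * p * (w * (a * b))
        comm = solve-∀
        w+w≤ : ∀ e f → w e + w f ≤ P
        w+w≤ e f = *-cancelˡ-≤ 2 (begin
          2 * (w e + w f)         ≡⟨ *-distribˡ-+ 2 (w e) (w f) ⟩
          2 * w e + 2 * w f       ≤⟨ +-mono-≤ (≤-trans (*-monoˡ-≤ (w e) (m≤m+n 2 14)) (w≤ e)) (≤-trans (*-monoˡ-≤ (w f) (m≤m+n 2 14)) (w≤ f)) ⟩
          P + P                   ≡⟨ cong (P +_) (sym (+-identityʳ P)) ⟩
          2 * P                   ∎)
          where open ≤-Reasoning
        pointwise : ∀ e f → weight (V.edgeData x′ e) (V.edgeData x′ f) ≡ P * P * ((w e + w f) * (𝟙S e * 𝟙S f))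
        -- Here the truncation must not bind, for an understated final cost would not rule out
        -- adjacent edges of value 1.
        pointwise e f = trans (m≤n⇒m⊓n≡m (*-mono-≤ (w+w≤ e f) (*-mono-≤ (x′≤ e) (x′≤ f))))
          (trans (cong₂ (λ s t → (w e + w f) * (s * t)) (final e) (final f)) (comm (w e + w f) P (𝟙S e) (𝟙S f)))
          where
          x′≤ : ∀ e → x′ e ≤ P
          x′≤ e = ≤-trans (≤-reflexive (final e)) (≤-trans (*-monoʳ-≤ P (𝟙≤1 (S e))) (≤-reflexive (*-identityʳ P)))

      -- P U(x) ≤ 2 P U(x′) − C(x′), by telescoping the level costs.
      value-kept : V.C x′ + P * V.U x ≤ 2 * P * V.U x′
      value-kept = *-cancelˡ-≤ L {{>-nonZero L>0}} (+-cancelʳ-≤ (L * (2 * V.C x)) _ _ (begin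
        L * (V.C x′ + P * V.U x) + L * (2 * V.C x)          ≤⟨ +-monoʳ-≤ _ (*-monoʳ-≤ L initial-cost) ⟩
        L * (V.C x′ + P * V.U x) + L * (P * V.U x)          ≡⟨ e₁ L (V.C x′) P (V.U x) ⟩
        L * V.C x′ + g * V.U x                              ≤⟨ V.levels-cost L 0 x ≤-refl ⟩
        (L + L) * V.C x + g * V.U x′                        ≡⟨ e₂ L (V.C x) P (V.U x′) ⟩
        L * (2 * P * V.U x′) + L * (2 * V.C x)              ∎))
        where
        open ≤-Reasoning
        e₁ : ∀ l c p u → l * (c + p * u) + l * (p * u) ≡ l * c + 2 * l * p * u
        e₁ = solve-∀
        e₂ : ∀ l c p u → (l + l) * c + 2 * l * p * u ≡ l * (2 * p * u) + l * (2 * c)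
        e₂ = solve-∀

      -- An edge of value 1 contributes w (1 - number of such neighbours) to utility minus half the
      -- cost, so only the isolated ones, `C`, contribute positively. The 32 is the 16 of
      -- `initial-value` times the 2 of `value-kept`.
      chosen-weight : size alive ≤ 32 * ∑ items (λ e → 𝟙 (C e) * w e)
      chosen-weight = +-cancelʳ-≤ (32 * Q) _ _ (*-cancelˡ-≤ (P * P) {{m*n≢0 P P {{m^n≢0 2 L}} {{m^n≢0 2 L}}}} (begin
        P * P * (size alive + 32 * Q)                       ≡⟨ e₁ P (size alive) Q ⟩
        P * (P * size alive) + 16 * (P * P * (2 * Q))       ≤⟨ +-mono-≤ (*-monoʳ-≤ P initial-value) (≤-reflexive (cong (16 *_) (sym final-cost))) ⟩
        P * (16 * V.U x) + 16 * V.C x′                      ≡⟨ e₂ P (V.U x) (V.C x′) ⟩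
        16 * (V.C x′ + P * V.U x)                           ≤⟨ *-monoʳ-≤ 16 value-kept ⟩
        16 * (2 * P * V.U x′)                               ≡⟨ cong (λ u → 16 * (2 * P * u)) final-value ⟩
        16 * (2 * P * (P * ∑ items (λ e → w e * 𝟙S e)))     ≡⟨ e₃ P _ ⟩
        P * P * (32 * ∑ items (λ e → w e * 𝟙S e))           ≤⟨ *-monoʳ-≤ (P * P) (*-monoʳ-≤ 32 (≤-trans (∑-mono items pointwise) (≤-reflexive (∑-+ items _ _)))) ⟩
        P * P * (32 * (∑ items (λ e → 𝟙 (C e) * w e) + Q))  ≡⟨ cong (P * P *_) (*-distribˡ-+ 32 (∑ items (λ e → 𝟙 (C e) * w e)) Q) ⟩
        P * P * (32 * ∑ items (λ e → 𝟙 (C e) * w e) + 32 * Q) ∎))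
        where
        open ≤-Reasoning
        Q = ∑ items (λ e → w e * 𝟙S e * nb e 𝟙S)
        e₁ : ∀ p a q → p * p * (a + 32 * q) ≡ p * (p * a) + 16 * (p * p * (2 * q))
        e₁ = solve-∀
        e₂ : ∀ p u c → p * (16 * u) + 16 * c ≡ 16 * (c + p * u)
        e₂ = solve-∀
        e₃ : ∀ p a → 16 * (2 * p * (p * a)) ≡ p * p * (32 * a)
        e₃ = solve-∀
        pointwise : ∀ e → w e * 𝟙S e ≤ 𝟙 (C e) * w e + w e * 𝟙S e * nb e 𝟙S
        pointwise e rewrite sym (m≡ e) with 0 <ᵇ x′ e | m e
        ... | false | _     = ≤-trans (≤-reflexive (*-zeroʳ (w e))) z≤n
        ... | true  | zero  = ≤-trans (≤-reflexive (*-comm (w e) 1)) (m≤m+n _ _)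
        ... | true  | suc k = m≤m*n (w e * 1) (suc k)

      C⇒S : ∀ {e} → C e ≡ true → S e ≡ true × m e ≡ 0
      C⇒S {e} p with 0 <ᵇ x′ e | m e ≡ᵇ 0 in eq | p
      ... | true | true | _ = refl , ≡ᵇ-true⇒≡ _ _ eq

      S⇒alive : ∀ {e} → S e ≡ true → alive e ≡ true
      S⇒alive {e} p with alive e in al
      ... | true  = refl
      ... | false with trans (sym p) (cong (0 <ᵇ_) (V.levels-zero L 0 x ≤-refl e (dead e al)))
      ...   | ()

      C⇒alive : ∀ {e} → C e ≡ true → alive e ≡ true
      C⇒alive p = S⇒alive (proj₁ (C⇒S p))

      C-independent : ∀ {e f} → C e ≡ true → C f ≡ true → κ e f ≡ true → ⊥
      C-independent {e} {f} p q k = <⇒≢ (nb-positive S e f k (proj₁ (C⇒S q))) (sym (trans (sym (m≡ e)) (proj₂ (C⇒S p))))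

      alive′-spec : ∀ e → alive′ e ≡ true → alive e ≡ true × C e ≡ false × nb e (λ f → 𝟙 (C f)) ≡ 0
      alive′-spec e p with alive e | C e | q e ≡ᵇ 0 in eq | p
      ... | true | false | true | _ = refl , refl , trans (sym (q≡ e)) (≡ᵇ-true⇒≡ _ _ eq)

      matched′-spec : ∀ e → matched′ e ≡ true → matched e ≡ true ⊎ C e ≡ true
      matched′-spec e p with matched e
      ... | true  = inj₁ refl
      ... | false = inj₂ p

      matched⇒matched′ : ∀ {e} → matched e ≡ true → matched′ e ≡ true
      matched⇒matched′ p rewrite p = refl

      C⇒matched′ : ∀ {e} → C e ≡ true → matched′ e ≡ true
      C⇒matched′ {e} p with matched e
      ... | true  = refl
      ... | false = p

      -- The weights over `C` amount to at least a 1 / 32 share of the survivors, and `removal`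
      -- counts every departing edge at most twice, so at least a 1 / 64 share departs.
      shrinks : size alive + 64 * size alive′ ≤ 64 * size alive
      shrinks = begin
        size alive + 64 * size alive′                                            ≤⟨ +-monoˡ-≤ _ chosen-weight ⟩
        32 * ∑ items (λ e → 𝟙 (C e) * w e) + 64 * size alive′                    ≡⟨ e₁ (∑ items λ e → 𝟙 (C e) * w e) (size alive′) ⟩
        32 * (∑ items (λ e → 𝟙 (C e) * w e) + 2 * size alive′)                   ≡⟨ cong (λ t → 32 * (t + 2 * size alive′)) (∑-cong items λ e → cong (λ t → 𝟙 (C e) * suc t) (a≡ e)) ⟩
        32 * (∑ items (λ e → 𝟙 (C e) * suc (nb e λ f → 𝟙 (alive f))) + 2 * size alive′)
          ≤⟨ *-monoʳ-≤ 32 (removal alive C alive′ alive-edge C⇒alive C-independent alive′-spec) ⟩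
        32 * (2 * size alive)                                                    ≡⟨ sym (*-assoc 32 2 (size alive)) ⟩
        64 * size alive                                                          ∎
        where
        open ≤-Reasoning
        e₁ : ∀ a b → 32 * a + 64 * b ≡ 32 * (a + 2 * b)
        e₁ = solve-∀

      κ-flip : ∀ {e f} → κ e f ≡ true → κ f e ≡ true
      κ-flip {e} {f} k = trans (κ-sym f e) k

      invariant : Invariant alive′ matched′
      invariant = record
        { alive-edge   = λ p → alive-edge (proj₁ (alive′-spec _ p))
        ; matched-edge = λ p → edge-of (matched′-spec _ p)
        ; independent  = λ p q k → indep k (matched′-spec _ p) (matched′-spec _ q)
        ; free         = λ p q k → free′ k (alive′-spec _ p) (matched′-spec _ q)
        ; covered      = λ e p → cover e (covered e p)
        }
        where
        edge-of : ∀ {e} → matched e ≡ true ⊎ C e ≡ true → edge e ≡ true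
        edge-of (inj₁ p) = matched-edge p
        edge-of (inj₂ p) = alive-edge (C⇒alive p)
        indep : ∀ {e f} → κ e f ≡ true → matched e ≡ true ⊎ C e ≡ true → matched f ≡ true ⊎ C f ≡ true → ⊥
        indep k (inj₁ p) (inj₁ q) = independent p q k
        indep k (inj₁ p) (inj₂ q) = free (C⇒alive q) p (κ-flip k)
        indep k (inj₂ p) (inj₁ q) = free (C⇒alive p) q k
        indep k (inj₂ p) (inj₂ q) = C-independent p q k
        free′ : ∀ {e f} → κ e f ≡ true → alive e ≡ true × C e ≡ false × nb e (λ f → 𝟙 (C f)) ≡ 0 →
                matched f ≡ true ⊎ C f ≡ true → ⊥
        free′ k (p , _ , _) (inj₁ q) = free p q k
        free′ {e} {f} k (_ , _ , z) (inj₂ q) = <⇒≢ (nb-positive C e f k q) (sym z)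
        cover : ∀ e → alive e ≡ true ⊎ matched e ≡ true ⊎ (∃ λ f → κ e f ≡ true × matched f ≡ true) →
                alive′ e ≡ true ⊎ matched′ e ≡ true ⊎ (∃ λ f → κ e f ≡ true × matched′ f ≡ true)
        cover e (inj₂ (inj₁ p)) = inj₂ (inj₁ (matched⇒matched′ p))
        cover e (inj₂ (inj₂ (f , k , p))) = inj₂ (inj₂ (f , k , matched⇒matched′ p))
        cover e (inj₁ p) rewrite p with C e in Ce
        ... | true = inj₂ (inj₁ (∨-true (matched e)))
          where
          ∨-true : ∀ b → (b ∨ true) ≡ true
          ∨-true true  = refl
          ∨-true false = refl
        ... | false with q e ≟ 0
        ...   | yes q≡0 rewrite q≡0 = inj₁ refl
        ...   | no  q≢0 with nb-witness C e (λ z → q≢0 (trans (q≡ e) z))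
        ...     | f , k , Cf = inj₂ (inj₂ (f , k , C⇒matched′ Cf))

      phase≡ : exec phaseDepth (λ e → phase (b e) (alive e , matched e)) ≡ λ e → alive′ e , matched′ e
      phase≡ = exec-bind (L * levelDepth) _ _

    phased : ∀ n → (I → Bool × Bool) → I → Bool × Bool
    phased n st = exec (n * phaseDepth) λ e → phases n (b e) (st e)

    Inv : (I → Bool × Bool) → Set
    Inv st = Invariant (λ e → proj₁ (st e)) (λ e → proj₂ (st e))

    remaining : (I → Bool × Bool) → ℕ
    remaining st = size λ e → proj₁ (st e)

    next : ∀ st → Inv st → I → Bool × Bool
    next st inv e = Phase.alive′ _ _ inv e , Phase.matched′ _ _ inv e

    phased-suc : ∀ n st inv → phased (suc n) st ≡ phased n (next st inv)
    phased-suc n st inv = trans (exec-bind phaseDepth (λ e → phase (b e) (st e)) λ e → phases n (b e))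
      (cong (λ st → exec (n * phaseDepth) λ e → phases n (b e) (st e)) (Phase.phase≡ _ _ inv))

    phased-inv : ∀ n st → Inv st → Inv (phased n st)
    phased-inv zero    st inv = inv
    phased-inv (suc n) st inv rewrite phased-suc n st inv = phased-inv n _ (Phase.invariant _ _ inv)

    -- Each phase removes at least 1 / 64 of its survivors, who are at least as many as the final r.
    -- This linear count avoids powers of 63 / 64, and n = 64 already halves.
    phased-shrinks : ∀ n st → Inv st → n * remaining (phased n st) + 64 * remaining (phased n st) ≤ 64 * remaining st
    phased-shrinks zero    st inv = ≤-refl
    phased-shrinks (suc n) st inv rewrite phased-suc n st inv = begin
      r + n * r + 64 * r                    ≡⟨ +-assoc r (n * r) (64 * r) ⟩
      r + (n * r + 64 * r)                  ≤⟨ +-mono-≤ r≤ IH ⟩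
      remaining st + 64 * remaining st₁     ≤⟨ Phase.shrinks _ _ inv ⟩
      64 * remaining st                     ∎
      where
      open ≤-Reasoning
      st₁ = next st inv
      r = remaining (phased n st₁)
      IH = phased-shrinks n st₁ (Phase.invariant _ _ inv)
      r≤ : r ≤ remaining st
      r≤ = *-cancelˡ-≤ 64 (≤-trans (m≤n+m (64 * r) (n * r)) (≤-trans IH
             (≤-trans (m≤n+m (64 * remaining st₁) (remaining st)) (Phase.shrinks _ _ inv))))

    phased-+ : ∀ m n st → Inv st → phased (m + n) st ≡ phased n (phased m st)
    phased-+ zero    n st inv = refl
    phased-+ (suc m) n st inv = trans (phased-suc (m + n) st inv)
      (trans (phased-+ m n _ (Phase.invariant _ _ inv)) (cong (phased n) (sym (phased-suc m st inv))))

    phased-halves : ∀ q → 64 ≤ q → ∀ t st → Inv st → 2 ^ t * remaining (phased (t * q) st) ≤ remaining st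
    phased-halves q q≥ zero    st inv = ≤-reflexive (*-identityˡ _)
    phased-halves q q≥ (suc t) st inv rewrite phased-+ q (t * q) st inv = *-cancelˡ-≤ 64 (begin
      64 * (2 ^ suc t * r)               ≡⟨ e₁ (2 ^ t) r ⟩
      (64 + 64) * (2 ^ t * r)            ≤⟨ *-mono-≤ (+-monoˡ-≤ 64 q≥) (phased-halves q q≥ t st₁ (phased-inv q st inv)) ⟩
      (q + 64) * remaining st₁           ≡⟨ *-distribʳ-+ (remaining st₁) q 64 ⟩
      q * remaining st₁ + 64 * remaining st₁ ≤⟨ phased-shrinks q st inv ⟩
      64 * remaining st                  ∎)
      where
      open ≤-Reasoning
      st₁ = phased q st
      r = remaining (phased (t * q) st₁)
      e₁ : ∀ p r → 64 * (2 * p * r) ≡ 128 * (p * r)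
      e₁ = solve-∀

-- Networks

encode : ∀ l → ℕ → Vec Bool l
encode zero    m = []
encode (suc l) m = (m % 2 ≡ᵇ 1) ∷ encode l (m / 2)

decode : ∀ {l} → Vec Bool l → ℕ
decode []      = 0
decode (b ∷ v) = 𝟙 b + decode v * 2

decode-encode : ∀ l m → m < 2 ^ l → decode (encode l m) ≡ m
decode-encode zero    zero m< = refl
decode-encode zero    (suc m) (s≤s ())
decode-encode (suc l) m m< = trans (cong₂ (λ a b → a + b * 2) (bit (m % 2) (m%n<n m 2)) (decode-encode l (m / 2) m/2<))
                               (sym (m≡m%n+[m/n]*n m 2))
  where
  bit : ∀ r → r < 2 → 𝟙 (r ≡ᵇ 1) ≡ r
  bit zero          _ = refl
  bit (suc zero)    _ = refl
  bit (suc (suc r)) (s≤s (s≤s ()))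
  m/2< : m / 2 < 2 ^ l
  m/2< = m<n*o⇒m/o<n (subst (m <_) (*-comm 2 (2 ^ l)) m<)

∑-delta-downFrom : ∀ N a → a < N → (g : ℕ → ℕ) → ∑ (downFrom N) (λ i → 𝟙 (a ≡ᵇ i) * g i) ≡ g a
∑-delta-downFrom (suc N) a a< g with a ≟ N
... | yes refl rewrite ≡ᵇ-refl a = trans (cong₂ _+_ (+-identityʳ (g a)) (above a ≤-refl)) (+-identityʳ (g a))
  where
  above : ∀ M → M ≤ a → ∑ (downFrom M) (λ i → 𝟙 (a ≡ᵇ i) * g i) ≡ 0
  above zero    M≤ = refl
  above (suc M) M< rewrite ≢⇒≡ᵇ-false a M (λ p → <⇒≢ M< (sym p)) = above M (<⇒≤ M<)
... | no a≢N rewrite ≢⇒≡ᵇ-false a N a≢N = ∑-delta-downFrom N a (≤∧≢⇒< (s≤s⁻¹ a<) a≢N) g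

∑-tabulate : ∀ {A : Set} {n} (f : Fin n → A) (g : A → ℕ) → ∑ (tabulate f) g ≡ ∑ (allFin n) (g ∘ f)
∑-tabulate f g = cong sum (trans (map-tabulate f g) (sym (map-tabulate id (g ∘ f))))

∑-delta-Fin : ∀ {n} (u : Fin n) (g : Fin n → ℕ) → ∑ (allFin n) (λ w → 𝟙 (does (u Fin.≟ w)) * g w) ≡ g u
∑-delta-Fin {suc n} fzero    g = trans (cong₂ _+_ (+-identityʳ (g fzero)) (trans (∑-tabulate {n = n} fsuc _) (∑-zero (allFin n)))) (+-identityʳ (g fzero))
∑-delta-Fin {suc n} (fsuc u) g = trans (∑-tabulate {n = n} fsuc _) (∑-delta-Fin u (g ∘ fsuc))

∑-const : ∀ {A : Set} (xs : List A) c → ∑ xs (λ _ → c) ≡ length xs * c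
∑-const []       c = refl
∑-const (x ∷ xs) c = cong (c +_) (∑-const xs c)

∑-++ : ∀ {A : Set} (xs ys : List A) (f : A → ℕ) → ∑ (xs ++ ys) f ≡ ∑ xs f + ∑ ys f
∑-++ xs ys f = trans (cong sum (map-++ f xs ys)) (sum-++ (map f xs) (map f ys))

∑-map : ∀ {A B : Set} (h : A → B) (xs : List A) (f : B → ℕ) → ∑ (map h xs) f ≡ ∑ xs (f ∘ h)
∑-map h []       f = refl
∑-map h (x ∷ xs) f = cong (f (h x) +_) (∑-map h xs f)

∑-cartesianProduct : ∀ {A B : Set} (xs : List A) (ys : List B) (f : A × B → ℕ) →
                     ∑ (cartesianProduct xs ys) f ≡ ∑ xs λ x → ∑ ys λ y → f (x , y)
∑-cartesianProduct []       ys f = refl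
∑-cartesianProduct (x ∷ xs) ys f = trans (∑-++ (map (x ,_) ys) _ f)
  (cong₂ _+_ (∑-map (x ,_) ys f) (∑-cartesianProduct xs ys f))

any-false : ∀ {A : Set} (p : A → Bool) xs → any p xs ≡ false → ∑ xs (𝟙 ∘ p) ≡ 0
any-false p []       _ = refl
any-false p (x ∷ xs) q with p x | q
... | false | q = any-false p xs q

any-true : ∀ {A : Set} (p : A → Bool) xs → any p xs ≡ true → ∃ λ x → p x ≡ true
any-true p (x ∷ xs) q with p x in eq | q
... | true  | _ = x , eq
... | false | q = any-true p xs q

-- The inbox of `Execution` has this form: a search by identifier, unambiguous since identifiers are
-- unique.
foldr-select : ∀ {A B : Set} (p : A → Bool) (F : A → B) (b : B) u xs → u ∈ xs → p u ≡ true →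
               (∀ x → p x ≡ true → x ≡ u) → foldr (λ x rest → if p x then F x else rest) b xs ≡ F u
foldr-select p F b u (x ∷ xs) (here refl) pu only rewrite pu = refl
foldr-select p F b u (x ∷ xs) (there u∈) pu only with p x in eq
... | true  = cong F (only x eq)
... | false = foldr-select p F b u xs u∈ pu only

∧-true : ∀ {a b} → a ∧ b ≡ true → a ≡ true × b ≡ true
∧-true {true} {true} _ = refl , refl

𝟙-∧ : ∀ a b → 𝟙 (a ∧ b) ≡ 𝟙 a * 𝟙 b
𝟙-∧ true  b = sym (+-identityʳ (𝟙 b))
𝟙-∧ false b = refl

module Network {n : ℕ} (G : Graph n) where

  -- Ordered pairs: an edge of G occurs twice, as the two copies in the bipartite double cover.  There
  -- (v , u) meets exactly the (v , w) and the (w , u), one for each edge of G adjacent to it.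
  items : List (Fin n × Fin n)
  items = cartesianProduct (allFin n) (allFin n)

  κ : Fin n × Fin n → Fin n × Fin n → Bool
  κ (u , v) (x , y) = adj G u v ∧ (adj G x y ∧ (does (u Fin.≟ x) xor does (v Fin.≟ y)))

  rowSum : Fin n → Fin n → (Fin n × Fin n → ℕ) → ℕ
  rowSum v u g = ∑ (allFin n) λ w → 𝟙 (adj G v w ∧ not (does (u Fin.≟ w))) * g (v , w)

  colSum : Fin n → Fin n → (Fin n × Fin n → ℕ) → ℕ
  colSum v u g = ∑ (allFin n) λ w → 𝟙 (adj G w u ∧ not (does (v Fin.≟ w))) * g (w , u)

  -- By the `xor` exactly one coordinate agrees. The row part consists of edges at v and the column
  -- part of edges at u, so each endpoint can sum one part locally.
  nb-split : ∀ cap v u g → adj G v u ≡ true → Semantics.nb items κ cap (v , u) g ≡ rowSum v u g + colSum v u g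
  nb-split cap v u g vu = begin
    ∑ items (λ f → 𝟙 (κ (v , u) f) * g f)                                    ≡⟨ ∑-cartesianProduct (allFin n) (allFin n) _ ⟩
    ∑ (allFin n) (λ x → ∑ (allFin n) λ y → 𝟙 (κ (v , u) (x , y)) * g (x , y)) ≡⟨ ∑-cong (allFin n) (λ x → trans (∑-cong (allFin n) (pointwise x)) (trans (∑-+ (allFin n) _ _) (cong₂ _+_ (∑-* (𝟙 (does (v Fin.≟ x))) (allFin n) _) (∑-delta-Fin u _)))) ⟩
    ∑ (allFin n) (λ x → 𝟙 (does (v Fin.≟ x)) * ∑ (allFin n) (λ y → 𝟙 (adj G x y ∧ not (does (u Fin.≟ y))) * g (x , y))
                        + 𝟙 (adj G x u ∧ not (does (v Fin.≟ x))) * g (x , u)) ≡⟨ ∑-+ (allFin n) _ _ ⟩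
    ∑ (allFin n) (λ x → 𝟙 (does (v Fin.≟ x)) * ∑ (allFin n) (λ y → 𝟙 (adj G x y ∧ not (does (u Fin.≟ y))) * g (x , y))) + colSum v u g ≡⟨ cong (_+ colSum v u g) (∑-delta-Fin v _) ⟩
    rowSum v u g + colSum v u g ∎
    where
    open ≡-Reasoning
    pointwise : ∀ x y → 𝟙 (κ (v , u) (x , y)) * g (x , y)
                      ≡ 𝟙 (does (v Fin.≟ x)) * (𝟙 (adj G x y ∧ not (does (u Fin.≟ y))) * g (x , y))
                        + 𝟙 (does (u Fin.≟ y)) * (𝟙 (adj G x y ∧ not (does (v Fin.≟ x))) * g (x , y))
    pointwise x y rewrite vu with adj G x y | does (v Fin.≟ x) | does (u Fin.≟ y)
    ... | false | true  | true  = refl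
    ... | false | true  | false = refl
    ... | false | false | true  = refl
    ... | false | false | false = refl
    ... | true  | true  | true  = refl
    ... | true  | true  | false = sym (trans (+-identityʳ _) (*-identityˡ _))
    ... | true  | false | true  = sym (*-identityˡ _)
    ... | true  | false | false = refl

  lineGraph : LineGraph items κ
  lineGraph = record
    { edge       = λ (u , v) → adj G u v
    ; row        = λ (u , v) → toℕ u
    ; col        = λ (u , v) → toℕ v
    ; _≟ᴵ_       = _≟ᴵ_
    ; count      = count
    ; κ-sym      = κ-sym
    ; κ-key      = λ {e} {f} → κ-key e f
    ; row-κ      = λ {e} {f} → row-κ e f
    ; col-κ      = λ {e} {f} → col-κ e f
    }
    where
    _≟ᴵ_ : (e f : Fin n × Fin n) → Dec (e ≡ f)
    (u , v) ≟ᴵ (x , y) = map′ (λ (p , q) → cong₂ _,_ p q) (λ p → cong proj₁ p , cong proj₂ p) ((u Fin.≟ x) ×-dec (v Fin.≟ y))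
    count : ∀ e (g : Fin n × Fin n → ℕ) → ∑ items (λ f → 𝟙 (does (e ≟ᴵ f)) * g f) ≡ g e
    count (u , v) g = trans (∑-cartesianProduct (allFin n) (allFin n) _) (trans
      (∑-cong (allFin n) λ x → trans (∑-cong (allFin n) λ y →
          trans (cong (_* g (x , y)) (𝟙-∧ (does (u Fin.≟ x)) _)) (*-assoc (𝟙 (does (u Fin.≟ x))) _ _))
        (trans (∑-* (𝟙 (does (u Fin.≟ x))) (allFin n) _) (cong (𝟙 (does (u Fin.≟ x)) *_) (∑-delta-Fin v λ y → g (x , y)))))
      (∑-delta-Fin u λ x → g (x , v)))
    ≟-sym : ∀ (a b : Fin n) → does (a Fin.≟ b) ≡ does (b Fin.≟ a)
    ≟-sym a b with a Fin.≟ b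
    ... | yes refl = sym (dec-true (a Fin.≟ a) refl)
    ... | no a≢b = sym (dec-false (b Fin.≟ a) λ p → a≢b (sym p))
    κ-sym : ∀ e f → κ e f ≡ κ f e
    κ-sym (u , v) (x , y) rewrite ≟-sym u x | ≟-sym v y with adj G u v | adj G x y
    ... | true  | true  = refl
    ... | true  | false = refl
    ... | false | true  = refl
    ... | false | false = refl
    κ-key : ∀ e f → κ e f ≡ true → toℕ (proj₁ e) ≡ toℕ (proj₁ f) ⊎ toℕ (proj₂ e) ≡ toℕ (proj₂ f)
    κ-key (u , v) (x , y) k with proj₂ (∧-true {adj G x y} (proj₂ (∧-true {adj G u v} k)))
    ... | k′ with u Fin.≟ x | v Fin.≟ y | k′
    ...   | yes p | _     | _ = inj₁ (cong toℕ p)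
    ...   | no _  | yes q | _ = inj₂ (cong toℕ q)
    row-κ : ∀ e f → adj G (proj₁ e) (proj₂ e) ≡ true → adj G (proj₁ f) (proj₂ f) ≡ true →
            toℕ (proj₁ e) ≡ toℕ (proj₁ f) → e ≢ f → κ e f ≡ true
    row-κ (u , v) (x , y) uv xy r e≢f rewrite uv | xy | dec-true (u Fin.≟ x) (Fin.toℕ-injective r)
      | dec-false (v Fin.≟ y) (λ p → e≢f (cong₂ _,_ (Fin.toℕ-injective r) p)) = refl
    col-κ : ∀ e f → adj G (proj₁ e) (proj₂ e) ≡ true → adj G (proj₁ f) (proj₂ f) ≡ true →
            toℕ (proj₂ e) ≡ toℕ (proj₂ f) → e ≢ f → κ e f ≡ true
    col-κ (u , v) (x , y) uv xy r e≢f rewrite uv | xy | dec-true (v Fin.≟ y) (Fin.toℕ-injective r)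
      | dec-false (u Fin.≟ x) (λ p → e≢f (cong₂ _,_ p (Fin.toℕ-injective r))) = refl

-- A node runs the programs of all its incident edges, and tells each neighbour its part of the sum
-- over the edges adjacent to their common edge.
module Simulation (B k : ℕ) (depth cap : ℕ → ℕ → ℕ) (program : ∀ n Δ → ℕ → Bool → EProg (depth n Δ) Bool) where

  NodeState : ℕ → ℕ → Set
  NodeState n Δ = Σ ℕ λ d → (ℕ × (ℕ → Bool)) × (ℕ → EProg d Bool)

  -- The neighbourhood is known only as a membership test, so the sum runs over all possible
  -- identifiers below n^k; local computation is free.
  localSum : ∀ n Δ {d} → (ℕ → Bool) → (ℕ → EProg (suc d) Bool) → ℕ → ℕ
  localSum n Δ nbr π j = ∑ (downFrom (n ^ k)) λ i →
    𝟙 (nbr i ∧ not (j ≡ᵇ i)) * (proj₁ (proj₂ (π j)) (proj₁ (π i)) ⊓ cap n Δ)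

  received : ∀ {l} → Maybe (Vec Bool l) → ℕ
  received nothing  = 0
  received (just v) = decode v

  sendState : ∀ {n Δ} → NodeState n Δ → ℕ → Maybe (Vec Bool (msgLen B n))
  sendState         (zero  , _           , π) j = nothing
  sendState {n} {Δ} (suc d , (me , nbr) , π) j = just (encode (msgLen B n) (localSum n Δ nbr π j))

  recvState : ∀ {n Δ} → NodeState n Δ → (ℕ → Maybe (Vec Bool (msgLen B n))) → NodeState n Δ
  recvState         (zero  , q           , π) inbox = zero , q , π
  recvState {n} {Δ} (suc d , (me , nbr) , π) inbox =
    d , (me , nbr) , λ j → proj₂ (proj₂ (π j)) (localSum n Δ nbr π j + received (inbox j))

  output : ∀ {n Δ} → NodeState n Δ → ℕ → Bool
  output (zero  , _ , π) j = π j
  output (suc _ , _ , π) j = false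

  alg : CongestAlg
  alg = record
    { bandwidth = B
    ; State     = NodeState
    ; rounds    = depth
    ; init      = λ n Δ me nbr → depth n Δ , (me , nbr) , λ j → program n Δ (me + j) true
    ; send      = λ {n} {Δ} → sendState {n} {Δ}
    ; recv      = λ {n} {Δ} → recvState {n} {Δ}
    ; out       = λ {n} {Δ} → output {n} {Δ}
    }

  module Run {n : ℕ} (Δ : ℕ) (G : Graph n) (id : Fin n → ℕ) (id-injective : ∀ u v → id u ≡ id v → u ≡ v)
             (id< : ∀ v → id v < n ^ k) (fits : n * cap n Δ < 2 ^ msgLen B n) where
    open Execution alg Δ G id
    open Network G
    open Semantics items κ (cap n Δ)

    round : (Fin n → NodeState n Δ) → Fin n → NodeState n Δ
    round st v = recvState {n} {Δ} (st v) λ j → foldr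
      (λ u rest → if adj G v u ∧ (id u ≡ᵇ j) then sendState {n} {Δ} (st u) (id v) else rest) nothing (allFin n)

    iterate : ℕ → (Fin n → NodeState n Δ) → Fin n → NodeState n Δ
    iterate zero    st = st
    iterate (suc d) st = iterate d (round st)

    iterate-state : ∀ d r → iterate d (state r) ≡ state (d + r)
    iterate-state zero    r = refl
    iterate-state (suc d) r = trans (iterate-state d (suc r)) (cong state (+-suc d r))

    -- At most one neighbour carries the identifier i, so the disjunction is a sum.
    nbr-indicator : ∀ v i → 𝟙 (nbrIds v i) ≡ ∑ (allFin n) λ w → 𝟙 (adj G v w ∧ (id w ≡ᵇ i))
    nbr-indicator v i with nbrIds v i in eq
    ... | false = sym (any-false _ (allFin n) eq)
    ... | true  = sym (trans (∑-cong (allFin n) pointwise) (∑-delta-Fin (proj₁ found) λ _ → 1))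
      where
      found = any-true (λ w → adj G v w ∧ (id w ≡ᵇ i)) (allFin n) eq
      hit = ∧-true {adj G v (proj₁ found)} (proj₂ found)
      pointwise : ∀ w → 𝟙 (adj G v w ∧ (id w ≡ᵇ i)) ≡ 𝟙 (does (proj₁ found Fin.≟ w)) * 1
      pointwise w with proj₁ found Fin.≟ w
      ... | yes refl = cong 𝟙 (proj₂ found)
      ... | no ≢w with adj G v w | id w ≡ᵇ i in idw
      ...   | false | _     = refl
      ...   | true  | false = refl
      ...   | true  | true  = ⊥-elim (≢w (id-injective _ _ (trans (≡ᵇ-true⇒≡ _ _ (proj₂ hit)) (sym (≡ᵇ-true⇒≡ _ _ idw)))))

    ∑-neighbours : ∀ v (h : ℕ → ℕ) → ∑ (downFrom (n ^ k)) (λ i → 𝟙 (nbrIds v i) * h i) ≡ ∑ (allFin n) λ w → 𝟙 (adj G v w) * h (id w)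
    ∑-neighbours v h = begin
      ∑ N (λ i → 𝟙 (nbrIds v i) * h i)                                            ≡⟨ ∑-cong N (λ i → trans (cong (_* h i) (nbr-indicator v i)) (trans (*-comm _ (h i)) (sym (∑-* (h i) (allFin n) _)))) ⟩
      ∑ N (λ i → ∑ (allFin n) λ w → h i * 𝟙 (adj G v w ∧ (id w ≡ᵇ i)))            ≡⟨ ∑-swap N (allFin n) _ ⟩
      ∑ (allFin n) (λ w → ∑ N λ i → h i * 𝟙 (adj G v w ∧ (id w ≡ᵇ i)))            ≡⟨ ∑-cong (allFin n) (λ w → trans (∑-cong N λ i → regroup (adj G v w) (id w ≡ᵇ i) (h i)) (trans (∑-* (𝟙 (adj G v w)) N _) (cong (𝟙 (adj G v w) *_) (∑-delta-downFrom (n ^ k) (id w) (id< w) h)))) ⟩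
      ∑ (allFin n) (λ w → 𝟙 (adj G v w) * h (id w))                              ∎
      where
      open ≡-Reasoning
      N = downFrom (n ^ k)
      regroup : ∀ a b x → x * 𝟙 (a ∧ b) ≡ 𝟙 a * (𝟙 b * x)
      regroup false b x = *-zeroʳ x
      regroup true  b x = trans (*-comm x (𝟙 b)) (sym (*-identityˡ _))

    inbox≡ : ∀ (st : Fin n → NodeState n Δ) v u → adj G v u ≡ true →
      foldr (λ u′ rest → if adj G v u′ ∧ (id u′ ≡ᵇ id u) then sendState {n} {Δ} (st u′) (id v) else rest) nothing (allFin n)
      ≡ sendState {n} {Δ} (st u) (id v)
    inbox≡ st v u vu = foldr-select _ (λ u′ → sendState {n} {Δ} (st u′) (id v)) nothing u (allFin n) (∈-allFin u)
      (cong₂ _∧_ vu (≡ᵇ-refl (id u)))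
      (λ x p → id-injective x u (≡ᵇ-true⇒≡ _ _ (proj₂ (∧-true {adj G v x} p))))

    conf : ∀ d → (Fin n → ℕ → EProg d Bool) → Fin n → NodeState n Δ
    conf d π v = d , (id v , nbrIds v) , π v

    -- Both endpoints run the program of their common edge, and the second equation keeps the two
    -- copies equal. Each endpoint thus knows the query and the payloads of its own edges, and only
    -- partial sums have to be sent.
    Represents : ∀ {d} → (Fin n → ℕ → EProg d Bool) → (Fin n × Fin n → EProg d Bool) → Set
    Represents π p = ∀ v u → adj G v u ≡ true → π v (id u) ≡ p (v , u) × p (v , u) ≡ p (u , v)

    module Round {d} (π : Fin n → ℕ → EProg (suc d) Bool) (p : Fin n × Fin n → EProg (suc d) Bool) (rep : Represents π p) where

      term : Fin n × Fin n → Fin n × Fin n → ℕ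
      term e f = proj₁ (proj₂ (p e)) (proj₁ (p f)) ⊓ cap n Δ

      localSum≡ : ∀ v u → adj G v u ≡ true → localSum n Δ (nbrIds v) (π v) (id u) ≡ rowSum v u (term (v , u))
      localSum≡ v u vu = begin
        localSum n Δ (nbrIds v) (π v) (id u)                       ≡⟨ ∑-cong (downFrom (n ^ k)) (λ i → trans (cong (_* h i) (𝟙-∧ (nbrIds v i) _)) (*-assoc (𝟙 (nbrIds v i)) _ (h i))) ⟩
        ∑ (downFrom (n ^ k)) (λ i → 𝟙 (nbrIds v i) * (𝟙 (not (id u ≡ᵇ i)) * h i)) ≡⟨ ∑-neighbours v _ ⟩
        ∑ (allFin n) (λ w → 𝟙 (adj G v w) * (𝟙 (not (id u ≡ᵇ id w)) * h (id w)))  ≡⟨ ∑-cong (allFin n) pointwise ⟩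
        rowSum v u (term (v , u))                                  ∎
        where
        open ≡-Reasoning
        h : ℕ → ℕ
        h i = proj₁ (proj₂ (π v (id u))) (proj₁ (π v i)) ⊓ cap n Δ
        same-id : ∀ w → (id u ≡ᵇ id w) ≡ does (u Fin.≟ w)
        same-id w with u Fin.≟ w
        ... | yes refl = ≡ᵇ-refl (id u)
        ... | no u≢w = ≢⇒≡ᵇ-false _ _ λ q → u≢w (id-injective u w q)
        pointwise : ∀ w → 𝟙 (adj G v w) * (𝟙 (not (id u ≡ᵇ id w)) * h (id w))
                        ≡ 𝟙 (adj G v w ∧ not (does (u Fin.≟ w))) * term (v , u) (v , w)
        pointwise w rewrite same-id w with adj G v w in vw
        ... | false = refl
        ... | true rewrite proj₁ (rep v u vu) | proj₁ (rep v w vw) = *-identityˡ _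

      rowSum< : ∀ v u → rowSum v u (term (v , u)) < 2 ^ msgLen B n
      rowSum< v u = ≤-<-trans (≤-trans (∑-mono (allFin n) λ w → ≤-trans (𝟙*≤ (adj G v w ∧ not (does (u Fin.≟ w))) _) (m⊓n≤n _ (cap n Δ)))
        (≤-reflexive (trans (∑-const (allFin n) (cap n Δ)) (cong (_* cap n Δ) (length-tabulate {n = n} (λ x → x)))))) fits

      -- The column of (v , u) is the row of (u , v) with its pairs reversed, and reversed pairs run
      -- equal programs; so what u can compute is the half that v lacks.
      flip-row : ∀ v u → adj G v u ≡ true → rowSum u v (term (u , v)) ≡ colSum v u (term (v , u))
      flip-row v u vu = ∑-cong (allFin n) pointwise
        where
        pointwise : ∀ w → 𝟙 (adj G u w ∧ not (does (v Fin.≟ w))) * term (u , v) (u , w)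
                        ≡ 𝟙 (adj G w u ∧ not (does (v Fin.≟ w))) * term (v , u) (w , u)
        pointwise w rewrite adj-sym G w u with adj G u w in uw
        ... | false = refl
        ... | true rewrite proj₂ (rep v u vu) | proj₂ (rep u w uw) = refl

      total≡ : ∀ v u → adj G v u ≡ true →
        localSum n Δ (nbrIds v) (π v) (id u)
        + received (foldr (λ u′ rest → if adj G v u′ ∧ (id u′ ≡ᵇ id u) then sendState {n} {Δ} (conf (suc d) π u′) (id v) else rest) nothing (allFin n))
        ≡ nb (v , u) (term (v , u))
      total≡ v u vu = trans (cong₂ _+_ (localSum≡ v u vu) (trans (cong received (inbox≡ (conf (suc d) π) v u vu))
          (trans (cong (decode ∘ encode (msgLen B n)) (localSum≡ u v uv))
            (trans (decode-encode (msgLen B n) _ (rowSum< u v)) (flip-row v u vu)))))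
        (sym (nb-split (cap n Δ) v u (term (v , u)) vu))
        where uv = trans (adj-sym G u v) vu

      nb-flip : ∀ v u → adj G v u ≡ true → nb (v , u) (term (v , u)) ≡ nb (u , v) (term (u , v))
      nb-flip v u vu = trans (nb-split (cap n Δ) v u _ vu) (trans (+-comm (rowSum v u (term (v , u))) _)
        (trans (cong₂ _+_ (sym (flip-row v u vu)) (flip-row u v uv)) (sym (nb-split (cap n Δ) u v _ uv))))
        where uv = trans (adj-sym G u v) vu

    simulates : ∀ d π p → Represents π p → ∀ v u → adj G v u ≡ true →
      output {n} {Δ} (iterate d (conf d π) v) (id u) ≡ exec d p (v , u) × exec d p (v , u) ≡ exec d p (u , v)
    simulates zero    π p rep v u vu = rep v u vu
    simulates (suc d) π p rep v u vu = simulates d _ _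
      (λ v u vu → cong₂ (λ q m → proj₂ (proj₂ q) m) (proj₁ (rep v u vu)) (R.total≡ v u vu)
                , cong₂ (λ q m → proj₂ (proj₂ q) m) (proj₂ (rep v u vu)) (R.nb-flip v u vu)) v u vu
      where module R = Round π p rep

    run-alg : ∀ v u → adj G v u ≡ true →
      let r = exec (depth n Δ) λ (x , y) → program n Δ (id x + id y) (adj G x y) in
      out alg {n} {Δ} (final v) (id u) ≡ r (v , u) × r (v , u) ≡ r (u , v)
    run-alg v u vu = subst (λ st → output {n} {Δ} (st v) (id u) ≡ r (v , u) × r (v , u) ≡ r (u , v))
      (trans (iterate-state (depth n Δ) 0) (cong state (+-identityʳ (depth n Δ))))
      (simulates (depth n Δ) (λ v j → program n Δ (id v + j) true) _
        (λ v u vu → cong (program n Δ (id v + id u)) (sym vu)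
                  , cong₂ (program n Δ) (+-comm (id v) (id u)) (adj-sym G v u)) v u vu)
      where r = exec (depth n Δ) λ (x , y) → program n Δ (id x + id y) (adj G x y)

-- Parameters and running time

1+n≤2^n : ∀ n → suc n ≤ 2 ^ n
1+n≤2^n zero    = ≤-refl
1+n≤2^n (suc n) = ≤-trans (+-mono-≤ (m^n>0 2 n) (1+n≤2^n n)) (≤-reflexive (sym (2^suc n)))

⌊log₂n⌋≤n : ∀ n → ⌊log₂ n ⌋ ≤ n
⌊log₂n⌋≤n n = ≤-trans (⌊log₂⌋-mono-≤ (<⇒≤ (1+n≤2^n n))) (≤-reflexive (⌊log₂[2^n]⌋≡n n))

n<2^1+⌊log₂n⌋ : ∀ n → n < 2 ^ suc ⌊log₂ n ⌋
n<2^1+⌊log₂n⌋ n = ≰⇒> λ le → <-irrefl refl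
  (≤-trans (≤-reflexive (sym (⌊log₂[2^n]⌋≡n (suc ⌊log₂ n ⌋)))) (⌊log₂⌋-mono-≤ le))

2^⌊log₂n⌋≤n : ∀ n → 0 < n → 2 ^ ⌊log₂ n ⌋ ≤ n
2^⌊log₂n⌋≤n = <-rec _ go
  where
  go : ∀ n → (∀ {m} → m < n → 0 < m → 2 ^ ⌊log₂ m ⌋ ≤ m) → 0 < n → 2 ^ ⌊log₂ n ⌋ ≤ n
  go (suc zero)       rec _ = ≤-refl
  go n@(suc (suc m)) rec _ = begin
    2 ^ ⌊log₂ n ⌋                              ≡⟨ cong (2 ^_) log≡ ⟩
    2 * 2 ^ ⌊log₂ ⌊ n /2⌋ ⌋                    ≤⟨ *-monoʳ-≤ 2 (rec (⌊n/2⌋<n (suc m)) z<s) ⟩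
    2 * ⌊ n /2⌋                                ≡⟨ cong (⌊ n /2⌋ +_) (+-identityʳ ⌊ n /2⌋) ⟩
    ⌊ n /2⌋ + ⌊ n /2⌋                          ≤⟨ +-monoʳ-≤ ⌊ n /2⌋ (⌊n/2⌋≤⌈n/2⌉ n) ⟩
    ⌊ n /2⌋ + ⌈ n /2⌉                          ≡⟨ ⌊n/2⌋+⌈n/2⌉≡n n ⟩
    n                                          ∎
    where
    open ≤-Reasoning
    log≡ : ⌊log₂ n ⌋ ≡ suc ⌊log₂ ⌊ n /2⌋ ⌋
    log≡ = sym (trans (cong suc (⌊log₂⌊n/2⌋⌋≡⌊log₂n⌋∸1 n)) (m+[n∸m]≡n (⌊log₂⌋-mono-≤ {2} {n} (s≤s (s≤s z≤n)))))

^-distribʳ-* : ∀ d a b → (a * b) ^ d ≡ a ^ d * b ^ d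
^-distribʳ-* zero    a b = refl
^-distribʳ-* (suc d) a b = trans (cong (a * b *_) (^-distribʳ-* d a b)) (eq a b (a ^ d) (b ^ d))
  where
  eq : ∀ a b c e → a * b * (c * e) ≡ a * c * (b * e)
  eq = solve-∀

-- With q = m / d one has m ≤ d (q + 1) ≤ d 2^q, and the d-th power of this is at most d^d 2^m. It
-- absorbs the powers of J into 2^J = O(L).
m^d≤d^d*2^m : ∀ d .{{_ : NonZero d}} m → m ^ d ≤ d ^ d * 2 ^ m
m^d≤d^d*2^m d m = begin
  m ^ d                     ≤⟨ ^-monoˡ-≤ d m≤ ⟩
  (d * 2 ^ q) ^ d           ≡⟨ ^-distribʳ-* d d (2 ^ q) ⟩
  d ^ d * (2 ^ q) ^ d       ≡⟨ cong (d ^ d *_) (^-*-assoc 2 q d) ⟩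
  d ^ d * 2 ^ (q * d)       ≤⟨ *-monoʳ-≤ (d ^ d) (^-monoʳ-≤ 2 (m/n*n≤m m d)) ⟩
  d ^ d * 2 ^ m             ∎
  where
  open ≤-Reasoning
  q = m / d
  m≤ : m ≤ d * 2 ^ q
  m≤ = begin
    m                  ≡⟨ m≡m%n+[m/n]*n m d ⟩
    m % d + q * d      ≤⟨ +-monoˡ-≤ (q * d) (<⇒≤ (m%n<n m d)) ⟩
    suc q * d          ≤⟨ *-monoˡ-≤ d (1+n≤2^n q) ⟩
    2 ^ q * d          ≡⟨ *-comm (2 ^ q) d ⟩
    d * 2 ^ q          ∎

-- The number is opaque, so that the rounds of 64 phases are never unfolded.
abstract
  phasesPerHalving : ℕ
  phasesPerHalving = 64

  64≤phasesPerHalving : 64 ≤ phasesPerHalving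
  64≤phasesPerHalving = ≤-refl

module Parameters (k n Δ : ℕ) where
  ln lΔ : ℕ
  ln = ⌊log₂ n ⌋
  lΔ = ⌊log₂ Δ ⌋
  -- 2^s₀ exceeds the line degree bound 2 Δ, and 2^L exceeds 16 (2 Δ + 1); 2^J lies between 16 L and
  -- 32 L, and 2^s between 4 J^2 and 16 J^2. `y₀` makes room for sums of two identifiers and `y` for
  -- base colours of 4 + 3 s₀ bits. `J` also serves as the number of reduction steps in a halving,
  -- since y ≤ 2^J. `cap` is at least M 2^s and 2 L M. Exhausting n^2 ordered pairs takes 2 (1 + ln)
  -- halvings.
  s₀ N₀ y₀ L J s y cap phaseCount : ℕ
  s₀ = lΔ + 2
  N₀ = k + ln
  y₀ = k * suc ln + 1
  L = lΔ + 6
  J = ⌊log₂ L ⌋ + 5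
  s = (⌊log₂ J ⌋ + ⌊log₂ J ⌋) + 4
  y = s₀ + s₀ + 1
  cap = 2 ^ (6 * L + 16)
  phaseCount = (suc ln + suc ln) * phasesPerHalving

  slots≡ : 2 ^ J ≡ 16 * 2 ^ suc ⌊log₂ L ⌋
  slots≡ = trans (cong (2 ^_) (eq ⌊log₂ L ⌋)) (^-distribˡ-+-* 2 4 (suc ⌊log₂ L ⌋))
    where
    eq : ∀ a → a + 5 ≡ 4 + suc a
    eq = solve-∀

  16L≤slots : 16 * L ≤ 2 ^ J
  16L≤slots = ≤-trans (*-monoʳ-≤ 16 (<⇒≤ (n<2^1+⌊log₂n⌋ L))) (≤-reflexive (sym slots≡))

  L>0 : 0 < L
  L>0 = ≤-trans (s≤s z≤n) (m≤n+m 6 lΔ)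

  J>0 : 0 < J
  J>0 = ≤-trans (s≤s z≤n) (m≤n+m 5 ⌊log₂ L ⌋)

  slots≤ : 2 ^ J ≤ 32 * L
  slots≤ = begin
    2 ^ J                       ≡⟨ slots≡ ⟩
    16 * (2 * 2 ^ ⌊log₂ L ⌋)    ≡⟨ sym (*-assoc 16 2 (2 ^ ⌊log₂ L ⌋)) ⟩
    32 * 2 ^ ⌊log₂ L ⌋          ≤⟨ *-monoʳ-≤ 32 (2^⌊log₂n⌋≤n L L>0) ⟩
    32 * L                      ∎
    where open ≤-Reasoning

  2^s≡ : 2 ^ s ≡ 16 * (2 ^ ⌊log₂ J ⌋ * 2 ^ ⌊log₂ J ⌋)
  2^s≡ = trans (^-distribˡ-+-* 2 (⌊log₂ J ⌋ + ⌊log₂ J ⌋) 4)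
    (trans (*-comm (2 ^ (⌊log₂ J ⌋ + ⌊log₂ J ⌋)) 16) (cong (16 *_) (^-distribˡ-+-* 2 ⌊log₂ J ⌋ ⌊log₂ J ⌋)))

  4JJ≤2^s : 4 * (J * J) ≤ 2 ^ s
  4JJ≤2^s = begin
    4 * (J * J)                                          ≤⟨ *-monoʳ-≤ 4 (*-mono-≤ (<⇒≤ (n<2^1+⌊log₂n⌋ J)) (<⇒≤ (n<2^1+⌊log₂n⌋ J))) ⟩
    4 * (2 * p * (2 * p))                                ≡⟨ eq p ⟩
    16 * (p * p)                                         ≡⟨ sym 2^s≡ ⟩
    2 ^ s                                                ∎
    where
    open ≤-Reasoning
    p = 2 ^ ⌊log₂ J ⌋
    eq : ∀ p → 4 * (2 * p * (2 * p)) ≡ 16 * (p * p)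
    eq = solve-∀

  2^s≤ : 2 ^ s ≤ 16 * (J * J)
  2^s≤ = ≤-trans (≤-reflexive 2^s≡) (*-monoʳ-≤ 16 (*-mono-≤ (2^⌊log₂n⌋≤n J J>0) (2^⌊log₂n⌋≤n J J>0)))

  y≤2^J : y ≤ 2 ^ J
  y≤2^J = ≤-trans (≤-trans (≤-reflexive (eq lΔ)) (+-mono-≤ (*-monoˡ-≤ lΔ (m≤m+n 2 14)) (m≤m+n 5 91)))
            (≤-trans (≤-reflexive (eq′ lΔ)) 16L≤slots)
    where
    eq : ∀ a → (a + 2) + (a + 2) + 1 ≡ 2 * a + 5
    eq = solve-∀
    eq′ : ∀ a → 16 * a + 96 ≡ 16 * (a + 6)
    eq′ = solve-∀

  y₀≤2^N₀ : y₀ ≤ 2 ^ N₀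
  y₀≤2^N₀ = begin
    k * suc ln + 1         ≤⟨ +-monoʳ-≤ (k * suc ln) (s≤s z≤n) ⟩
    k * suc ln + suc ln    ≡⟨ +-comm (k * suc ln) (suc ln) ⟩
    suc k * suc ln         ≤⟨ *-mono-≤ (1+n≤2^n k) (1+n≤2^n ln) ⟩
    2 ^ k * 2 ^ ln         ≡⟨ sym (^-distribˡ-+-* 2 k ln) ⟩
    2 ^ N₀                 ∎
    where open ≤-Reasoning

  J≤ : J ≤ L + 5
  J≤ = +-monoˡ-≤ 5 (⌊log₂n⌋≤n L)

  s≤ : s ≤ 2 * L + 14
  s≤ = ≤-trans (+-monoˡ-≤ 4 (+-mono-≤ half half)) (≤-reflexive (eq L))
    where
    half : ⌊log₂ J ⌋ ≤ L + 5
    half = ≤-trans (⌊log₂n⌋≤n J) J≤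
    eq : ∀ l → (l + 5) + (l + 5) + 4 ≡ 2 * l + 14
    eq = solve-∀

  M : ℕ
  M = 2 ^ L * (2 ^ L * 2 ^ L)

  M≡ : M ≡ 2 ^ (L + (L + L))
  M≡ = sym (trans (^-distribˡ-+-* 2 L (L + L)) (cong (2 ^ L *_) (^-distribˡ-+-* 2 L L)))

  power≤cap : ∀ e → e ≤ 6 * L + 16 → 2 ^ e ≤ cap
  power≤cap e = ^-monoʳ-≤ 2

  M2^s≤cap : M * 2 ^ s ≤ cap
  M2^s≤cap = ≤-trans (≤-reflexive (trans (cong (_* 2 ^ s) M≡) (sym (^-distribˡ-+-* 2 (L + (L + L)) s))))
    (power≤cap (L + (L + L) + s) (≤-trans (+-monoʳ-≤ (L + (L + L)) s≤) (≤-trans (m≤m+n _ (L + 2)) (≤-reflexive (eq L)))))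
    where
    eq : ∀ l → l + (l + l) + (2 * l + 14) + (l + 2) ≡ 6 * l + 16
    eq = solve-∀

  2LM≤cap : 2 * L * M ≤ cap
  2LM≤cap = ≤-trans (*-mono-≤ (*-monoʳ-≤ 2 (≤-trans (n≤1+n L) (1+n≤2^n L))) (≤-reflexive M≡))
    (≤-trans (≤-reflexive (sym (^-distribˡ-+-* 2 (suc L) (L + (L + L)))))
      (power≤cap (suc L + (L + (L + L))) (≤-trans (m≤m+n _ (2 * L + 15)) (≤-reflexive (eq L)))))
    where
    eq : ∀ l → suc l + (l + (l + l)) + (2 * l + 15) ≡ 6 * l + 16
    eq = solve-∀

  2M≤cap : 2 * M ≤ cap
  2M≤cap = ≤-trans (*-monoˡ-≤ M (m≤m*n 2 L {{>-nonZero L>0}})) 2LM≤cap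

  2^s₀≤cap : 2 ^ s₀ ≤ cap
  2^s₀≤cap = power≤cap s₀ (≤-trans (m≤m+n _ (5 * lΔ + 50)) (≤-reflexive (eq lΔ)))
    where
    eq : ∀ a → a + 2 + (5 * a + 50) ≡ 6 * (a + 6) + 16
    eq = solve-∀

  cap>0 : 1 ≤ cap
  cap>0 = m^n>0 2 (6 * L + 16)

  base-bits : 4 + 3 * s₀ ≤ 2 + 3 * s + 2 * y
  base-bits = ≤-trans (m≤m+n _ (3 * s + s₀)) (≤-reflexive (eq s₀ s))
    where
    eq : ∀ a b → 4 + 3 * a + (3 * b + a) ≡ 2 + 3 * b + 2 * (a + a + 1)
    eq = solve-∀

  colour-bits : suc (suc ln * k) ≤ 2 + 3 * s₀ + 2 * y₀
  colour-bits = ≤-trans (m≤m+n _ (3 + 3 * s₀ + k * suc ln)) (≤-reflexive (eq k ln s₀))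
    where
    eq : ∀ k l a → suc (suc l * k) + (3 + 3 * a + k * suc l) ≡ 2 + 3 * a + 2 * (k * suc l + 1)
    eq = solve-∀

  Δ-bound : 2 * suc Δ ≤ 2 ^ s₀
  Δ-bound = ≤-trans (*-monoʳ-≤ 2 (n<2^1+⌊log₂n⌋ Δ)) (≤-reflexive (cong (2 ^_) (+-comm 2 lΔ)))

  32Δ-bound : 32 * suc Δ ≤ 2 ^ L
  32Δ-bound = ≤-trans (*-monoʳ-≤ 32 (n<2^1+⌊log₂n⌋ Δ))
    (≤-reflexive (trans (sym (^-distribˡ-+-* 2 5 (suc lΔ))) (cong (2 ^_) (eq lΔ))))
    where
    eq : ∀ a → 5 + suc a ≡ a + 6
    eq = solve-∀

  -- Since lΔ ≤ ln, the exponent is at most 7 ln + 53, which 54 (1 + ln) bits accommodate.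
  fits : Δ ≤ n → n * cap < 2 ^ (54 * suc ln)
  fits Δ≤n = begin-strict
    n * cap                           <⟨ *-monoˡ-< cap {{m^n≢0 2 (6 * L + 16)}} (n<2^1+⌊log₂n⌋ n) ⟩
    2 ^ suc ln * cap                  ≡⟨ sym (^-distribˡ-+-* 2 (suc ln) (6 * L + 16)) ⟩
    2 ^ (suc ln + (6 * L + 16))       ≤⟨ ^-monoʳ-≤ 2 (≤-trans (+-monoʳ-≤ (suc ln) (+-monoˡ-≤ 16 (*-monoʳ-≤ 6 (+-monoˡ-≤ 6 (⌊log₂⌋-mono-≤ Δ≤n))))) (≤-trans (m≤m+n _ (47 * ln + 1)) (≤-reflexive (eq ln)))) ⟩
    2 ^ (54 * suc ln)                 ∎
    where
    open ≤-Reasoning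
    eq : ∀ l → suc l + (6 * (l + 6) + 16) + (47 * l + 1) ≡ 54 * suc l
    eq = solve-∀

  nn-bound : n * n < 2 ^ (suc ln + suc ln)
  nn-bound = subst (n * n <_) (sym (^-distribˡ-+-* 2 (suc ln) (suc ln)))
    (*-mono-< (n<2^1+⌊log₂n⌋ n) (n<2^1+⌊log₂n⌋ n))

  classes levelDepth : ℕ
  classes = 2 ^ (4 + 3 * s)
  levelDepth = J * (J * (s * 2) + classes * 2) + 2 ^ J * 2

  phaseDepth depth : ℕ
  phaseDepth = suc (L * levelDepth + 2)
  depth = N₀ * (s₀ * 2) + (phaseCount * phaseDepth + 0)

-- The size 2^s = O(J^2) gives O(J^6) crude classes, and these are swept in each of J halvings,
-- whence the exponent 7.
refine-time : ∀ A C D J q s K P → q ≤ A * (J * J) → s ≤ q → K ≤ C * (q * (q * q)) → J ^ 7 ≤ D * P → 0 < J →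
              J * (J * (s * 2) + K * 2) ≤ (2 * A + 2 * C * (A * A * A)) * D * P
refine-time A C D J q s K P q≤ s≤ K≤ J⁷≤ J>0 = begin
  J * (J * (s * 2) + K * 2)                              ≤⟨ *-monoʳ-≤ J (+-mono-≤ (*-monoʳ-≤ J (*-monoˡ-≤ 2 (≤-trans s≤ q≤))) (*-monoˡ-≤ 2 (≤-trans K≤ (*-monoʳ-≤ C (*-mono-≤ q≤ (*-mono-≤ q≤ q≤)))))) ⟩
  J * (J * (A * (J * J) * 2) + C * (A * (J * J) * (A * (J * J) * (A * (J * J)))) * 2) ≡⟨ e₁ A C J ⟩
  2 * A * J ^ 4 + 2 * C * (A * A * A) * J ^ 7            ≤⟨ +-monoˡ-≤ _ (*-monoʳ-≤ (2 * A) (^-monoʳ-≤ J {{>-nonZero J>0}} {4} {7} (s≤s (s≤s (s≤s (s≤s z≤n)))))) ⟩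
  2 * A * J ^ 7 + 2 * C * (A * A * A) * J ^ 7            ≡⟨ sym (*-distribʳ-+ (J ^ 7) (2 * A) (2 * C * (A * A * A))) ⟩
  (2 * A + 2 * C * (A * A * A)) * J ^ 7                  ≤⟨ *-monoʳ-≤ (2 * A + 2 * C * (A * A * A)) J⁷≤ ⟩
  (2 * A + 2 * C * (A * A * A)) * (D * P)                ≡⟨ sym (*-assoc (2 * A + 2 * C * (A * A * A)) D P) ⟩
  (2 * A + 2 * C * (A * A * A)) * D * P                  ∎
  where
  open ≤-Reasoning
  e₁ : ∀ A C J → J * (J * (A * (J * J) * 2) + C * (A * (J * J) * (A * (J * J) * (A * (J * J)))) * 2)
                 ≡ 2 * A * (J * (J * (J * (J * 1)))) + 2 * C * (A * A * A) * (J * (J * (J * (J * (J * (J * (J * 1)))))))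
  e₁ = solve-∀

levelDepth-linear : ∃ λ c → ∀ k n Δ → Parameters.levelDepth k n Δ ≤ c * Parameters.L k n Δ
levelDepth-linear = linear 16 16 (7 ^ 7) 32 refl refl (m^d≤d^d*2^m 7) refl
  where
  -- The numerals enter as variables, so the bound is derived symbolically and 7^7 is not expanded.
  linear : ∀ A C D E → A ≡ 16 → C ≡ 16 → (∀ m → m ^ 7 ≤ D * 2 ^ m) → E ≡ 32 →
           ∃ λ c → ∀ k n Δ → Parameters.levelDepth k n Δ ≤ c * Parameters.L k n Δ
  linear A C D E A≡ C≡ D≤ E≡ = ((2 * A + 2 * C * (A * A * A)) * D + 2) * E , λ k n Δ → bound k n Δ
    where
    bound : ∀ k n Δ → Parameters.levelDepth k n Δ ≤ ((2 * A + 2 * C * (A * A * A)) * D + 2) * E * Parameters.L k n Δ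
    bound k n Δ = begin
      J * (J * (s * 2) + classes * 2) + 2 ^ J * 2
        ≤⟨ +-mono-≤ (refine-time A C D J (2 ^ s) s classes (2 ^ J) (subst (λ a → 2 ^ s ≤ a * (J * J)) (sym A≡) 2^s≤)
             (≤-trans (n≤1+n s) (1+n≤2^n s)) (≤-reflexive classes≡) (D≤ J) J>0) (≤-reflexive (*-comm (2 ^ J) 2)) ⟩
      F * 2 ^ J + 2 * 2 ^ J          ≡⟨ sym (*-distribʳ-+ (2 ^ J) F 2) ⟩
      (F + 2) * 2 ^ J                ≤⟨ *-monoʳ-≤ (F + 2) (subst (λ e → 2 ^ J ≤ e * L) (sym E≡) slots≤) ⟩
      (F + 2) * (E * L)              ≡⟨ sym (*-assoc (F + 2) E L) ⟩
      (F + 2) * E * L                ∎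
      where
      open ≤-Reasoning
      open Parameters k n Δ
      F = (2 * A + 2 * C * (A * A * A)) * D
      classes≡ : classes ≡ C * (2 ^ s * (2 ^ s * 2 ^ s))
      classes≡ = trans (^-distribˡ-+-* 2 4 (3 * s)) (cong₂ _*_ (sym C≡) (trans (cong (2 ^_) (eq s))
        (trans (^-distribˡ-+-* 2 s (s + s)) (cong (2 ^ s *_) (^-distribˡ-+-* 2 s s)))))
        where
        eq : ∀ s → 3 * s ≡ s + (s + s)
        eq = solve-∀

-- The first summand pays for the base colouring, the second for the phases; 36 comes from L ≤ 6 (1
-- + lΔ).
timeConstant : ℕ → ℕ → ℕ
timeConstant c k = suc k * 4 + 2 * phasesPerHalving * ((c + 3) * 36)

depth-bound : ∀ c k n Δ → (let open Parameters k n Δ) → levelDepth ≤ c * L →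
              depth ≤ timeConstant c k * (suc lΔ * suc lΔ) * suc ln
depth-bound c k n Δ linear = begin
  N₀ * (s₀ * 2) + (phaseCount * phaseDepth + 0)
    ≤⟨ +-mono-≤ (*-mono-≤ N₀≤ s₀≤) (≤-trans (≤-reflexive (+-identityʳ (phaseCount * phaseDepth))) (*-monoʳ-≤ phaseCount phaseDepth≤)) ⟩
  suc k * suc ln * (4 * Λ) + (suc ln + suc ln) * phasesPerHalving * ((c + 3) * (36 * Λ))
    ≡⟨ e₁ (suc k) (suc ln) phasesPerHalving (c + 3) Λ ⟩
  (suc k * 4 + 2 * phasesPerHalving * ((c + 3) * 36)) * Λ * suc ln ∎
  where
  open ≤-Reasoning
  open Parameters k n Δ
  Λ = suc lΔ * suc lΔ
  e₁ : ∀ k l q c Λ → k * l * (4 * Λ) + (l + l) * q * (c * (36 * Λ)) ≡ (k * 4 + 2 * q * (c * 36)) * Λ * l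
  e₁ = solve-∀
  N₀≤ : N₀ ≤ suc k * suc ln
  N₀≤ = ≤-trans (m≤m+n (k + ln) (1 + k * ln)) (≤-reflexive (eq k ln))
    where
    eq : ∀ k l → k + l + (1 + k * l) ≡ suc k * suc l
    eq = solve-∀
  s₀≤ : s₀ * 2 ≤ 4 * Λ
  s₀≤ = ≤-trans (m≤m+n ((lΔ + 2) * 2) (6 * lΔ + 4 * (lΔ * lΔ))) (≤-reflexive (eq lΔ))
    where
    eq : ∀ a → (a + 2) * 2 + (6 * a + 4 * (a * a)) ≡ 4 * (suc a * suc a)
    eq = solve-∀
  LL≤ : L * L ≤ 36 * Λ
  LL≤ = ≤-trans (m≤m+n ((lΔ + 6) * (lΔ + 6)) (60 * lΔ + 35 * (lΔ * lΔ))) (≤-reflexive (eq lΔ))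
    where
    eq : ∀ a → (a + 6) * (a + 6) + (60 * a + 35 * (a * a)) ≡ 36 * (suc a * suc a)
    eq = solve-∀
  phaseDepth≤ : phaseDepth ≤ (c + 3) * (36 * Λ)
  phaseDepth≤ = begin
    suc (L * levelDepth + 2)           ≡⟨ sym (+-suc (L * levelDepth) 2) ⟩
    L * levelDepth + 3                 ≤⟨ +-mono-≤ (*-monoʳ-≤ L (linear)) (m≤m*n 3 (L * L) {{m*n≢0 L L {{>-nonZero L>0}} {{>-nonZero L>0}}}}) ⟩
    L * (c * L) + 3 * (L * L)          ≡⟨ e₂ L c ⟩
    (c + 3) * (L * L)                  ≤⟨ *-monoʳ-≤ (c + 3) LL≤ ⟩
    (c + 3) * (36 * Λ)                 ∎
    where
    e₂ : ∀ l c → l * (c * l) + 3 * (l * l) ≡ (c + 3) * (l * l)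
    e₂ = solve-∀

-- The algorithm

-- Disjointness at a node only needs independence within rows. An edge covered through its column is
-- covered through a row of the other endpoint, because `matched` is symmetric.
outputs-maximal-matching :
  ∀ (A : CongestAlg) {n} Δ (G : Graph n) (id : Fin n → ℕ) (matched : Fin n × Fin n → Bool) →
  let open Execution A Δ G id
      open Network G using (κ) in
  (∀ v u → adj G v u ≡ true → out A {n} {Δ} (final v) (id u) ≡ matched (v , u) × matched (v , u) ≡ matched (u , v)) →
  (∀ {e} → matched e ≡ true → adj G (proj₁ e) (proj₂ e) ≡ true) →
  (∀ {e f} → matched e ≡ true → matched f ≡ true → κ e f ≡ true → ⊥) →
  (∀ e → adj G (proj₁ e) (proj₂ e) ≡ true → matched e ≡ true ⊎ ∃ λ f → κ e f ≡ true × matched f ≡ true) →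
  OutputsMaximalMatching
outputs-maximal-matching A {n} Δ G id matched out≡ matched-edge independent covered = agree , unique , maximal
  where
  open Execution A Δ G id
  open Network G
  open LineGraph lineGraph
  agree : ∀ u v → adj G u v ≡ true → out A {n} {Δ} (final u) (id v) ≡ out A {n} {Δ} (final v) (id u)
  agree u v uv = trans (proj₁ (out≡ u v uv)) (trans (proj₂ (out≡ u v uv)) (sym (proj₁ (out≡ v u (trans (adj-sym G v u) uv)))))
  inM⇒matched : ∀ {u v} → InM u v → matched (u , v) ≡ true
  inM⇒matched {u} {v} (uv , o) = trans (sym (proj₁ (out≡ u v uv))) o
  matched⇒inM : ∀ {u v} → matched (u , v) ≡ true → InM u v
  matched⇒inM {u} {v} m = uv , trans (proj₁ (out≡ u v uv)) m
    where uv = matched-edge m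
  flip : ∀ {u v} → matched (u , v) ≡ true → matched (v , u) ≡ true
  flip {u} {v} m = trans (sym (proj₂ (out≡ u v (matched-edge m)))) m
  unique : ∀ u v w → InM u v → InM u w → v ≡ w
  unique u v w m m′ with v Fin.≟ w
  ... | yes p = p
  ... | no v≢w = ⊥-elim (independent (inM⇒matched m) (inM⇒matched m′)
                   (row-κ (proj₁ m) (proj₁ m′) refl λ p → v≢w (cong proj₂ p)))
  maximal : ∀ u v → adj G u v ≡ true → (∃ λ w → InM u w) ⊎ (∃ λ w → InM v w)
  maximal u v uv with covered (u , v) uv
  ... | inj₁ m = inj₁ (v , matched⇒inM m)
  ... | inj₂ ((x , y) , k≡ , m) with κ-key k≡
  ...   | inj₁ p = inj₁ (y , matched⇒inM (subst (λ t → matched (t , y) ≡ true) (sym (Fin.toℕ-injective p)) m))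
  ...   | inj₂ q = inj₂ (x , matched⇒inM (flip (subst (λ t → matched (x , t) ≡ true) (sym (Fin.toℕ-injective q)) m)))

colourDepth : ℕ → ℕ → ℕ → ℕ
colourDepth k n Δ = let open Parameters k n Δ in N₀ * (s₀ * 2)

-- With unit weights the total at an edge is its degree, below 2^s₀, so `reduce-proper` applies.
-- About log y₀ steps would do, but the N₀ steps taken still fit the budget because this is done
-- only once.
colouring : ∀ k n Δ → ℕ → EProg (colourDepth k n Δ) ℕ
colouring k n Δ c = let open Parameters k n Δ in Lines.reduce s₀ (λ _ _ → 1) N₀ y₀ c ⟨ 0 , 0 , 0 , 0 ⟩

-- The initial colour c of the edge uv is id u + id v: adjacent edges share one summand only.
program : ∀ k n Δ → ℕ → Bool → EProg (Parameters.depth k n Δ) Bool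
program k n Δ c alive = bind (colourDepth k n Δ) (colouring k n Δ c) λ b →
  bind (phaseCount * phaseDepth) (Matching.phases L s y J J phaseCount b (alive , false)) proj₂
  where open Parameters k n Δ

module Correctness (k : ℕ) {n Δ : ℕ} (G : Graph n) (deg≤ : ∀ v → degree G v ≤ Δ) (Δ≤n : Δ ≤ n)
                   (id : Fin n → ℕ) (id-injective : ∀ u v → id u ≡ id v → u ≡ v) (id< : ∀ v → id v < n ^ k) where
  open Parameters k n Δ
  open Network G
  open Semantics items κ cap
  open LineGraph lineGraph
  open LineGraphSums items κ cap lineGraph

  degree-bound : ∀ e → nb e (λ _ → 1) ≤ 2 * Δ
  degree-bound (v , u) = by-cases (adj G v u) refl
    where
    open ≤-Reasoning
    row≤ : rowSum v u (λ _ → 1) ≤ Δ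
    row≤ = ≤-trans (∑-mono (allFin n) λ w → ≤-trans (≤-reflexive (*-identityʳ _)) (𝟙-∧≤ (adj G v w) _)) (deg≤ v)
      where
      𝟙-∧≤ : ∀ a b → 𝟙 (a ∧ b) ≤ 𝟙 a
      𝟙-∧≤ true  b = 𝟙≤1 b
      𝟙-∧≤ false b = z≤n
    col≤ : colSum v u (λ _ → 1) ≤ Δ
    col≤ = ≤-trans (∑-mono (allFin n) pointwise) (deg≤ u)
      where
      pointwise : ∀ w → 𝟙 (adj G w u ∧ not (does (v Fin.≟ w))) * 1 ≤ 𝟙 (adj G u w)
      pointwise w rewrite adj-sym G u w with adj G w u
      ... | false = z≤n
      ... | true  = ≤-trans (≤-reflexive (*-identityʳ (𝟙 (not (does (v Fin.≟ w)))))) (𝟙≤1 (not (does (v Fin.≟ w))))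
    by-cases : ∀ b → adj G v u ≡ b → nb (v , u) (λ _ → 1) ≤ 2 * Δ
    by-cases true  vu = begin
      nb (v , u) (λ _ → 1)                                ≡⟨ nb-split cap v u _ vu ⟩
      rowSum v u (λ _ → 1) + colSum v u (λ _ → 1)         ≤⟨ +-mono-≤ row≤ col≤ ⟩
      Δ + Δ                                               ≡⟨ cong (Δ +_) (sym (+-identityʳ Δ)) ⟩
      2 * Δ                                               ∎
    by-cases false vu = ≤-trans (≤-reflexive (trans (∑-cong items vanish) (∑-zero items))) z≤n
      where
      vanish : ∀ f → 𝟙 (κ (v , u) f) * 1 ≡ 0
      vanish f rewrite vu = refl

  colour₀ : Fin n × Fin n → ℕ
  colour₀ (v , u) = id v + id u

  colour₀-bound : ∀ e → colour₀ e < 2 ^ (2 + 3 * s₀ + 2 * y₀)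
  colour₀-bound (v , u) = <-≤-trans
    (subst (colour₀ (v , u) <_) (sym (2^suc (suc ln * k))) (+-mono-< (<-≤-trans (id< v) n^k≤) (<-≤-trans (id< u) n^k≤)))
    (^-monoʳ-≤ 2 colour-bits)
    where
    n^k≤ : n ^ k ≤ 2 ^ (suc ln * k)
    n^k≤ = ≤-trans (^-monoˡ-≤ k (<⇒≤ (n<2^1+⌊log₂n⌋ n))) (≤-reflexive (^-*-assoc 2 (suc ln) k))

  colour₀-proper : ∀ e f → κ e f ≡ true → colour₀ e ≢ colour₀ f
  colour₀-proper (v , u) (x , y) k≡ p with v Fin.≟ x | u Fin.≟ y | proj₂ (∧-true {adj G x y} (proj₂ (∧-true {adj G v u} k≡)))
  ... | yes refl | no u≢y  | _ = u≢y (id-injective u y (+-cancelˡ-≡ (id v) _ _ p))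
  ... | no v≢x   | yes refl | _ = v≢x (id-injective v x (+-cancelʳ-≡ (id u) _ _ p))

  module L₀ = Lines.Spec s₀ (λ _ _ → 1) items κ cap
    (λ _ _ → ≤-trans (≤-reflexive (*-identityˡ (2 ^ s₀))) 2^s₀≤cap) (λ _ → ⟨ 0 , 0 , 0 , 0 ⟩)

  base : Fin n × Fin n → ℕ
  base = L₀.reduced N₀ y₀ colour₀

  base-bound : ∀ e → base e < 2 ^ (2 + 3 * s + 2 * y)
  base-bound e = <-≤-trans (L₀.reduce-bound N₀ y₀ colour₀ y₀≤2^N₀ colour₀-bound e) (^-monoʳ-≤ 2 base-bits)

  base-proper : ∀ e f → κ e f ≡ true → base e ≢ base f
  base-proper e f k≡ p = <⇒≢ (nb-positive (λ h → base e ≡ᵇ base h) e f k≡ (trans (cong (base e ≡ᵇ_) (sym p)) (≡ᵇ-refl (base e))))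
    (sym (trans (nb-cong e λ h → sym (*-identityˡ (𝟙 (base e ≡ᵇ base h)))) (L₀.reduce-proper small N₀ y₀ colour₀ proper₀ e)))
    where
    small : ∀ e → L₀.total e < 2 ^ s₀
    small e = ≤-trans (s≤s (degree-bound e)) (≤-trans (≤-trans (n≤1+n _) (≤-reflexive (eq Δ))) Δ-bound)
      where
      eq : ∀ d → suc (suc (2 * d)) ≡ 2 * suc d
      eq = solve-∀
    proper₀ : ∀ e → L₀.mono colour₀ e ≡ 0
    proper₀ e = trans (∑-cong items vanish) (∑-zero items)
      where
      vanish : ∀ f → 𝟙 (κ e f) * (1 * 𝟙 (colour₀ e ≡ᵇ colour₀ f)) ≡ 0
      vanish f with κ e f in eq
      ... | false = refl
      ... | true rewrite ≢⇒≡ᵇ-false (colour₀ e) (colour₀ f) (colour₀-proper e f eq) = refl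

  16deg≤ : ∀ e → 16 * suc (nb e (λ _ → 1)) ≤ 2 ^ L
  16deg≤ e = ≤-trans (*-monoʳ-≤ 16 (s≤s (degree-bound e)))
    (≤-trans (≤-trans (m≤m+n _ 16) (≤-reflexive (eq Δ))) 32Δ-bound)
    where
    eq : ∀ d → 16 * suc (2 * d) + 16 ≡ 32 * suc d
    eq = solve-∀

  module P = Matching.Spec L s y J J items κ lineGraph cap cap>0 M2^s≤cap 2M≤cap 2LM≤cap y≤2^J
    {{>-nonZero J>0}} 4JJ≤2^s 16L≤slots L>0 16deg≤ base base-proper base-bound

  state₀ : Fin n × Fin n → Bool × Bool
  state₀ e = edge e , false

  inv₀ : P.Inv state₀
  inv₀ = record
    { alive-edge   = λ p → p
    ; matched-edge = λ ()
    ; independent  = λ ()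
    ; free         = λ _ ()
    ; covered      = λ e p → inj₁ p
    }

  end : Fin n × Fin n → Bool × Bool
  end = P.phased phaseCount state₀

  module E = P.Invariant (P.phased-inv phaseCount state₀ inv₀)

  size₀ : P.remaining state₀ ≤ n * n
  size₀ = begin
    ∑ items (λ e → 𝟙 (edge e))          ≤⟨ ∑-mono items (λ e → 𝟙≤1 (edge e)) ⟩
    ∑ items (λ _ → 1)                   ≡⟨ ∑-cartesianProduct (allFin n) (allFin n) _ ⟩
    ∑ (allFin n) (λ _ → ∑ (allFin n) (λ _ → 1)) ≡⟨ ∑-const (allFin n) _ ⟩
    _                                   ≡⟨ cong₂ _*_ len (trans (∑-const (allFin n) 1) (trans (*-identityʳ _) len)) ⟩
    n * n                               ∎
    where
    open ≤-Reasoning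
    len = length-tabulate {n = n} (λ (i : Fin n) → i)

  exhausted : P.remaining end ≡ 0
  exhausted = n<1⇒n≡0 (*-cancelˡ-< (2 ^ (suc ln + suc ln)) _ 1 (begin-strict
    2 ^ (suc ln + suc ln) * P.remaining end  ≤⟨ P.phased-halves phasesPerHalving 64≤phasesPerHalving (suc ln + suc ln) state₀ inv₀ ⟩
    P.remaining state₀                       ≤⟨ size₀ ⟩
    n * n                                    <⟨ nn-bound ⟩
    2 ^ (suc ln + suc ln)                    ≡⟨ sym (*-identityʳ _) ⟩
    2 ^ (suc ln + suc ln) * 1                ∎))
    where open ≤-Reasoning

  none-alive : ∀ e → proj₁ (end e) ≡ false
  none-alive = none-counted (λ e → proj₁ (end e)) exhausted

  matched : Fin n × Fin n → Bool
  matched e = proj₂ (end e)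

  run≡ : exec depth (λ (x , y) → program k n Δ (id x + id y) (adj G x y)) ≡ matched
  run≡ = trans (exec-bind (colourDepth k n Δ) (λ (x , y) → colouring k n Δ (id x + id y)) finish)
    (exec-bind (phaseCount * phaseDepth) (λ e → main (base e) (state₀ e)) (λ _ → proj₂))
    where
    main : ℕ → Bool × Bool → EProg (phaseCount * phaseDepth) (Bool × Bool)
    main = Matching.phases L s y J J phaseCount
    finish : Fin n × Fin n → ℕ → EProg (phaseCount * phaseDepth + 0) Bool
    finish e b = bind (phaseCount * phaseDepth) (main b (state₀ e)) proj₂

  module Sim = Simulation 54 k (Parameters.depth k) (Parameters.cap k) (program k)
  open Execution Sim.alg Δ G id

  out≡ : ∀ v u → adj G v u ≡ true → out Sim.alg {n} {Δ} (final v) (id u) ≡ matched (v , u) × matched (v , u) ≡ matched (u , v)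
  out≡ v u vu = subst (λ r → out Sim.alg {n} {Δ} (final v) (id u) ≡ r (v , u) × r (v , u) ≡ r (u , v)) run≡
    (Sim.Run.run-alg Δ G id id-injective id< (fits Δ≤n) v u vu)

  correct : OutputsMaximalMatching
  correct = outputs-maximal-matching Sim.alg Δ G id matched out≡ E.matched-edge E.independent
    (λ e p → drop-alive (none-alive e) (E.covered e p))
    where
    drop-alive : ∀ {a} {A : Set} → a ≡ false → a ≡ true ⊎ A → A
    drop-alive refl (inj₁ ())
    drop-alive refl (inj₂ p) = p

maxDegree≤n : ∀ {n Δ} (G : Graph n) → MaxDegree G Δ → Δ ≤ n
maxDegree≤n {n} G (_ , v , refl) = ≤-trans (∑-mono (allFin n) λ u → 𝟙≤1 (adj G v u))
  (≤-reflexive (trans (∑-const (allFin n) 1) (trans (*-identityʳ _) (length-tabulate {n = n} λ i → i))))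

theorem4p9 : ∀ (k : ℕ) → Σ CongestAlg λ A → ∃ λ c → SolvesMaximalMatchingInRounds k A c
theorem4p9 k = assemble levelDepth-linear
  where
  assemble : (∃ λ c → ∀ k n Δ → Parameters.levelDepth k n Δ ≤ c * Parameters.L k n Δ) →
             Σ CongestAlg λ A → ∃ λ c → SolvesMaximalMatchingInRounds k A c
  assemble (c , linear) = Simulation.alg 54 k (Parameters.depth k) (Parameters.cap k) (program k) , timeConstant c k , λ n Δ G max (id , id-injective , id<) →
    depth-bound c k n Δ (linear k n Δ) , Correctness.correct k G (proj₁ max) (maxDegree≤n G max) id id-injective id<
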